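{- Let $QR_{20}$ denote the extended quadratic residue code of length $20$ over $\mathrm{GF}(7)$. Then $QR_{20}$ is a self-dual $[20,10,9]$ code over $\mathrm{GF}(7)$ with $A_7(QR_{20})\cong D_{20}^+$. Moreover, every self-dual $[20,10,9]$ code $C$ over $\mathrm{GF}(7)$ such that $A_7(C)\cong D_{20}^+$ is equivalent to $QR_{20}$.
   Context: An $[n,k,d]$ code over $\mathrm{GF}(p)$ is a $k$-dimensional subspace of $\mathrm{GF}(p)^n$ with minimum nonzero Hamming weight $d$. A code $C$ is self-dual if $C=C^\perp$ with respect to the standard inner product. Two codes $C,C'$ of length $n$ are equivalent if there is an $n\times n$ $(1,-1,0)$-monomial matrix $M$ (a permutation matrix with some entries replaced by $-1$) with $C'=\{cM\mid c\in C\}$. The extended quadratic residue code $QR_{20}$ is obtained by extending the quadratic residue code of prime length $19$ over $\mathrm{GF}(7)$ (note $7$ is a quadratic residue mod $19$) by one coordinate, in the standard way making it self-dual. Construction A: let $\varepsilon_1,\dots,\varepsilon_n$ be an orthogonal basis of $\mathbb{R}^n$ with $(\varepsilon_i,\varepsilon_j)=p\,\delta_{i,j}$. For a code $C$ of length $n$ over $\mathrm{GF}(p)$, $A_p(C)=\{\frac1p\sum_{i=1}^n x_i\varepsilon_i \mid x\in\mathbb{Z}^n,\ x \bmod p\in C\}$. Lattices $L,L'\subset\mathbb{R}^n$ are isomorphic ($L\cong L'$) if $L'=\{xA\mid x\in L\}$ for some orthogonal matrix $A$. With $e_1,\dots,e_{20}$ the standard basis of $\mathbb{R}^{20}$: $D_{20}=\{\sum\alpha_ie_i\mid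 \alpha\in\mathbb{Z}^{20},\ \sum\alpha_i\equiv 0\pmod 2\}$ and $D_{20}^+=\langle D_{20},\tfrac12\mathbf{1}\rangle$, where $\mathbf 1$ is the all-one vector. -}

module Defs where

open import Algebra.Bundles using (CommutativeMonoid)
open import Algebra.Bundles.Raw using (RawRing)
import Algebra.Definitions.RawSemiring as RawSemiringDefs
import Algebra.Properties.CommutativeSemigroup as CommutativeSemigroupProperties
open import Data.Bool.Base using (if_then_else_)
open import Data.Fin.Base as Fin using (Fin; toℕ)
open import Data.Fin.Permutation using (Permutation′; _⟨$⟩ʳ_)
import Data.Fin.Properties as Fin
open import Data.Integer.Base as ℤ using (ℤ; +_; 0ℤ; 1ℤ; _%ℕ_)
import Data.Integer.Divisibility as ℤ
open import Data.Nat.Base as ℕ using (ℕ; NonZero)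
open import Data.Nat.DivMod using (_mod_)
import Data.Nat.Properties as ℕ
open import Data.Product.Base using (_×_; _,_; ∃)
open import Data.Rational.Base as ℚ using (ℚ; 0ℚ; 1ℚ; ½; ∣_∣)
import Data.Rational.Properties as ℚ
open import Data.Sign.Base using (Sign)
open import Data.Vec.Base using (tabulate; count)
open import Data.Vec.Functional using (Vector; head; tail; transpose)
open import Function.Base using (_∘_)
open import Level using (0ℓ)
open import Relation.Binary.PropositionalEquality
  using (_≡_; _≢_; refl; sym; cong; cong₂; subst; module ≡-Reasoning)
open import Relation.Nullary.Decidable using (does; ¬?)
open import Relation.Nullary.Negation using (¬_)
open import Relation.Unary using (Pred; _∈_; _≐_; _∪_; U)

------------------------------------------------------------------------
-- Linear algebra with coordinate row vectors

module LinearAlgebra (R : RawRing 0ℓ 0ℓ) where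
  open RawRing R
  open RawSemiringDefs rawSemiring using (sum)

  Matrix : ℕ → ℕ → Set
  Matrix m n = Vector (Vector Carrier n) m

  infix  4 _≋_
  infixl 6 _⊕_
  infixl 7 _∙_ _⊛_ _ᵥ*_

  _≋_ : ∀ {n} → Vector Carrier n → Vector Carrier n → Set
  x ≋ y = ∀ i → x i ≈ y i

  𝟎 : ∀ {n} → Vector Carrier n
  𝟎 _ = 0#

  _⊕_ : ∀ {n} → Vector Carrier n → Vector Carrier n → Vector Carrier n
  (x ⊕ y) i = x i + y i

  ⊖_ : ∀ {n} → Vector Carrier n → Vector Carrier n
  (⊖ x) i = - x i

  _⊛_ : ∀ {n} → Carrier → Vector Carrier n → Vector Carrier n
  (a ⊛ x) i = a * x i

  _∙_ : ∀ {n} → Vector Carrier n → Vector Carrier n → Carrier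
  x ∙ y = sum (λ i → x i * y i)

  -- x ᵥ* M is also the linear combination Σᵢ xᵢ Mᵢ of the rows of M.
  _ᵥ*_ : ∀ {m n} → Vector Carrier m → Matrix m n → Vector Carrier n
  (x ᵥ* M) j = x ∙ (λ i → M i j)

  𝐈 : ∀ {n} → Matrix n n
  𝐈 i j = if does (i Fin.≟ j) then 1# else 0#

  record IsSubspace {n} (S : Pred (Vector Carrier n) 0ℓ) : Set where
    field
      resp : ∀ {x y} → x ≋ y → x ∈ S → y ∈ S
      zero : 𝟎 ∈ S
      add  : ∀ {x y} → x ∈ S → y ∈ S → x ⊕ y ∈ S
      scal : ∀ a {x} → x ∈ S → a ⊛ x ∈ S

  -- The rows of B form a basis of the subspace S.
  record IsBasis {k n} (S : Pred (Vector Carrier n) 0ℓ) (B : Matrix k n) : Set where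
    field
      members     : ∀ i → B i ∈ S
      independent : ∀ a → a ᵥ* B ≋ 𝟎 → a ≋ 𝟎
      spanning    : ∀ {x} → x ∈ S → ∃ λ a → x ≋ a ᵥ* B

  HasDimension : ∀ {n} → Pred (Vector Carrier n) 0ℓ → ℕ → Set
  HasDimension {n} S k = ∃ λ (B : Matrix k n) → IsBasis S B

  image : ∀ {m n} → Pred (Vector Carrier m) 0ℓ → Matrix m n → Pred (Vector Carrier n) 0ℓ
  image S M y = ∃ λ x → x ∈ S × y ≋ x ᵥ* M

  -- The additive subgroup generated by S.
  data ⟨_⟩ {n} (S : Pred (Vector Carrier n) 0ℓ) : Pred (Vector Carrier n) 0ℓ where
    gen  : ∀ {x} → x ∈ S → x ∈ ⟨ S ⟩
    zero : 𝟎 ∈ ⟨ S ⟩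
    add  : ∀ {x y} → x ∈ ⟨ S ⟩ → y ∈ ⟨ S ⟩ → x ⊕ y ∈ ⟨ S ⟩
    neg  : ∀ {x} → x ∈ ⟨ S ⟩ → ⊖ x ∈ ⟨ S ⟩
    resp : ∀ {x y} → x ≋ y → x ∈ ⟨ S ⟩ → y ∈ ⟨ S ⟩

  record IsOrthogonal {n} (A : Matrix n n) : Set where
    field
      rows    : ∀ i j → A i ∙ A j ≈ 𝐈 i j
      columns : ∀ i j → transpose A i ∙ transpose A j ≈ 𝐈 i j

  ⟦_⟧ : Sign → Carrier
  ⟦ Sign.+ ⟧ = 1#
  ⟦ Sign.- ⟧ = - 1#

  -- (1,−1,0)-monomial matrices: permutation matrices with some entries 1
  -- replaced by −1.
  record IsMonomial {n} (M : Matrix n n) : Set where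
    field
      σ        : Permutation′ n
      sign     : Vector Sign n
      on-perm  : ∀ i → M i (σ ⟨$⟩ʳ i) ≈ ⟦ sign i ⟧
      off-perm : ∀ i j → j ≢ σ ⟨$⟩ʳ i → M i j ≈ 0#

------------------------------------------------------------------------
-- The integers modulo p, a field when p is prime

GF : (p : ℕ) .{{_ : NonZero p}} → RawRing 0ℓ 0ℓ
GF p = record
  { Carrier = Fin p
  ; _≈_     = _≡_
  ; _+_     = λ a b → (toℕ a ℕ.+ toℕ b) mod p
  ; _*_     = λ a b → (toℕ a ℕ.* toℕ b) mod p
  ; -_      = λ a → (p ℕ.∸ toℕ a) mod p
  ; 0#      = 0 mod p
  ; 1#      = 1 mod p
  }

reduce : (p : ℕ) .{{_ : NonZero p}} → ℤ → Fin p
reduce p z = (z %ℕ p) mod p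

------------------------------------------------------------------------
-- Codes over GF(p)

module Codes (p : ℕ) .{{_ : NonZero p}} where
  open RawRing (GF p) using (0#)
  open LinearAlgebra (GF p)

  Word : ℕ → Set
  Word n = Vector (Fin p) n

  Code : ℕ → Set₁
  Code n = Pred (Word n) 0ℓ

  weight : ∀ {n} → Word n → ℕ
  weight x = count (λ a → ¬? (a Fin.≟ 0#)) (tabulate x)

  record HasMinWeight {n} (C : Code n) (d : ℕ) : Set where
    field
      attained : ∃ λ x → x ∈ C × ¬ (x ≋ 𝟎) × weight x ≡ d
      minimal  : ∀ {x} → x ∈ C → ¬ (x ≋ 𝟎) → d ℕ.≤ weight x

  record Is[_,_,_]Code (n k d : ℕ) (C : Code n) : Set where
    field
      subspace  : IsSubspace C
      dimension : HasDimension C k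
      minWeight : HasMinWeight C d

  infix 9 _^⊥

  _^⊥ : ∀ {n} → Code n → Code n
  (C ^⊥) x = ∀ {y} → y ∈ C → x ∙ y ≡ 0#

  IsSelfDual : ∀ {n} → Code n → Set
  IsSelfDual C = C ≐ C ^⊥

  Equivalent : ∀ {n} → Code n → Code n → Set
  Equivalent {n} C C′ = ∃ λ (M : Matrix n n) → IsMonomial M × C′ ≐ image C M

open Codes

------------------------------------------------------------------------
-- The quadratic residue code of length 19 over GF(7) and its extension

-- GF(343) = GF(7)[t]/(t³ − 2): the cubes in GF(7) are 0 and ±1, so t³ − 2
-- is irreducible.  The triple (a , b , c) stands for a + bt + ct².
GF343 : RawRing 0ℓ 0ℓ
GF343 = record
  { Carrier = Fin 7 × Fin 7 × Fin 7
  ; _≈_     = _≡_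
  ; _+_     = λ { (a , b , c) (a′ , b′ , c′) → a + a′ , b + b′ , c + c′ }
  ; _*_     = λ { (a , b , c) (a′ , b′ , c′) →
                  a * a′ + two * (b * c′ + c * b′)
                , a * b′ + b * a′ + two * (c * c′)
                , a * c′ + b * b′ + c * a′ }
  ; -_      = λ { (a , b , c) → - a , - b , - c }
  ; 0#      = 0# , 0# , 0#
  ; 1#      = 1# , 0# , 0#
  }
  where
  open RawRing (GF 7)
  two : Fin 7
  two = 1# + 1#

module _ where
  open RawRing GF343
  open RawSemiringDefs rawSemiring using (sum; _^_)

  constant : Fin 7 → Carrier
  constant a = a , 0 mod 7 , 0 mod 7

  -- α = t − 1 is a primitive 19th root of unity.
  α : Carrier
  α = 6 mod 7 , 1 mod 7 , 0 mod 7

  α¹⁹≡1 : α ^ 19 ≡ 1#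
  α¹⁹≡1 = refl

  α≢1 : α ≢ 1#
  α≢1 ()

  -- The value at x of the polynomial Σᵢ cᵢ Xⁱ.
  eval : ∀ {n} → Word 7 n → Carrier → Carrier
  eval c x = sum (λ i → constant (c i) * x ^ toℕ i)

  IsQuadraticResidue : (p : ℕ) .{{_ : NonZero p}} → Fin p → Set
  IsQuadraticResidue p r = r ≢ 0 mod p × ∃ λ s → s ·ₚ s ≡ r
    where open RawRing (GF p) using () renaming (_*_ to _·ₚ_)

  -- The cyclic code with generator polynomial ∏ (X − αʳ), r running over the
  -- quadratic residues mod 19: its words are those with zeros at all these αʳ.
  QR₁₉ : Code 7 19
  QR₁₉ c = ∀ r → IsQuadraticResidue 19 r → eval c (α ^ toℕ r) ≈ 0#

-- The standard extension adjoins the coordinate γ Σᵢ cᵢ, where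
-- 1 + 19 γ² = 0 in GF(7); the solutions are γ = ±2.  It is put first.
module _ where
  open RawRing (GF 7)
  open RawSemiringDefs rawSemiring using (sum)

  γ : Fin 7
  γ = 2 mod 7

  γ-spec : 1# + (19 mod 7) * (γ * γ) ≡ 0#
  γ-spec = refl

  QR₂₀ : Code 7 20
  QR₂₀ x = tail x ∈ QR₁₉ × head x ≡ γ * sum (tail x)

------------------------------------------------------------------------
-- Real numbers: Cauchy sequences of rationals, with equality _≃_

IsCauchy : (ℕ → ℚ) → Set
IsCauchy s = ∀ e → 0ℚ ℚ.< e →
  ∃ λ N → ∀ m n → N ℕ.≤ m → N ℕ.≤ n → ∣ s m ℚ.- s n ∣ ℚ.≤ e

record ℝ : Set where
  field
    seq    : ℕ → ℚ
    cauchy : IsCauchy seq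

open ℝ

_≃_ : ℝ → ℝ → Set
x ≃ y = ∀ e → 0ℚ ℚ.< e → ∃ λ N → ∀ n → N ℕ.≤ n → ∣ seq x n ℚ.- seq y n ∣ ℚ.≤ e

private
  open CommutativeSemigroupProperties
    (CommutativeMonoid.commutativeSemigroup ℚ.+-0-commutativeMonoid) using (interchange)

  abstract
    constant-cauchy : ∀ q → IsCauchy (λ _ → q)
    constant-cauchy q e 0<e = 0 , λ _ _ _ _ →
      subst (ℚ._≤ e) (sym (cong ∣_∣ (ℚ.+-inverseʳ q))) (ℚ.<⇒≤ 0<e)

    half : ∀ {e} → 0ℚ ℚ.< e → 0ℚ ℚ.< ½ ℚ.* e
    half {e} 0<e = subst (ℚ._< ½ ℚ.* e) (ℚ.*-zeroʳ ½) (ℚ.*-monoʳ-<-pos ½ 0<e)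

    halves : ∀ e → ½ ℚ.* e ℚ.+ ½ ℚ.* e ≡ e
    halves e rewrite sym (ℚ.*-distribʳ-+ e ½ ½) = ℚ.*-identityˡ e

    +-cauchy : ∀ {s t} → IsCauchy s → IsCauchy t → IsCauchy (λ n → s n ℚ.+ t n)
    +-cauchy {s} {t} cs ct e 0<e with cs (½ ℚ.* e) (half 0<e) | ct (½ ℚ.* e) (half 0<e)
    ... | M , hs | N , ht = M ℕ.⊔ N , λ m n ≤m ≤n → begin
        ∣ (s m ℚ.+ t m) ℚ.- (s n ℚ.+ t n) ∣
          ≡⟨ cong ∣_∣ (rearrange (s m) (t m) (s n) (t n)) ⟩
        ∣ (s m ℚ.- s n) ℚ.+ (t m ℚ.- t n) ∣
          ≤⟨ ℚ.∣p+q∣≤∣p∣+∣q∣ (s m ℚ.- s n) (t m ℚ.- t n) ⟩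
        ∣ s m ℚ.- s n ∣ ℚ.+ ∣ t m ℚ.- t n ∣
          ≤⟨ ℚ.+-mono-≤ (hs m n (ℕ.m⊔n≤o⇒m≤o M N ≤m) (ℕ.m⊔n≤o⇒m≤o M N ≤n))
                        (ht m n (ℕ.m⊔n≤o⇒n≤o M N ≤m) (ℕ.m⊔n≤o⇒n≤o M N ≤n)) ⟩
        ½ ℚ.* e ℚ.+ ½ ℚ.* e
          ≡⟨ halves e ⟩
        e ∎
      where
      open ℚ.≤-Reasoning
      rearrange : ∀ a b c d → (a ℚ.+ b) ℚ.- (c ℚ.+ d) ≡ (a ℚ.- c) ℚ.+ (b ℚ.- d)
      rearrange a b c d rewrite ℚ.neg-distrib-+ c d = interchange a b (ℚ.- c) (ℚ.- d)

    neg-cauchy : ∀ {s} → IsCauchy s → IsCauchy (λ n → ℚ.- s n)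
    neg-cauchy {s} cs e 0<e with cs e 0<e
    ... | N , h = N , λ m n ≤m ≤n →
        subst (ℚ._≤ e) (sym (flip-sign (s m) (s n))) (h m n ≤m ≤n)
      where
      rearrange : ∀ a b → (ℚ.- a) ℚ.- (ℚ.- b) ≡ ℚ.- (a ℚ.- b)
      rearrange a b = sym (ℚ.neg-distrib-+ a (ℚ.- b))
      flip-sign : ∀ a b → ∣ (ℚ.- a) ℚ.- (ℚ.- b) ∣ ≡ ∣ a ℚ.- b ∣
      flip-sign a b rewrite rearrange a b = ℚ.∣-p∣≡∣p∣ (a ℚ.- b)

    bounded : ∀ {s} → IsCauchy s →
              ∃ λ B → ∃ λ N → 0ℚ ℚ.< B × (∀ n → N ℕ.≤ n → ∣ s n ∣ ℚ.≤ B)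
    bounded {s} cs with cs 1ℚ (ℚ.positive⁻¹ 1ℚ)
    ... | N , h = ∣ s N ∣ ℚ.+ 1ℚ , N ,
          ℚ.+-mono-≤-< (ℚ.0≤∣p∣ (s N)) (ℚ.positive⁻¹ 1ℚ) , λ n ≤n → begin
        ∣ s n ∣                        ≡⟨ cong ∣_∣ (rearrange (s n) (s N)) ⟩
        ∣ s N ℚ.+ (s n ℚ.- s N) ∣      ≤⟨ ℚ.∣p+q∣≤∣p∣+∣q∣ (s N) (s n ℚ.- s N) ⟩
        ∣ s N ∣ ℚ.+ ∣ s n ℚ.- s N ∣    ≤⟨ ℚ.+-monoʳ-≤ ∣ s N ∣ (h n N ≤n ℕ.≤-refl) ⟩
        ∣ s N ∣ ℚ.+ 1ℚ                 ∎
      where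
      open ℚ.≤-Reasoning
      rearrange : ∀ a b → a ≡ b ℚ.+ (a ℚ.- b)
      rearrange a b rewrite ℚ.+-comm a (ℚ.- b) | sym (ℚ.+-assoc b (ℚ.- b) a)
                          | ℚ.+-inverseʳ b = sym (ℚ.+-identityˡ a)

    *-mono-≤ : ∀ {a b c d} → 0ℚ ℚ.≤ c → 0ℚ ℚ.≤ b → a ℚ.≤ b → c ℚ.≤ d → a ℚ.* c ℚ.≤ b ℚ.* d
    *-mono-≤ {a} {b} {c} {d} 0≤c 0≤b a≤b c≤d = ℚ.≤-trans
      (ℚ.*-monoʳ-≤-nonNeg c {{ℚ.nonNegative 0≤c}} a≤b)
      (ℚ.*-monoˡ-≤-nonNeg b {{ℚ.nonNegative 0≤b}} c≤d)

    *-cauchy : ∀ {s t} → IsCauchy s → IsCauchy t → IsCauchy (λ n → s n ℚ.* t n)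
    *-cauchy {s} {t} cs ct e 0<e with bounded {s} cs | bounded {t} ct
    ... | B , K , 0<B , hB | B′ , K′ , 0<B′ , hB′ = go
      where
      S : ℚ
      S = B ℚ.+ B′
      instance
        S-pos : ℚ.Positive S
        S-pos = ℚ.positive (ℚ.+-mono-< 0<B 0<B′)
        S-nonZero : ℚ.NonZero S
        S-nonZero = ℚ.pos⇒nonZero S
        S⁻¹-pos : ℚ.Positive (ℚ.1/ S)
        S⁻¹-pos = ℚ.1/pos⇒pos S
        e-pos : ℚ.Positive e
        e-pos = ℚ.positive 0<e
      δ : ℚ
      δ = ℚ.1/ S ℚ.* e
      0<δ : 0ℚ ℚ.< δ
      0<δ = ℚ.positive⁻¹ δ {{ℚ.pos*pos⇒pos (ℚ.1/ S) e}}
      Sδ≡e : B ℚ.* δ ℚ.+ B′ ℚ.* δ ≡ e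
      Sδ≡e = begin
        B ℚ.* δ ℚ.+ B′ ℚ.* δ  ≡⟨ ℚ.*-distribʳ-+ δ B B′ ⟨
        S ℚ.* δ               ≡⟨ ℚ.*-assoc S (ℚ.1/ S) e ⟨
        S ℚ.* ℚ.1/ S ℚ.* e    ≡⟨ cong (ℚ._* e) (ℚ.*-inverseʳ S) ⟩
        1ℚ ℚ.* e              ≡⟨ ℚ.*-identityˡ e ⟩
        e                     ∎
        where open ≡-Reasoning
      rearrange : ∀ a b c d → a ℚ.* b ℚ.- c ℚ.* d ≡ a ℚ.* (b ℚ.- d) ℚ.+ d ℚ.* (a ℚ.- c)
      rearrange a b c d
        rewrite ℚ.*-distribˡ-+ a b (ℚ.- d) | ℚ.*-distribˡ-+ d a (ℚ.- c)
              | sym (ℚ.neg-distribʳ-* a d) | sym (ℚ.neg-distribʳ-* d c)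
              | ℚ.*-comm d a | ℚ.*-comm d c
              | ℚ.+-assoc (a ℚ.* b) (ℚ.- (a ℚ.* d)) (a ℚ.* d ℚ.- c ℚ.* d)
              | sym (ℚ.+-assoc (ℚ.- (a ℚ.* d)) (a ℚ.* d) (ℚ.- (c ℚ.* d)))
              | ℚ.+-inverseˡ (a ℚ.* d) | ℚ.+-identityˡ (ℚ.- (c ℚ.* d)) = refl
      go : ∃ λ N → ∀ m n → N ℕ.≤ m → N ℕ.≤ n → ∣ s m ℚ.* t m ℚ.- s n ℚ.* t n ∣ ℚ.≤ e
      go with cs δ 0<δ | ct δ 0<δ
      ... | M , hs | M′ , ht = (K ℕ.⊔ K′) ℕ.⊔ (M ℕ.⊔ M′) , λ m n ≤m ≤n →
        let open ℚ.≤-Reasoning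
            K≤ : ∀ {i} → (K ℕ.⊔ K′) ℕ.⊔ (M ℕ.⊔ M′) ℕ.≤ i → K ℕ.⊔ K′ ℕ.≤ i
            K≤ = ℕ.m⊔n≤o⇒m≤o (K ℕ.⊔ K′) (M ℕ.⊔ M′)
            M≤ : ∀ {i} → (K ℕ.⊔ K′) ℕ.⊔ (M ℕ.⊔ M′) ℕ.≤ i → M ℕ.⊔ M′ ℕ.≤ i
            M≤ = ℕ.m⊔n≤o⇒n≤o (K ℕ.⊔ K′) (M ℕ.⊔ M′)
        in begin
          ∣ s m ℚ.* t m ℚ.- s n ℚ.* t n ∣
            ≡⟨ cong ∣_∣ (rearrange (s m) (t m) (s n) (t n)) ⟩
          ∣ s m ℚ.* (t m ℚ.- t n) ℚ.+ t n ℚ.* (s m ℚ.- s n) ∣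
            ≤⟨ ℚ.∣p+q∣≤∣p∣+∣q∣ (s m ℚ.* (t m ℚ.- t n)) (t n ℚ.* (s m ℚ.- s n)) ⟩
          ∣ s m ℚ.* (t m ℚ.- t n) ∣ ℚ.+ ∣ t n ℚ.* (s m ℚ.- s n) ∣
            ≡⟨ cong₂ ℚ._+_ (ℚ.∣p*q∣≡∣p∣*∣q∣ (s m) (t m ℚ.- t n))
                           (ℚ.∣p*q∣≡∣p∣*∣q∣ (t n) (s m ℚ.- s n)) ⟩
          ∣ s m ∣ ℚ.* ∣ t m ℚ.- t n ∣ ℚ.+ ∣ t n ∣ ℚ.* ∣ s m ℚ.- s n ∣
            ≤⟨ ℚ.+-mono-≤
                 (*-mono-≤ (ℚ.0≤∣p∣ (t m ℚ.- t n)) (ℚ.<⇒≤ 0<B)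
                   (hB m (ℕ.m⊔n≤o⇒m≤o K K′ (K≤ ≤m)))
                   (ht m n (ℕ.m⊔n≤o⇒n≤o M M′ (M≤ ≤m)) (ℕ.m⊔n≤o⇒n≤o M M′ (M≤ ≤n))))
                 (*-mono-≤ (ℚ.0≤∣p∣ (s m ℚ.- s n)) (ℚ.<⇒≤ 0<B′)
                   (hB′ n (ℕ.m⊔n≤o⇒n≤o K K′ (K≤ ≤n)))
                   (hs m n (ℕ.m⊔n≤o⇒m≤o M M′ (M≤ ≤m)) (ℕ.m⊔n≤o⇒m≤o M M′ (M≤ ≤n)))) ⟩
          B ℚ.* δ ℚ.+ B′ ℚ.* δ
            ≡⟨ Sδ≡e ⟩
          e ∎

fromℚ : ℚ → ℝ
fromℚ q = record { seq = λ _ → q ; cauchy = constant-cauchy q }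

fromℤ : ℤ → ℝ
fromℤ z = fromℚ (z ℚ./ 1)

ℝ-rawRing : RawRing 0ℓ 0ℓ
ℝ-rawRing = record
  { Carrier = ℝ
  ; _≈_     = _≃_
  ; _+_     = λ x y → record
    { seq    = λ n → seq x n ℚ.+ seq y n
    ; cauchy = +-cauchy {seq x} {seq y} (cauchy x) (cauchy y) }
  ; _*_     = λ x y → record
    { seq    = λ n → seq x n ℚ.* seq y n
    ; cauchy = *-cauchy {seq x} {seq y} (cauchy x) (cauchy y) }
  ; -_      = λ x → record
    { seq    = λ n → ℚ.- seq x n
    ; cauchy = neg-cauchy {seq x} (cauchy x) }
  ; 0#      = fromℚ 0ℚ
  ; 1#      = fromℚ 1ℚ
  }

------------------------------------------------------------------------
-- Lattices in ℝⁿ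

open RawRing ℝ-rawRing using (_≈_; _*_)
open LinearAlgebra ℝ-rawRing

Lattice : ℕ → Set₁
Lattice n = Pred (Vector ℝ n) 0ℓ

ℝMatrix : ℕ → ℕ → Set
ℝMatrix = Matrix

infix 4 _≅_

_≅_ : ∀ {n} → Lattice n → Lattice n → Set
_≅_ {n} L L′ = ∃ λ (A : Matrix n n) → IsOrthogonal A × L′ ≐ image L A

-- The rows εᵢ are an orthogonal basis of ℝⁿ with (εᵢ , εⱼ) = p δᵢⱼ.
record IsOrthogonalBasis {n} (p : ℕ) (ε : Matrix n n) : Set where
  field
    basis : IsBasis U ε
    gram  : ∀ i j → ε i ∙ ε j ≈ fromℤ (+ p) * 𝐈 i j

constructionA : ∀ {n} (p : ℕ) .{{_ : NonZero p}} → Matrix n n → Code p n → Lattice n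
constructionA {n} p ε C v = ∃ λ (x : Vector ℤ n) →
  reduce p ∘ x ∈ C × v ≋ fromℚ (1ℤ ℚ./ p) ⊛ ((fromℤ ∘ x) ᵥ* ε)

D : (n : ℕ) → Lattice n
D n v = ∃ λ (a : Vector ℤ n) → (+ 2) ℤ.∣ sum a × v ≋ fromℤ ∘ a
  where open RawSemiringDefs (RawRing.rawSemiring ℤ.+-*-rawRing) using (sum)

D⁺ : (n : ℕ) → Lattice n
D⁺ n = ⟨ D n ∪ (_≋ (λ _ → fromℚ ½)) ⟩

{-# OPTIONS --safe #-}

-- A vector of D₂₀⁺ of norm 7 is ½ times an odd vector with one entry ±3 and
-- the other entries ±1.  A frame of such vectors is therefore ½ F, where F is,
-- up to a signed permutation of its columns, 3I + S with S of entries ±1 off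
-- the diagonal.  The columns of F, reduced modulo 7, are codewords; if S had
-- S_jk = S_kj for some j ≠ k, then two of them would combine to a word of
-- weight 8.  Hence minimum weight 9 makes I + S a skew Hadamard matrix of
-- order 20.
--
-- Such matrices are searched by naming one vertex (row) after the other and
-- recording how many of the columns have a given pattern of entries in the
-- named rows.  Row orthogonality and the absence of codewords of weight at
-- most 8 leave few cases, in all of which ten rows span QR₂₀ up to a signed
-- permutation.  As both codes are self-dual, that is an equivalence.
--
-- Conversely the skew Hadamard matrix of Paley type gives a frame of D₂₀⁺
-- whose columns lie in QR₂₀, and thus an isometry between the two lattices.
-- With generator matrices (I | A) and (−Aᵀ | I) a word of weight at most 8 has
-- at most four nonzero coefficients for one of them, so finitely many
-- combinations show that the minimum weight is 9.

module Submission where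

-- Real numbers enter only at the boundary. An isometry carries ε_i to a vector ½ F_i, and since the
-- integers embed injectively into the reals, all relations between these vectors become integer
-- equations for F; equality of reals never has to be decided.
--
-- Skewness decides everything because the diagonal entries 3 add 3 (S_jk + S_kj) to the inner
-- product of rows j and k. If this term vanishes, the rows agree in 9 and disagree in 9 of the
-- other 18 columns; if not, the imbalance of 6 among those columns is exactly what produces a light
-- word.
--
-- The obstacle is the size of the search. Vertices with the same entries in all named rows are
-- interchangeable, so a new row is described by counts alone, and cases equal up to a permutation
-- collapse. A leaf need not show that the matrix is of Paley type: it suffices that the named
-- codewords combine to ten words which, read along a signed relabelling of the coordinates, are the
-- generators of `QR₂₀`.

open import Defs
open import Algebra.Bundles using (CommutativeRing; RawRing)
open import Data.Fin.Base as Fin using (Fin; zero; suc; toℕ)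
import Data.Fin.Properties as Fin
open import Data.Integer.Base as ℤ using (ℤ; 0ℤ; 1ℤ)
import Data.Integer.Properties as ℤ
open import Data.Integer.Tactic.RingSolver using (solve-∀)
open import Data.Nat.Base as ℕ using (ℕ; nonZero; _≤_; s≤s; z≤n)
import Data.Nat.Properties as ℕ
open import Data.Product.Base using (_×_; _,_; ∃; proj₁; proj₂)
open import Data.Sign.Base as Sign using (Sign)
open import Data.Sum.Base using (_⊎_; inj₁; inj₂)
open import Function.Base using (_∘_)
open import Level using (0ℓ)
open import Relation.Nullary.Decidable using (Dec; yes; no; from-yes)
open import Relation.Nullary.Negation using (¬_; contradiction)

-- Linear algebra over a commutative ring; systematic codes.

module MatrixAlgebra (R : CommutativeRing 0ℓ 0ℓ) where
  import Algebra.Properties.Semiring.Sum as SemiringSum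
  import Algebra.Properties.CommutativeSemigroup as CommutativeSemigroupProperties
  import Algebra.Properties.Ring as RingProperties
  open import Data.Fin.Base using (_↑ˡ_; _↑ʳ_)
  open import Data.Nat.Base using (zero; suc)
  open import Data.Vec.Functional using (Vector; head; tail; transpose; _∷_; _++_)
  open import Data.Vec.Functional.Properties using (lookup-++ˡ; lookup-++ʳ)
  open import Relation.Binary.PropositionalEquality as ≡ using (_≡_; _≢_)
  open import Relation.Unary using (Pred; _∈_)
  open import Relation.Nullary.Decidable using (dec-true; dec-false)
  open CommutativeRing R hiding (zero)
  open LinearAlgebra rawRing hiding (zero)
  open SemiringSum semiring
    using (sum; sum-cong-≋; sum-replicate-zero; ∑-distrib-+; ∑-comm; *-distribˡ-sum; *-distribʳ-sum)
  open CommutativeSemigroupProperties *-commutativeSemigroup using (x∙yz≈y∙xz)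
  open RingProperties ring using (-‿distribʳ-*; -‿+-comm; -0#≈0#)
  open import Relation.Binary.Reasoning.Setoid setoid

  private variable m n k : ℕ

  infixl 7 _·ₘ_

  _·ₘ_ : Matrix m n → Matrix n k → Matrix m k
  (M ·ₘ N) i = M i ᵥ* N

  sum-zero : {f : Vector Carrier n} → (∀ i → f i ≈ 0#) → sum f ≈ 0#
  sum-zero {n} f≈0 = trans (sum-cong-≋ f≈0) (sum-replicate-zero n)

  sum-neg : (f : Vector Carrier n) → sum (λ i → - f i) ≈ - sum f
  sum-neg {zero}  f = sym -0#≈0#
  sum-neg {suc n} f = trans (+-congˡ (sum-neg (f ∘ suc))) (-‿+-comm _ _)

  ∙-cong : {x x′ y y′ : Vector Carrier n} → x ≋ x′ → y ≋ y′ → x ∙ y ≈ x′ ∙ y′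
  ∙-cong p q = sum-cong-≋ (λ i → *-cong (p i) (q i))

  ∙-congˡ : {x y y′ : Vector Carrier n} → y ≋ y′ → x ∙ y ≈ x ∙ y′
  ∙-congˡ = ∙-cong (λ _ → refl)

  ∙-congʳ : {x x′ y : Vector Carrier n} → x ≋ x′ → x ∙ y ≈ x′ ∙ y
  ∙-congʳ p = ∙-cong p (λ _ → refl)

  ∙-comm : (x y : Vector Carrier n) → x ∙ y ≈ y ∙ x
  ∙-comm x y = sum-cong-≋ (λ i → *-comm (x i) (y i))

  ∙-zeroˡ : {x y : Vector Carrier n} → x ≋ 𝟎 → x ∙ y ≈ 0#
  ∙-zeroˡ p = sum-zero (λ i → trans (*-congʳ (p i)) (zeroˡ _))

  ∙-⊛ˡ : ∀ a (x y : Vector Carrier n) → (a ⊛ x) ∙ y ≈ a * (x ∙ y)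
  ∙-⊛ˡ a x y = trans (sum-cong-≋ (λ i → *-assoc a (x i) (y i)))
    (sym (*-distribˡ-sum a (λ i → x i * y i)))

  ∙-⊛ʳ : ∀ a (x y : Vector Carrier n) → x ∙ (a ⊛ y) ≈ a * (x ∙ y)
  ∙-⊛ʳ a x y = trans (∙-comm x (a ⊛ y)) (trans (∙-⊛ˡ a y x) (*-congˡ (∙-comm y x)))

  ∙-⊕ˡ : (x x′ y : Vector Carrier n) → (x ⊕ x′) ∙ y ≈ x ∙ y + x′ ∙ y
  ∙-⊕ˡ x x′ y = trans (sum-cong-≋ (λ i → distribʳ (y i) (x i) (x′ i)))
    (∑-distrib-+ (λ i → x i * y i) (λ i → x′ i * y i))

  ᵥ*-cong : {x x′ : Vector Carrier m} {M M′ : Matrix m n} →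
            x ≋ x′ → (∀ i → M i ≋ M′ i) → x ᵥ* M ≋ x′ ᵥ* M′
  ᵥ*-cong p q j = ∙-cong p (λ i → q i j)

  ᵥ*-congˡ : {x : Vector Carrier m} {M M′ : Matrix m n} →
             (∀ i → M i ≋ M′ i) → x ᵥ* M ≋ x ᵥ* M′
  ᵥ*-congˡ = ᵥ*-cong (λ _ → refl)

  ᵥ*-⊛ : ∀ a (x : Vector Carrier m) (M : Matrix m n) → (a ⊛ x) ᵥ* M ≋ a ⊛ (x ᵥ* M)
  ᵥ*-⊛ a x M j = ∙-⊛ˡ a x (λ i → M i j)

  ᵥ*-∙ : (x : Vector Carrier m) (M : Matrix m n) (y : Vector Carrier n) →
         (x ᵥ* M) ∙ y ≈ x ∙ (λ i → M i ∙ y)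
  ᵥ*-∙ x M y = begin
    sum (λ j → sum (λ i → x i * M i j) * y j)
      ≈⟨ sum-cong-≋ (λ j → *-distribʳ-sum (y j) (λ i → x i * M i j)) ⟩
    sum (λ j → sum (λ i → x i * M i j * y j))
      ≈⟨ ∑-comm (λ j i → x i * M i j * y j) ⟩
    sum (λ i → sum (λ j → x i * M i j * y j))
      ≈⟨ sum-cong-≋ (λ i → sum-cong-≋ (λ j → *-assoc (x i) (M i j) (y j))) ⟩
    sum (λ i → sum (λ j → x i * (M i j * y j)))
      ≈⟨ sum-cong-≋ (λ i → *-distribˡ-sum (x i) (λ j → M i j * y j)) ⟨
    sum (λ i → x i * sum (λ j → M i j * y j)) ∎

  ᵥ*-assoc : (x : Vector Carrier m) (M : Matrix m n) (N : Matrix n k) →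
             (x ᵥ* M) ᵥ* N ≋ x ᵥ* (M ·ₘ N)
  ᵥ*-assoc x M N j = ᵥ*-∙ x M (λ i → N i j)

  𝐈-refl : (i : Fin n) → 𝐈 i i ≡ 1#
  𝐈-refl i rewrite dec-true (i Fin.≟ i) ≡.refl = ≡.refl

  𝐈-off : {i j : Fin n} → i ≢ j → 𝐈 i j ≡ 0#
  𝐈-off {i = i} {j} i≢j rewrite dec-false (i Fin.≟ j) i≢j = ≡.refl

  ∙-single : (x y : Vector Carrier n) (j : Fin n) → (∀ i → i ≢ j → y i ≈ 0#) → x ∙ y ≈ x j * y j
  ∙-single x y zero    y≈0 = trans
    (+-congˡ (sum-zero (λ i → trans (*-congˡ (y≈0 (suc i) λ ())) (zeroʳ _)))) (+-identityʳ _)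
  ∙-single x y (suc j) y≈0 = trans
    (+-cong (trans (*-congˡ (y≈0 zero λ ())) (zeroʳ _))
            (∙-single (x ∘ suc) (y ∘ suc) j (λ i i≢j → y≈0 (suc i) (i≢j ∘ Fin.suc-injective))))
    (+-identityˡ _)

  ∙-𝐈 : (x : Vector Carrier n) (j : Fin n) → x ∙ (λ i → 𝐈 i j) ≈ x j
  ∙-𝐈 x j = trans (∙-single x (λ i → 𝐈 i j) j (λ i i≢j → reflexive (𝐈-off i≢j)))
                  (trans (*-congˡ (reflexive (𝐈-refl j))) (*-identityʳ _))

  𝐈-sym : (i j : Fin n) → 𝐈 i j ≡ 𝐈 j i
  𝐈-sym i j with i Fin.≟ j
  ... | yes ≡.refl = ≡.sym (𝐈-refl i)
  ... | no i≢j     = ≡.sym (𝐈-off (i≢j ∘ ≡.sym))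

  𝐈-∙ : (i : Fin n) (x : Vector Carrier n) → 𝐈 i ∙ x ≈ x i
  𝐈-∙ i x = trans (∙-comm (𝐈 i) x)
    (trans (∙-congˡ {x = x} (λ j → reflexive (𝐈-sym i j))) (∙-𝐈 x i))

  parity-equation : ∀ {x : Vector Carrier (suc n)} c → head x ≈ c * sum (tail x) →
                    x ∙ ((- 1#) ∷ λ _ → c) ≈ 0#
  parity-equation {x = x} c e = begin
    head x * - 1# + sum (λ i → tail x i * c)
      ≈⟨ +-cong (trans (sym (-‿distribʳ-* (head x) 1#)) (-‿cong (*-identityʳ (head x))))
                (trans (sym (*-distribʳ-sum c (tail x))) (*-comm (sum (tail x)) c)) ⟩
    - head x + c * sum (tail x)
      ≈⟨ +-congˡ (sym e) ⟩
    - head x + head x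
      ≈⟨ -‿inverseˡ (head x) ⟩
    0# ∎

  ∙-0∷ : (x : Vector Carrier (suc n)) (y : Vector Carrier n) → x ∙ (0# ∷ y) ≈ tail x ∙ y
  ∙-0∷ x y = trans (+-congʳ (zeroʳ (head x))) (+-identityˡ _)

  factor : ∀ l d a c → l * (d * a) + d * c ≈ d * (l * a + c)
  factor l d a c = trans (+-congʳ (x∙yz≈y∙xz l d a)) (sym (distribˡ d (l * a) c))

  sign-cancel : ∀ t a b → (t * a) * (t * b) ≈ t * (t * (a * b))
  sign-cancel t a b = trans (*-assoc t a (t * b)) (*-congˡ (x∙yz≈y∙xz a t b))

  sign-regroup : ∀ d s a → (d * s) * (d * (s * a)) ≈ d * (d * (s * (s * a)))
  sign-regroup d s a = trans (*-assoc d s _) (*-congˡ (x∙yz≈y∙xz s d (s * a)))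

  gram-row : ∀ {p} (P : Matrix m n) → (∀ i j → P i ∙ P j ≈ p * 𝐈 i j) →
             (x : Vector Carrier m) → ∀ k → (x ᵥ* P) ∙ P k ≈ p * x k
  gram-row {p = p} P gram x k = begin
    (x ᵥ* P) ∙ P k              ≈⟨ ᵥ*-∙ x P (P k) ⟩
    x ∙ (λ i → P i ∙ P k)       ≈⟨ ∙-congˡ {x = x} (λ i → gram i k) ⟩
    x ∙ (p ⊛ (λ i → 𝐈 i k))     ≈⟨ ∙-⊛ʳ p x (λ i → 𝐈 i k) ⟩
    p * (x ∙ (λ i → 𝐈 i k))     ≈⟨ *-congˡ (∙-𝐈 x k) ⟩
    p * x k                     ∎

  gram-∙ : ∀ {p} (P : Matrix m n) → (∀ i j → P i ∙ P j ≈ p * 𝐈 i j) →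
           (x y : Vector Carrier m) → (x ᵥ* P) ∙ (y ᵥ* P) ≈ p * (x ∙ y)
  gram-∙ {p = p} P gram x y = begin
    (x ᵥ* P) ∙ (y ᵥ* P)             ≈⟨ ᵥ*-∙ x P (y ᵥ* P) ⟩
    x ∙ (λ i → P i ∙ (y ᵥ* P))      ≈⟨ ∙-congˡ {x = x} (λ i → trans (∙-comm (P i) (y ᵥ* P)) (gram-row P gram y i)) ⟩
    x ∙ (p ⊛ y)                     ≈⟨ ∙-⊛ʳ p x y ⟩
    p * (x ∙ y)                     ∎

  -- Pairing 𝐈 j = b j P with row i of P identifies p b with the transpose of P. The passage from
  -- rows to columns therefore needs neither a division by p nor a determinant, only coefficients b
  -- expressing the unit vectors in the rows.
  gram-transpose : ∀ {p} (P : Matrix n n) → (∀ i j → P i ∙ P j ≈ p * 𝐈 i j) →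
                   (b : Matrix n n) → (∀ j → 𝐈 j ≋ b j ᵥ* P) →
                   ∀ j k → transpose P j ∙ transpose P k ≈ p * 𝐈 j k
  gram-transpose {p = p} P gram b 𝐈≋bP j k = begin
    transpose P j ∙ transpose P k   ≈⟨ ∙-congʳ {y = transpose P k} (λ i → entry i) ⟩
    (p ⊛ b j) ∙ transpose P k       ≈⟨ ∙-⊛ˡ p (b j) (transpose P k) ⟩
    p * (b j ᵥ* P) k                ≈⟨ *-congˡ (𝐈≋bP j k) ⟨
    p * 𝐈 j k                       ∎
    where
    entry : ∀ i → P i j ≈ p * b j i
    entry i = trans (sym (𝐈-∙ j (P i))) (trans (∙-congʳ {y = P i} (𝐈≋bP j)) (gram-row P gram (b j) i))

  ∙-⊛⊛ : ∀ a b (x y : Vector Carrier n) → (a ⊛ x) ∙ (b ⊛ y) ≈ a * (b * (x ∙ y))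
  ∙-⊛⊛ a b x y = trans (∙-⊛ˡ a x (b ⊛ y)) (*-congˡ (∙-⊛ʳ b x y))

  sum-++ : ∀ m (f : Vector Carrier (m ℕ.+ n)) → sum f ≈ sum (f ∘ (_↑ˡ n)) + sum (f ∘ (m ↑ʳ_))
  sum-++ zero    f = sym (+-identityˡ _)
  sum-++ (suc m) f = trans (+-congˡ (sum-++ m (f ∘ suc))) (sym (+-assoc _ _ _))

  combination : {S : Pred (Vector Carrier n) 0ℓ} → IsSubspace S →
                (a : Vector Carrier m) (M : Matrix m n) → (∀ i → M i ∈ S) → a ᵥ* M ∈ S
  combination {m = zero}  S a M M∈S = IsSubspace.zero S
  combination {m = suc m} S a M M∈S = IsSubspace.add S
    (IsSubspace.scal S (a zero) (M∈S zero)) (combination S (a ∘ suc) (M ∘ suc) (M∈S ∘ suc))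

  -- This and the next two lemmas treat the three coordinates of a product in `GF343` whose left
  -- factor is constant, so that two of its coordinates are 0. The variable `t` stands for the 2
  -- that arises from reducing by the cubic relation.
  absorb : ∀ w t x y → w + t * (0# * x + 0# * y) ≈ w
  absorb w t x y = trans (+-congˡ (trans (*-congˡ (trans (+-cong (zeroˡ x) (zeroˡ y)) (+-identityˡ 0#))) (zeroʳ t)))
    (+-identityʳ w)

  absorb′ : ∀ w t x y → w + 0# * x + t * (0# * y) ≈ w
  absorb′ w t x y = trans (+-cong (trans (+-congˡ (zeroˡ x)) (+-identityʳ w)) (trans (*-congˡ (zeroˡ y)) (zeroʳ t)))
    (+-identityʳ w)

  absorb″ : ∀ w x y → w + 0# * x + 0# * y ≈ w
  absorb″ w x y = trans (+-cong (trans (+-congˡ (zeroˡ x)) (+-identityʳ w)) (zeroˡ y)) (+-identityʳ w)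

  parity-isSubspace : ∀ c → IsSubspace {ℕ.suc n} (λ x → head x ≈ c * sum (tail x))
  parity-isSubspace {n} c = record
    { resp = λ x≋y e → trans (sym (x≋y zero)) (trans e (*-congˡ (sum-cong-≋ (x≋y ∘ suc))))
    ; zero = sym (trans (*-congˡ (sum-zero {f = 𝟎 {n}} (λ _ → refl))) (zeroʳ c))
    ; add  = λ {x} {y} e e′ → trans (+-cong e e′)
        (trans (sym (distribˡ c _ _)) (*-congˡ (sym (∑-distrib-+ (tail x) (tail y)))))
    ; scal = λ a {x} e → trans (*-congˡ e) (trans (x∙yz≈y∙xz a c _) (*-congˡ (*-distribˡ-sum a (tail x)))) }

  module _ (m : ℕ) {n : ℕ} where

    left : {A : Set} → Vector A (m ℕ.+ n) → Vector A m
    left x i = x (i ↑ˡ n)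

    right : {A : Set} → Vector A (m ℕ.+ n) → Vector A n
    right x j = x (m ↑ʳ j)

    ∙-split : (x y : Vector Carrier (m ℕ.+ n)) → x ∙ y ≈ left x ∙ left y + right x ∙ right y
    ∙-split x y = sum-++ m (λ i → x i * y i)

    split-ext : {x y : Vector Carrier (m ℕ.+ n)} → left x ≋ left y → right x ≋ right y → x ≋ y
    split-ext {x} {y} p q i with Fin.splitAt m i | Fin.join-splitAt m n i
    ... | inj₁ j | ≡.refl = p j
    ... | inj₂ j | ≡.refl = q j

  module Systematic {m n : ℕ} (A : Matrix m n) where

    generator : Matrix m (m ℕ.+ n)
    generator i = 𝐈 i ++ A i

    check : Matrix (m ℕ.+ n) n
    check = (λ i → ⊖ A i) ++ 𝐈

    left-encode : ∀ a → left m (a ᵥ* generator) ≋ a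
    left-encode a i = trans (∙-congˡ {x = a} (λ k → reflexive (lookup-++ˡ (𝐈 k) (A k) i))) (∙-𝐈 a i)

    right-encode : ∀ a → right m (a ᵥ* generator) ≋ a ᵥ* A
    right-encode a j = ∙-congˡ {x = a} (λ k → reflexive (lookup-++ʳ (𝐈 k) (A k) j))

    encode : {x : Vector Carrier (m ℕ.+ n)} → right m x ≋ left m x ᵥ* A → x ≋ left m x ᵥ* generator
    encode {x} h = split-ext m (λ i → sym (left-encode (left m x) i))
      (λ j → trans (h j) (sym (right-encode (left m x) j)))

    check≈0 : {x : Vector Carrier (m ℕ.+ n)} → x ᵥ* check ≋ 𝟎 → right m x ≋ left m x ᵥ* A
    check≈0 {x} h j = begin
      right m x j                                 ≈⟨ +-identityˡ _ ⟨
      0# + right m x j                            ≈⟨ +-congʳ (-‿inverseʳ (u ∙ a)) ⟨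
      u ∙ a + - (u ∙ a) + right m x j             ≈⟨ +-assoc _ _ _ ⟩
      u ∙ a + (- (u ∙ a) + right m x j)           ≈⟨ +-congˡ (trans (sym expand) (h j)) ⟩
      u ∙ a + 0#                                  ≈⟨ +-identityʳ _ ⟩
      u ∙ a                                       ∎
      where
      u = left m x
      a = λ i → A i j
      expand : (x ᵥ* check) j ≈ - (u ∙ a) + right m x j
      expand = trans (∙-split m x (λ k → check k j)) (+-cong
        (trans (∙-congˡ {x = u} (λ i → reflexive (≡.cong (λ r → r j) (lookup-++ˡ (λ i → ⊖ A i) 𝐈 i))))
          (trans (sum-cong-≋ (λ i → sym (-‿distribʳ-* (u i) (a i)))) (sum-neg (λ i → u i * a i))))
        (trans (∙-congˡ {x = right m x} (λ i → reflexive (≡.cong (λ r → r j) (lookup-++ʳ (λ i → ⊖ A i) 𝐈 i))))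
          (∙-𝐈 (right m x) j)))

    -- If the check matrix factors through E, then every solution of the equations E passes all
    -- checks. The factor V records a Gaussian elimination, so verifying it costs one matrix
    -- product.
    systematic : ∀ {k} (E : Matrix (m ℕ.+ n) k) (V : Matrix k n) → (∀ i j → (E ·ₘ V) i j ≈ check i j) →
                 {x : Vector Carrier (m ℕ.+ n)} → x ᵥ* E ≋ 𝟎 → right m x ≋ left m x ᵥ* A
    systematic E V EV≈check {x} xE≈0 = check≈0 λ j → trans
      (∙-congˡ {x = x} (λ i → sym (EV≈check i j)))
      (trans (sym (ᵥ*-assoc x E V j)) (∙-zeroˡ {x = x ᵥ* E} xE≈0))

    module Code {S : Pred (Vector Carrier (m ℕ.+ n)) 0ℓ} (subspace : IsSubspace S)
      (generator∈S : ∀ i → generator i ∈ S)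
      (S-systematic : ∀ {x} → x ∈ S → right m x ≋ left m x ᵥ* A)
      where

      basis : IsBasis S generator
      basis = record
        { members     = generator∈S
        ; independent = λ a aG≈0 i → trans (sym (left-encode a i)) (aG≈0 (i ↑ˡ n))
        ; spanning    = λ {x} x∈S → left m x , encode (S-systematic x∈S) }

      orthogonal-to : ∀ {x y} → (∀ i → x ∙ generator i ≈ 0#) → y ∈ S → x ∙ y ≈ 0#
      orthogonal-to {x} {y} h y∈S = begin
        x ∙ y                                   ≈⟨ ∙-comm x y ⟩
        y ∙ x                                   ≈⟨ ∙-congʳ {y = x} (encode (S-systematic y∈S)) ⟩
        (left m y ᵥ* generator) ∙ x             ≈⟨ ᵥ*-∙ (left m y) generator x ⟩
        left m y ∙ (λ i → generator i ∙ x)      ≈⟨ ∙-comm (left m y) _ ⟩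
        (λ i → generator i ∙ x) ∙ left m y      ≈⟨ ∙-zeroˡ (λ i → trans (∙-comm (generator i) x) (h i)) ⟩
        0#                                      ∎

      self-orthogonal : (∀ i j → generator i ∙ generator j ≈ 0#) → ∀ {x y} → x ∈ S → y ∈ S → x ∙ y ≈ 0#
      self-orthogonal GG≈0 x∈S = orthogonal-to λ i →
        trans (∙-comm _ (generator i)) (orthogonal-to (λ j → GG≈0 i j) x∈S)

      -- The hypothesis amounts to AᵀA = -I: it makes every check a combination of generator rows,
      -- so that a word orthogonal to those rows is systematic and hence lies in S.
      dual⇒systematic : (∀ i j → (transpose generator ·ₘ (λ i → ⊖ A i)) i j ≈ check i j) →
                        ∀ {x} → (∀ {y} → y ∈ S → x ∙ y ≈ 0#) → x ∈ S
      dual⇒systematic checks {x} h = IsSubspace.resp subspace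
        (λ i → sym (encode (systematic (transpose generator) (λ i → ⊖ A i) checks
          (λ i → h (generator∈S i))) i))
        (combination subspace (left m x) generator generator∈S)

      -- Pairing x with row i of (I | A) and using self-orthogonality solves for the left half. Thus
      -- (-Aᵀ | I) generates the code as well, and the right half can serve as information part.
      co-systematic : (∀ i j → generator i ∙ generator j ≈ 0#) → ∀ {x} → x ∈ S →
                      left m x ≋ right m x ᵥ* (λ j i → - A i j)
      co-systematic GG≈0 {x} x∈S i = begin
        left m x i                                          ≈⟨ +-identityʳ _ ⟨
        left m x i + 0#                                     ≈⟨ +-congˡ (-‿inverseʳ (right m x ∙ A i)) ⟨
        left m x i + (right m x ∙ A i + - (right m x ∙ A i)) ≈⟨ +-assoc _ _ _ ⟨
        left m x i + right m x ∙ A i + - (right m x ∙ A i)  ≈⟨ +-congʳ (trans (sym expand) (self-orthogonal GG≈0 x∈S (generator∈S i))) ⟩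
        0# + - (right m x ∙ A i)                            ≈⟨ +-identityˡ _ ⟩
        - (right m x ∙ A i)                                 ≈⟨ sum-neg (λ j → right m x j * A i j) ⟨
        sum (λ j → - (right m x j * A i j))                 ≈⟨ sum-cong-≋ (λ j → -‿distribʳ-* (right m x j) (A i j)) ⟩
        (right m x ᵥ* (λ j i → - A i j)) i                  ∎
        where
        expand : x ∙ generator i ≈ left m x i + right m x ∙ A i
        expand = trans (∙-split m x (generator i)) (+-cong
          (trans (∙-congˡ {x = left m x} (λ k → reflexive (lookup-++ˡ (𝐈 i) (A i) k)))
            (trans (∙-comm (left m x) (𝐈 i)) (𝐈-∙ i (left m x))))
          (∙-congˡ {x = right m x} (λ k → reflexive (lookup-++ʳ (𝐈 i) (A i) k))))

-- The Cauchy reals as a commutative ring containing the integers.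

module RealRing where
  open import Data.Integer.Base using (+_)
  open import Data.Rational.Base as ℚ using (ℚ; 0ℚ; 1ℚ; ½; ∣_∣; toℚᵘ)
  import Data.Rational.Properties as ℚ
  open import Data.Rational.Solver using (module +-*-Solver)
  open import Data.Rational.Unnormalised.Base as ℚᵘ using (mkℚᵘ; *≡*)
  import Data.Rational.Unnormalised.Properties as ℚᵘ
  open import Relation.Binary.PropositionalEquality
  open ℝ
  open RawRing ℝ-rawRing
  open +-*-Solver using (solve; _:+_; _:*_; :-_; _:-_; _:=_)

  -- Equality of reals is by definition nullity of the difference. Each congruence law is then an
  -- identity between rational sequences together with a closure property of null sequences.
  IsNull : (ℕ → ℚ) → Set
  IsNull s = ∀ e → 0ℚ ℚ.< e → ∃ λ N → ∀ n → N ℕ.≤ n → ∣ s n ∣ ℚ.≤ e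

  IsBounded : (ℕ → ℚ) → Set
  IsBounded s = ∃ λ B → 0ℚ ℚ.< B × ∃ λ N → ∀ n → N ℕ.≤ n → ∣ s n ∣ ℚ.≤ B

  null-ext : ∀ {s t} → (∀ n → s n ≡ t n) → IsNull s → IsNull t
  null-ext eq h e 0<e with h e 0<e
  ... | N , b = N , λ n N≤n → subst (λ q → ∣ q ∣ ℚ.≤ e) (eq n) (b n N≤n)

  null-0 : IsNull (λ _ → 0ℚ)
  null-0 e 0<e = 0 , λ _ _ → ℚ.<⇒≤ 0<e

  null-neg : ∀ {s} → IsNull s → IsNull (λ n → ℚ.- s n)
  null-neg {s} h e 0<e with h e 0<e
  ... | N , b = N , λ n N≤n → subst (ℚ._≤ e) (sym (ℚ.∣-p∣≡∣p∣ (s n))) (b n N≤n)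

  null-+ : ∀ {s t} → IsNull s → IsNull t → IsNull (λ n → s n ℚ.+ t n)
  null-+ {s} {t} hs ht e 0<e
    with hs (½ ℚ.* e) (subst (ℚ._< ½ ℚ.* e) (ℚ.*-zeroʳ ½) (ℚ.*-monoʳ-<-pos ½ 0<e))
       | ht (½ ℚ.* e) (subst (ℚ._< ½ ℚ.* e) (ℚ.*-zeroʳ ½) (ℚ.*-monoʳ-<-pos ½ 0<e))
  ... | M , b | N , c = M ℕ.⊔ N , λ n ≤n → begin
      ∣ s n ℚ.+ t n ∣      ≤⟨ ℚ.∣p+q∣≤∣p∣+∣q∣ (s n) (t n) ⟩
      ∣ s n ∣ ℚ.+ ∣ t n ∣  ≤⟨ ℚ.+-mono-≤ (b n (ℕ.m⊔n≤o⇒m≤o M N ≤n)) (c n (ℕ.m⊔n≤o⇒n≤o M N ≤n)) ⟩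
      ½ ℚ.* e ℚ.+ ½ ℚ.* e  ≡⟨ ℚ.*-distribʳ-+ e ½ ½ ⟨
      1ℚ ℚ.* e             ≡⟨ ℚ.*-identityˡ e ⟩
      e                    ∎
    where open ℚ.≤-Reasoning

  null-* : ∀ {s t} → IsBounded s → IsNull t → IsNull (λ n → s n ℚ.* t n)
  null-* {s} {t} (B , 0<B , M , b) ht e 0<e = bound
    where
    instance
      B-pos : ℚ.Positive B
      B-pos = ℚ.positive 0<B
      B-nonZero : ℚ.NonZero B
      B-nonZero = ℚ.pos⇒nonZero B
      B⁻¹-pos : ℚ.Positive (ℚ.1/ B)
      B⁻¹-pos = ℚ.1/pos⇒pos B
      e-pos : ℚ.Positive e
      e-pos = ℚ.positive 0<e
    δ : ℚ
    δ = ℚ.1/ B ℚ.* e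
    Bδ≡e : B ℚ.* δ ≡ e
    Bδ≡e = trans (sym (ℚ.*-assoc B (ℚ.1/ B) e))
      (trans (cong (ℚ._* e) (ℚ.*-inverseʳ B)) (ℚ.*-identityˡ e))
    bound : ∃ λ N → ∀ n → N ℕ.≤ n → ∣ s n ℚ.* t n ∣ ℚ.≤ e
    bound with ht δ (ℚ.positive⁻¹ δ {{ℚ.pos*pos⇒pos (ℚ.1/ B) e}})
    ... | N , c = M ℕ.⊔ N , λ n ≤n → let open ℚ.≤-Reasoning in begin
      ∣ s n ℚ.* t n ∣      ≡⟨ ℚ.∣p*q∣≡∣p∣*∣q∣ (s n) (t n) ⟩
      ∣ s n ∣ ℚ.* ∣ t n ∣  ≤⟨ ℚ.*-monoʳ-≤-nonNeg ∣ t n ∣ {{ℚ.nonNegative (ℚ.0≤∣p∣ (t n))}}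
                               (b n (ℕ.m⊔n≤o⇒m≤o M N ≤n)) ⟩
      B ℚ.* ∣ t n ∣        ≤⟨ ℚ.*-monoˡ-≤-nonNeg B {{ℚ.pos⇒nonNeg B}} (c n (ℕ.m⊔n≤o⇒n≤o M N ≤n)) ⟩
      B ℚ.* δ              ≡⟨ Bδ≡e ⟩
      e                    ∎

  cauchy⇒bounded : ∀ {s} → IsCauchy s → IsBounded s
  cauchy⇒bounded {s} cs with cs 1ℚ (ℚ.positive⁻¹ 1ℚ)
  ... | N , h = ∣ s N ∣ ℚ.+ 1ℚ
    , ℚ.+-mono-≤-< (ℚ.0≤∣p∣ (s N)) (ℚ.positive⁻¹ 1ℚ)
    , N , λ n ≤n → begin
      ∣ s n ∣                      ≡⟨ cong ∣_∣ (solve 2 (λ a b → a := b :+ (a :- b)) refl (s n) (s N)) ⟩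
      ∣ s N ℚ.+ (s n ℚ.- s N) ∣    ≤⟨ ℚ.∣p+q∣≤∣p∣+∣q∣ (s N) (s n ℚ.- s N) ⟩
      ∣ s N ∣ ℚ.+ ∣ s n ℚ.- s N ∣  ≤⟨ ℚ.+-monoʳ-≤ ∣ s N ∣ (h n N ≤n ℕ.≤-refl) ⟩
      ∣ s N ∣ ℚ.+ 1ℚ               ∎
    where open ℚ.≤-Reasoning

  ≃-pointwise : ∀ {x y : ℝ} → (∀ n → seq x n ≡ seq y n) → x ≈ y
  ≃-pointwise {x} {y} eq = null-ext
    (λ n → sym (trans (cong (ℚ._- seq y n) (eq n)) (ℚ.+-inverseʳ (seq y n)))) null-0

  ≃-refl : ∀ {x} → x ≈ x
  ≃-refl {x} = ≃-pointwise {x} {x} (λ _ → refl)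

  ≃-sym : ∀ {x y} → x ≈ y → y ≈ x
  ≃-sym {x} {y} h = null-ext
    (λ n → solve 2 (λ a b → :- (a :- b) := b :- a) refl (seq x n) (seq y n)) (null-neg h)

  ≃-trans : ∀ {x y z} → x ≈ y → y ≈ z → x ≈ z
  ≃-trans {x} {y} {z} h k = null-ext
    (λ n → solve 3 (λ a b c → (a :- b) :+ (b :- c) := a :- c) refl (seq x n) (seq y n) (seq z n))
    (null-+ h k)

  +-cong : ∀ {x x′ y y′} → x ≈ x′ → y ≈ y′ → x + y ≈ x′ + y′
  +-cong {x} {x′} {y} {y′} h k = null-ext
    (λ n → solve 4 (λ a a′ b b′ → (a :- a′) :+ (b :- b′) := (a :+ b) :- (a′ :+ b′)) refl
      (seq x n) (seq x′ n) (seq y n) (seq y′ n))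
    (null-+ h k)

  neg-cong : ∀ {x x′} → x ≈ x′ → (- x) ≈ (- x′)
  neg-cong {x} {x′} h = null-ext
    (λ n → solve 2 (λ a a′ → :- (a :- a′) := (:- a) :- (:- a′)) refl (seq x n) (seq x′ n)) (null-neg h)

  *-cong : ∀ {x x′ y y′} → x ≈ x′ → y ≈ y′ → x * y ≈ x′ * y′
  *-cong {x} {x′} {y} {y′} h k = null-ext
    (λ n → solve 4 (λ a a′ b b′ → a :* (b :- b′) :+ b′ :* (a :- a′) := (a :* b) :- (a′ :* b′)) refl
      (seq x n) (seq x′ n) (seq y n) (seq y′ n))
    (null-+ {λ n → seq x n ℚ.* (seq y n ℚ.- seq y′ n)} {λ n → seq y′ n ℚ.* (seq x n ℚ.- seq x′ n)}
      (null-* {seq x} (cauchy⇒bounded {seq x} (cauchy x)) k)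
      (null-* {seq y′} (cauchy⇒bounded {seq y′} (cauchy y′)) h))

  ℝ-commutativeRing : CommutativeRing 0ℓ 0ℓ
  ℝ-commutativeRing = record
    { Carrier = ℝ
    ; _≈_ = _≈_
    ; _+_ = _+_
    ; _*_ = _*_
    ; -_  = -_
    ; 0#  = 0#
    ; 1#  = 1#
    ; isCommutativeRing = record
      { isRing = record
        { +-isAbelianGroup = record
          { isGroup = record
            { isMonoid = record
              { isSemigroup = record
                { isMagma = record
                  { isEquivalence = record
                    { refl  = λ {x} → ≃-refl {x}
                    ; sym   = λ {x} {y} → ≃-sym {x} {y}
                    ; trans = λ {x} {y} {z} → ≃-trans {x} {y} {z} }
                  ; ∙-cong = λ {x} {x′} {y} {y′} → +-cong {x} {x′} {y} {y′} }
                ; assoc = λ x y z → ≃-pointwise {(x + y) + z} {x + (y + z)}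
                    (λ n → ℚ.+-assoc (seq x n) (seq y n) (seq z n)) }
              ; identity = (λ x → ≃-pointwise {0# + x} {x} (λ n → ℚ.+-identityˡ (seq x n)))
                         , (λ x → ≃-pointwise {x + 0#} {x} (λ n → ℚ.+-identityʳ (seq x n))) }
            ; inverse = (λ x → ≃-pointwise {(- x) + x} {0#} (λ n → ℚ.+-inverseˡ (seq x n)))
                      , (λ x → ≃-pointwise {x + (- x)} {0#} (λ n → ℚ.+-inverseʳ (seq x n)))
            ; ⁻¹-cong = λ {x} {y} → neg-cong {x} {y} }
          ; comm = λ x y → ≃-pointwise {x + y} {y + x} (λ n → ℚ.+-comm (seq x n) (seq y n)) }
        ; *-cong = λ {x} {x′} {y} {y′} → *-cong {x} {x′} {y} {y′}
        ; *-assoc = λ x y z → ≃-pointwise {(x * y) * z} {x * (y * z)}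
            (λ n → ℚ.*-assoc (seq x n) (seq y n) (seq z n))
        ; *-identity = (λ x → ≃-pointwise {1# * x} {x} (λ n → ℚ.*-identityˡ (seq x n)))
                     , (λ x → ≃-pointwise {x * 1#} {x} (λ n → ℚ.*-identityʳ (seq x n)))
        ; distrib = (λ x y z → ≃-pointwise {x * (y + z)} {x * y + x * z}
                       (λ n → ℚ.*-distribˡ-+ (seq x n) (seq y n) (seq z n)))
                  , (λ x y z → ≃-pointwise {(y + z) * x} {y * x + z * x}
                       (λ n → ℚ.*-distribʳ-+ (seq x n) (seq y n) (seq z n))) }
      ; *-comm = λ x y → ≃-pointwise {x * y} {y * x} (λ n → ℚ.*-comm (seq x n) (seq y n)) } }

  -- A constant sequence of absolute value d ≠ 0 violates the tolerance ½ d at every index. Through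
  -- this lemma equations between reals descend to the integers.
  fromℚ-injective : ∀ {p q} → fromℚ p ≈ fromℚ q → p ≡ q
  fromℚ-injective {p} {q} h with ∣ p ℚ.- q ∣ ℚ.≟ 0ℚ
  ... | yes d≡0 = begin
      p                ≡⟨ solve 2 (λ a b → a := b :+ (a :- b)) refl p q ⟩
      q ℚ.+ (p ℚ.- q)  ≡⟨ cong (q ℚ.+_) (ℚ.∣p∣≡0⇒p≡0 (p ℚ.- q) d≡0) ⟩
      q ℚ.+ 0ℚ         ≡⟨ ℚ.+-identityʳ q ⟩
      q                ∎
    where open ≡-Reasoning
  ... | no d≢0 = contradiction (ℚ.≤-<-trans (d≤e _ ℕ.≤-refl) e<d) (ℚ.<-irrefl refl)
    where
    d : ℚ
    d = ∣ p ℚ.- q ∣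
    instance
      d-pos : ℚ.Positive d
      d-pos = ℚ.nonNeg∧nonZero⇒pos d {{ℚ.nonNegative (ℚ.0≤∣p∣ (p ℚ.- q))}} {{ℚ.≢-nonZero d≢0}}
    e : ℚ
    e = ½ ℚ.* d
    0<e : 0ℚ ℚ.< e
    0<e = ℚ.positive⁻¹ e {{ℚ.pos*pos⇒pos ½ d}}
    e<d : e ℚ.< d
    e<d = subst (e ℚ.<_) (ℚ.*-identityˡ d) (ℚ.*-monoˡ-<-pos d {½} {1ℚ} (ℚ.*<* (ℤ.+<+ (ℕ.s≤s (ℕ.s≤s ℕ.z≤n)))))
    d≤e : ∀ n → proj₁ (h e 0<e) ℕ.≤ n → d ℚ.≤ e
    d≤e = proj₂ (h e 0<e)

  private
    toℚᵘ-/1 : ∀ a → toℚᵘ (a ℚ./ 1) ℚᵘ.≃ mkℚᵘ a 0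
    toℚᵘ-/1 a = ℚ.toℚᵘ-fromℚᵘ (mkℚᵘ a 0)

  /1-+ : ∀ a b → (a ℤ.+ b) ℚ./ 1 ≡ a ℚ./ 1 ℚ.+ b ℚ./ 1
  /1-+ a b = ℚ.toℚᵘ-injective (begin
    toℚᵘ ((a ℤ.+ b) ℚ./ 1)              ≈⟨ toℚᵘ-/1 (a ℤ.+ b) ⟩
    mkℚᵘ (a ℤ.+ b) 0                    ≈⟨ *≡* (identity a b) ⟩
    mkℚᵘ a 0 ℚᵘ.+ mkℚᵘ b 0              ≈⟨ ℚᵘ.+-cong (toℚᵘ-/1 a) (toℚᵘ-/1 b) ⟨
    toℚᵘ (a ℚ./ 1) ℚᵘ.+ toℚᵘ (b ℚ./ 1)  ≈⟨ ℚ.toℚᵘ-homo-+ (a ℚ./ 1) (b ℚ./ 1) ⟨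
    toℚᵘ (a ℚ./ 1 ℚ.+ b ℚ./ 1)          ∎)
    where
    open import Relation.Binary.Reasoning.Setoid ℚᵘ.≃-setoid
    identity : ∀ a b → (a ℤ.+ b) ℤ.* (+ 1 ℤ.* + 1) ≡ (a ℤ.* + 1 ℤ.+ b ℤ.* + 1) ℤ.* + 1
    identity = solve-∀

  /1-* : ∀ a b → (a ℤ.* b) ℚ./ 1 ≡ a ℚ./ 1 ℚ.* (b ℚ./ 1)
  /1-* a b = ℚ.toℚᵘ-injective (begin
    toℚᵘ ((a ℤ.* b) ℚ./ 1)              ≈⟨ toℚᵘ-/1 (a ℤ.* b) ⟩
    mkℚᵘ (a ℤ.* b) 0                    ≈⟨ ℚᵘ.*-cong (toℚᵘ-/1 a) (toℚᵘ-/1 b) ⟨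
    toℚᵘ (a ℚ./ 1) ℚᵘ.* toℚᵘ (b ℚ./ 1)  ≈⟨ ℚ.toℚᵘ-homo-* (a ℚ./ 1) (b ℚ./ 1) ⟨
    toℚᵘ (a ℚ./ 1 ℚ.* (b ℚ./ 1))        ∎)
    where open import Relation.Binary.Reasoning.Setoid ℚᵘ.≃-setoid

  /1-injective : ∀ {a b} → a ℚ./ 1 ≡ b ℚ./ 1 → a ≡ b
  /1-injective {a} {b} eq with ℚ.fromℚᵘ-injective {mkℚᵘ a 0} {mkℚᵘ b 0} eq
  ... | *≡* eq′ = trans (sym (ℤ.*-identityʳ a)) (trans eq′ (ℤ.*-identityʳ b))

  fromℤ-+ : ∀ a b → fromℤ (a ℤ.+ b) ≈ fromℤ a + fromℤ b
  fromℤ-+ a b = ≃-pointwise {fromℤ (a ℤ.+ b)} {fromℤ a + fromℤ b} (λ _ → /1-+ a b)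

  fromℤ-* : ∀ a b → fromℤ (a ℤ.* b) ≈ fromℤ a * fromℤ b
  fromℤ-* a b = ≃-pointwise {fromℤ (a ℤ.* b)} {fromℤ a * fromℤ b} (λ _ → /1-* a b)

  fromℤ-injective : ∀ {a b} → fromℤ a ≈ fromℤ b → a ≡ b
  fromℤ-injective {a} {b} h = /1-injective (fromℚ-injective h)

-- Reduction of integers modulo p.

module Reduction (p : ℕ) .{{_ : ℕ.NonZero p}} where
  open import Data.Integer.Base using (+_; _%ℕ_; _/ℕ_)
  import Data.Integer.DivMod as ℤ
  open import Data.Nat.Base using (NonZero)
  import Data.Nat.Divisibility as ℕ
  open import Data.Nat.DivMod using (_mod_; m≡m%n+[m/n]*n; m%n<n)
  open import Relation.Binary.PropositionalEquality
  open RawRing (GF p)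

  infix 4 _≡ₚ_

  -- With the quotient as an explicit witness, compatibility with sums and products becomes a
  -- polynomial identity, which the ring solver proves.
  record _≡ₚ_ (a b : ℤ) : Set where
    constructor congruent
    field
      quotient : ℤ
      equation : a ≡ b ℤ.+ quotient ℤ.* + p

  ≡ₚ-sym : ∀ {a b} → a ≡ₚ b → b ≡ₚ a
  ≡ₚ-sym {b = b} (congruent k refl) = congruent (ℤ.- k) (identity b k (+ p))
    where
    identity : ∀ b k q → b ≡ (b ℤ.+ k ℤ.* q) ℤ.+ (ℤ.- k) ℤ.* q
    identity = solve-∀

  ≡ₚ-trans : ∀ {a b c} → a ≡ₚ b → b ≡ₚ c → a ≡ₚ c
  ≡ₚ-trans {c = c} (congruent k refl) (congruent l refl) = congruent (l ℤ.+ k) (identity c k l (+ p))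
    where
    identity : ∀ c k l q → (c ℤ.+ l ℤ.* q) ℤ.+ k ℤ.* q ≡ c ℤ.+ (l ℤ.+ k) ℤ.* q
    identity = solve-∀

  ≡ₚ-+ : ∀ {a b c d} → a ≡ₚ b → c ≡ₚ d → a ℤ.+ c ≡ₚ b ℤ.+ d
  ≡ₚ-+ {b = b} {d = d} (congruent k refl) (congruent l refl) = congruent (k ℤ.+ l) (identity b d k l (+ p))
    where
    identity : ∀ b d k l q → (b ℤ.+ k ℤ.* q) ℤ.+ (d ℤ.+ l ℤ.* q) ≡ (b ℤ.+ d) ℤ.+ (k ℤ.+ l) ℤ.* q
    identity = solve-∀

  ≡ₚ-* : ∀ {a b c d} → a ≡ₚ b → c ≡ₚ d → a ℤ.* c ≡ₚ b ℤ.* d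
  ≡ₚ-* {b = b} {d = d} (congruent k refl) (congruent l refl) =
    congruent (k ℤ.* d ℤ.+ b ℤ.* l ℤ.+ k ℤ.* l ℤ.* + p) (identity b d k l (+ p))
    where
    identity : ∀ b d k l q → (b ℤ.+ k ℤ.* q) ℤ.* (d ℤ.+ l ℤ.* q) ≡
               b ℤ.* d ℤ.+ (k ℤ.* d ℤ.+ b ℤ.* l ℤ.+ k ℤ.* l ℤ.* q) ℤ.* q
    identity = solve-∀

  toℤ : Fin p → ℤ
  toℤ i = + toℕ i

  mod-≡ₚ : ∀ n → + n ≡ₚ toℤ (n mod p)
  mod-≡ₚ n = congruent (+ (n ℕ./ p)) (begin
    + n                                   ≡⟨ cong +_ (m≡m%n+[m/n]*n n p) ⟩
    + (n ℕ.% p ℕ.+ n ℕ./ p ℕ.* p)         ≡⟨ ℤ.pos-+ (n ℕ.% p) _ ⟩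
    + (n ℕ.% p) ℤ.+ + (n ℕ./ p ℕ.* p)     ≡⟨ cong₂ ℤ._+_ (cong +_ (sym (Fin.toℕ-fromℕ< (m%n<n n p)))) (ℤ.pos-* (n ℕ./ p) p) ⟩
    toℤ (n mod p) ℤ.+ + (n ℕ./ p) ℤ.* + p ∎)
    where open ≡-Reasoning

  reduce-≡ₚ : ∀ z → z ≡ₚ toℤ (reduce p z)
  reduce-≡ₚ z = ≡ₚ-trans (congruent (z /ℕ p) (ℤ.a≡a%ℕn+[a/ℕn]*n z p)) (mod-≡ₚ (z %ℕ p))

  -- Two representatives differ by less than p in absolute value, so a difference divisible by p is
  -- 0.
  toℤ-injective : ∀ {i j} → toℤ i ≡ₚ toℤ j → i ≡ j
  toℤ-injective {i} {j} (congruent k eq) = Fin.toℕ-injective (ℤ.+-injective (ℤ.i-j≡0⇒i≡j _ _ difference≡0))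
    where
    identity : ∀ j k q → (j ℤ.+ k ℤ.* q) ℤ.- j ≡ k ℤ.* q
    identity = solve-∀
    difference : toℤ i ℤ.- toℤ j ≡ k ℤ.* + p
    difference = trans (cong (ℤ._- toℤ j) eq) (identity (toℤ j) k (+ p))
    small : ℤ.∣ toℤ i ℤ.- toℤ j ∣ ℕ.< p
    small = ℕ.≤-<-trans
      (subst (λ z → ℤ.∣ z ∣ ℕ.≤ toℕ i ℕ.⊔ toℕ j) (sym (ℤ.m-n≡m⊖n (toℕ i) (toℕ j))) (ℤ.∣m⊝n∣≤m⊔n (toℕ i) (toℕ j)))
      (ℕ.⊔-lub (Fin.toℕ<n i) (Fin.toℕ<n j))
    divisible : p ℕ.∣ ℤ.∣ toℤ i ℤ.- toℤ j ∣
    divisible = ℕ.divides ℤ.∣ k ∣ (trans (cong ℤ.∣_∣ difference) (ℤ.abs-* k (+ p)))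
    difference≡0 : toℤ i ℤ.- toℤ j ≡ 0ℤ
    difference≡0 with ℤ.∣ toℤ i ℤ.- toℤ j ∣ in eq′
    ... | ℕ.zero  = ℤ.∣i∣≡0⇒i≡0 eq′
    ... | ℕ.suc m = contradiction (subst (p ℕ.∣_) eq′ divisible) (ℕ.>⇒∤ (subst (ℕ._< p) eq′ small))

  reduce-unique : ∀ {z i} → z ≡ₚ toℤ i → reduce p z ≡ i
  reduce-unique {z} h = toℤ-injective (≡ₚ-trans (≡ₚ-sym (reduce-≡ₚ z)) h)

  reduce-+ : ∀ a b → reduce p (a ℤ.+ b) ≡ reduce p a + reduce p b
  reduce-+ a b = reduce-unique (≡ₚ-trans (≡ₚ-+ (reduce-≡ₚ a) (reduce-≡ₚ b))
    (mod-≡ₚ (toℕ (reduce p a) ℕ.+ toℕ (reduce p b))))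

  reduce-* : ∀ a b → reduce p (a ℤ.* b) ≡ reduce p a * reduce p b
  reduce-* a b = reduce-unique (≡ₚ-trans (≡ₚ-* (reduce-≡ₚ a) (reduce-≡ₚ b))
    (subst (_≡ₚ toℤ (reduce p a * reduce p b)) (ℤ.pos-* (toℕ (reduce p a)) (toℕ (reduce p b)))
      (mod-≡ₚ (toℕ (reduce p a) ℕ.* toℕ (reduce p b)))))

  reduce-multiple : ∀ k → reduce p (+ p ℤ.* k) ≡ 0#
  reduce-multiple k = reduce-unique (≡ₚ-trans
    (congruent k (trans (ℤ.*-comm (+ p) k) (sym (ℤ.+-identityˡ _)))) (mod-≡ₚ 0))

  reduce≡0 : ∀ z → reduce p z ≡ 0# → ∃ λ k → z ≡ + p ℤ.* k
  reduce≡0 z eq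
    with congruent k z≡ ← ≡ₚ-trans {z} {toℤ 0#} {0ℤ} (subst (λ i → z ≡ₚ toℤ i) eq (reduce-≡ₚ z)) (≡ₚ-sym (mod-≡ₚ 0))
    = k , trans z≡ (trans (ℤ.+-identityˡ _) (ℤ.*-comm k (+ p)))

-- The ring structure of GF(7), by exhaustion.

module GF7 where
  open import Data.Integer.Base using (+_)
  open import Relation.Binary.PropositionalEquality
  open import Relation.Binary.PropositionalEquality.Algebra using (isMagma)
  open RawRing (GF 7)

  private
    assoc+ : ∀ a b c → (a + b) + c ≡ a + (b + c)
    assoc+ = from-yes (Fin.all? λ a → Fin.all? λ b → Fin.all? λ c → (a + b) + c Fin.≟ a + (b + c))
    assoc* : ∀ a b c → (a * b) * c ≡ a * (b * c)
    assoc* = from-yes (Fin.all? λ a → Fin.all? λ b → Fin.all? λ c → (a * b) * c Fin.≟ a * (b * c))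
    distribˡ : ∀ a b c → a * (b + c) ≡ a * b + a * c
    distribˡ = from-yes (Fin.all? λ a → Fin.all? λ b → Fin.all? λ c → a * (b + c) Fin.≟ a * b + a * c)
    comm+ : ∀ a b → a + b ≡ b + a
    comm+ = from-yes (Fin.all? λ a → Fin.all? λ b → a + b Fin.≟ b + a)
    comm* : ∀ a b → a * b ≡ b * a
    comm* = from-yes (Fin.all? λ a → Fin.all? λ b → a * b Fin.≟ b * a)
    identity+ : ∀ a → 0# + a ≡ a
    identity+ = from-yes (Fin.all? λ a → 0# + a Fin.≟ a)
    identity* : ∀ a → 1# * a ≡ a
    identity* = from-yes (Fin.all? λ a → 1# * a Fin.≟ a)
    inverse : ∀ a → (- a) + a ≡ 0#
    inverse = from-yes (Fin.all? λ a → (- a) + a Fin.≟ 0#)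

  GF7-commutativeRing : CommutativeRing 0ℓ 0ℓ
  GF7-commutativeRing = record
    { Carrier = Fin 7
    ; _≈_ = _≡_
    ; _+_ = _+_
    ; _*_ = _*_
    ; -_  = -_
    ; 0#  = 0#
    ; 1#  = 1#
    ; isCommutativeRing = record
      { isRing = record
        { +-isAbelianGroup = record
          { isGroup = record
            { isMonoid = record
              { isSemigroup = record
                { isMagma = isMagma _+_
                ; assoc = assoc+ }
              ; identity = identity+ , (λ a → trans (comm+ a 0#) (identity+ a)) }
            ; inverse = inverse , (λ a → trans (comm+ a (- a)) (inverse a))
            ; ⁻¹-cong = cong -_ }
          ; comm = comm+ }
        ; *-cong = cong₂ _*_
        ; *-assoc = assoc*
        ; *-identity = identity* , (λ a → trans (comm* a 1#) (identity* a))
        ; distrib = distribˡ , (λ a b c → trans (comm* (b + c) a)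
            (trans (distribˡ a b c) (cong₂ _+_ (comm* a b) (comm* a c)))) }
      ; *-comm = comm* } }

-- The extended quadratic residue code and its self-duality.

module QuadraticResidueCode where
  import Algebra.Definitions.RawSemiring as RawSemiringDefs
  open import Data.Fin.Patterns using (0F; 1F; 2F)
  open import Data.Nat.DivMod using (_mod_)
  open import Data.Product.Properties using (≡-dec)
  open import Data.Vec.Base using (Vec; []; _∷_; lookup)
  open import Data.Vec.Functional using (Vector; head; tail; transpose) renaming (_∷_ to _∷ᵥ_)
  import Data.Vec.Functional.Properties as Vector
  open import Relation.Binary.PropositionalEquality
  open import Relation.Nullary.Decidable using (_→-dec_; ¬?)
  open import Relation.Unary using (_∈_)
  open GF7
  open MatrixAlgebra GF7-commutativeRing
  open CommutativeRing GF7-commutativeRing using (+-identityˡ; zeroʳ)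
  open RawRing (GF 7)
  open RawSemiringDefs rawSemiring using (sum)
  open LinearAlgebra (GF 7) hiding (zero)
  open Codes 7
  open import Algebra.Properties.Semiring.Sum (CommutativeRing.semiring GF7-commutativeRing) using (sum-cong-≗)

  private
    module K = RawRing GF343
    module KD = RawSemiringDefs K.rawSemiring

  coordinate : Fin 3 → K.Carrier → Fin 7
  coordinate 0F (a , b , c) = a
  coordinate 1F (a , b , c) = b
  coordinate 2F (a , b , c) = c

  coordinate-ext : ∀ {y z} → (∀ k → coordinate k y ≡ coordinate k z) → y ≡ z
  coordinate-ext eq = cong₂ _,_ (eq 0F) (cong₂ _,_ (eq 1F) (eq 2F))

  -- The coordinates are linear over GF(7). This turns the vanishing of a value in GF(343) into
  -- three linear equations over GF(7), with the coordinates of the powers of the root as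
  -- coefficients.
  coordinate-constant : ∀ k a y → coordinate k (constant a K.* y) ≡ a * coordinate k y
  coordinate-constant k a (b , c , d) = lemma k a b c d
    where
    lemma : ∀ k a b c d → coordinate k (constant a K.* (b , c , d)) ≡ a * coordinate k (b , c , d)
    lemma 0F a b c d = absorb (a * b) (1# + 1#) d c
    lemma 1F a b c d = absorb′ (a * c) (1# + 1#) b d
    lemma 2F a b c d = absorb″ (a * d) c b

  coordinate-sum : ∀ {n} k (f : Vector K.Carrier n) → coordinate k (KD.sum f) ≡ sum (coordinate k ∘ f)
  coordinate-sum {ℕ.zero}  0F f = refl
  coordinate-sum {ℕ.zero}  1F f = refl
  coordinate-sum {ℕ.zero}  2F f = refl
  coordinate-sum {ℕ.suc n} 0F f = cong (coordinate 0F (f zero) +_) (coordinate-sum 0F (f ∘ suc))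
  coordinate-sum {ℕ.suc n} 1F f = cong (coordinate 1F (f zero) +_) (coordinate-sum 1F (f ∘ suc))
  coordinate-sum {ℕ.suc n} 2F f = cong (coordinate 2F (f zero) +_) (coordinate-sum 2F (f ∘ suc))

  power : ∀ {n} → Fin 3 → K.Carrier → Word n
  power k y i = coordinate k (y KD.^ toℕ i)

  coordinate-eval : ∀ {n} k (c : Word n) y → coordinate k (eval c y) ≡ c ∙ power k y
  coordinate-eval k c y = trans (coordinate-sum k (λ i → constant (c i) K.* y KD.^ toℕ i))
    (sum-cong-≗ λ i → coordinate-constant k (c i) (y KD.^ toℕ i))

  eval≡0 : ∀ {n} {c : Word n} {y} → (∀ k → c ∙ power k y ≡ 0#) → eval c y ≡ K.0#
  eval≡0 {c = c} {y} h = coordinate-ext λ { 0F → trans (coordinate-eval 0F c y) (h 0F)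
                                          ; 1F → trans (coordinate-eval 1F c y) (h 1F)
                                          ; 2F → trans (coordinate-eval 2F c y) (h 2F) }

  eval≡0⇒ : ∀ {n} {c : Word n} {y} → eval c y ≡ K.0# → ∀ k → c ∙ power k y ≡ 0#
  eval≡0⇒ {c = c} {y} h k = trans (sym (coordinate-eval k c y)) (trans (cong (coordinate k) h) (coordinate-0 k))
    where
    coordinate-0 : ∀ k → coordinate k K.0# ≡ 0#
    coordinate-0 0F = refl
    coordinate-0 1F = refl
    coordinate-0 2F = refl

  eval-isSubspace : ∀ {n} y → IsSubspace {n} (λ c → eval c y ≡ K.0#)
  eval-isSubspace {n} y = record
    { resp = λ {c} {d} c≋d h → eval≡0 {c = d} λ k →
        trans (∙-congʳ {x = d} {c} {power k y} (λ i → sym (c≋d i))) (eval≡0⇒ {c = c} h k)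
    ; zero = eval≡0 {c = 𝟎 {n}} {y} λ k → ∙-zeroˡ {x = 𝟎 {n}} {power k y} (λ _ → refl)
    ; add  = λ {c} {d} h h′ → eval≡0 {c = c ⊕ d} λ k → trans (∙-⊕ˡ c d (power k y))
        (trans (cong₂ _+_ (eval≡0⇒ {c = c} h k) (eval≡0⇒ {c = d} h′ k)) (+-identityˡ 0#))
    ; scal = λ a {c} h → eval≡0 {c = a ⊛ c} λ k → trans (∙-⊛ˡ a c (power k y))
        (trans (cong (a *_) (eval≡0⇒ {c = c} h k)) (zeroʳ a)) }

  QR₂₀-isSubspace : IsSubspace QR₂₀
  QR₂₀-isSubspace = record
    { resp = λ {x} {y} x≋y (h , e) →
          (λ r q → V.resp (eval-isSubspace (α KD.^ toℕ r)) {tail x} {tail y} (x≋y ∘ suc) (h r q))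
        , V.resp (parity-isSubspace γ) {x} {y} x≋y e
    ; zero = (λ r q → V.zero (eval-isSubspace {19} (α KD.^ toℕ r))) , V.zero (parity-isSubspace {19} γ)
    ; add  = λ {x} {y} (h , e) (h′ , e′) →
          (λ r q → V.add (eval-isSubspace (α KD.^ toℕ r)) {tail x} {tail y} (h r q) (h′ r q))
        , V.add (parity-isSubspace γ) {x} {y} e e′
    ; scal = λ a {x} (h , e) →
          (λ r q → V.scal (eval-isSubspace (α KD.^ toℕ r)) a {tail x} (h r q))
        , V.scal (parity-isSubspace γ) a {x} e }
    where module V = IsSubspace

  fromTable : ∀ {m n} → Vec (Vec ℕ n) m → Matrix m n
  fromTable t i j = lookup (lookup t i) j mod 7

  -- The right half of the reduced echelon form of a generator matrix of `QR₂₀`. Both inclusions are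
  -- certified below, by `generator∈QR₂₀` and `QR₂₀-systematic`.
  A-table : Vec (Vec ℕ 10) 10
  A-table =
    ( (1 ∷ 6 ∷ 5 ∷ 3 ∷ 1 ∷ 3 ∷ 0 ∷ 2 ∷ 5 ∷ 6 ∷ [])
    ∷ (1 ∷ 5 ∷ 6 ∷ 5 ∷ 5 ∷ 2 ∷ 4 ∷ 2 ∷ 3 ∷ 1 ∷ [])
    ∷ (6 ∷ 3 ∷ 6 ∷ 1 ∷ 0 ∷ 3 ∷ 5 ∷ 2 ∷ 6 ∷ 2 ∷ [])
    ∷ (5 ∷ 3 ∷ 5 ∷ 3 ∷ 5 ∷ 3 ∷ 2 ∷ 1 ∷ 3 ∷ 4 ∷ [])
    ∷ (3 ∷ 6 ∷ 0 ∷ 6 ∷ 4 ∷ 4 ∷ 1 ∷ 1 ∷ 3 ∷ 6 ∷ [])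
    ∷ (1 ∷ 1 ∷ 5 ∷ 5 ∷ 4 ∷ 6 ∷ 1 ∷ 3 ∷ 4 ∷ 4 ∷ [])
    ∷ (3 ∷ 2 ∷ 5 ∷ 6 ∷ 6 ∷ 3 ∷ 4 ∷ 0 ∷ 5 ∷ 0 ∷ [])
    ∷ (0 ∷ 3 ∷ 2 ∷ 5 ∷ 6 ∷ 6 ∷ 3 ∷ 4 ∷ 0 ∷ 5 ∷ [])
    ∷ (2 ∷ 3 ∷ 1 ∷ 5 ∷ 1 ∷ 3 ∷ 0 ∷ 0 ∷ 3 ∷ 2 ∷ [])
    ∷ (5 ∷ 6 ∷ 5 ∷ 5 ∷ 2 ∷ 4 ∷ 2 ∷ 3 ∷ 1 ∷ 1 ∷ []) ∷ [] )

  A : Matrix 10 10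
  A = fromTable A-table

  open Systematic A using (generator; check; systematic; module Code)

  residue : Fin 3 → Fin 19
  residue = lookup (1 mod 19 ∷ 4 mod 19 ∷ 5 mod 19 ∷ [])

  residue-isQuadraticResidue : ∀ l → IsQuadraticResidue 19 (residue l)
  residue-isQuadraticResidue 0F = (λ ()) , 1 mod 19 , refl
  residue-isQuadraticResidue 1F = (λ ()) , 2 mod 19 , refl
  residue-isQuadraticResidue 2F = (λ ()) , 9 mod 19 , refl

  root : Fin 3 → K.Carrier
  root l = α KD.^ toℕ (residue l)

  parity : Word 20
  parity = (- 1#) ∷ᵥ λ _ → γ

  -- The equation for the first coordinate, and the three coordinates of the
  -- values at α, α⁴ and α⁵, which represent the orbits of the Frobenius map
  -- on the roots of the generator polynomial.
  equation : Fin 10 → Word 20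
  equation 0F      = parity
  equation (suc k) = 0# ∷ᵥ power (proj₂ (Fin.remQuot {3} 3 k)) (root (proj₁ (Fin.remQuot {3} 3 k)))

  equations : Matrix 20 10
  equations = transpose equation

  -- A recorded Gaussian elimination: it combines the ten equations into the ten checks of the
  -- systematic form.
  elimination : Matrix 10 10
  elimination = fromTable
    ( (1 ∷ 6 ∷ 5 ∷ 3 ∷ 1 ∷ 3 ∷ 0 ∷ 2 ∷ 5 ∷ 6 ∷ [])
    ∷ (4 ∷ 5 ∷ 3 ∷ 6 ∷ 5 ∷ 1 ∷ 1 ∷ 1 ∷ 5 ∷ 4 ∷ [])
    ∷ (0 ∷ 3 ∷ 5 ∷ 3 ∷ 5 ∷ 5 ∷ 0 ∷ 1 ∷ 1 ∷ 5 ∷ [])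
    ∷ (2 ∷ 6 ∷ 6 ∷ 4 ∷ 4 ∷ 0 ∷ 6 ∷ 5 ∷ 1 ∷ 1 ∷ [])
    ∷ (2 ∷ 5 ∷ 1 ∷ 3 ∷ 1 ∷ 5 ∷ 4 ∷ 4 ∷ 6 ∷ 4 ∷ [])
    ∷ (1 ∷ 0 ∷ 5 ∷ 4 ∷ 0 ∷ 2 ∷ 0 ∷ 0 ∷ 1 ∷ 1 ∷ [])
    ∷ (2 ∷ 4 ∷ 2 ∷ 4 ∷ 3 ∷ 3 ∷ 4 ∷ 4 ∷ 6 ∷ 3 ∷ [])
    ∷ (5 ∷ 1 ∷ 1 ∷ 1 ∷ 1 ∷ 0 ∷ 5 ∷ 3 ∷ 4 ∷ 0 ∷ [])
    ∷ (4 ∷ 4 ∷ 3 ∷ 3 ∷ 3 ∷ 5 ∷ 5 ∷ 5 ∷ 2 ∷ 1 ∷ [])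
    ∷ (5 ∷ 1 ∷ 3 ∷ 3 ∷ 3 ∷ 2 ∷ 0 ∷ 6 ∷ 0 ∷ 5 ∷ []) ∷ [] )

  equations·elimination≡check : ∀ i j → (equations ·ₘ elimination) i j ≡ check i j
  equations·elimination≡check =
    from-yes (Fin.all? λ i → Fin.all? λ j → (equations ·ₘ elimination) i j Fin.≟ check i j)

  generator-orthogonal : ∀ i j → generator i ∙ generator j ≡ 0#
  generator-orthogonal = from-yes (Fin.all? λ i → Fin.all? λ j → generator i ∙ generator j Fin.≟ 0#)

  generator-dual : ∀ i j → (transpose generator ·ₘ (λ i → ⊖ A i)) i j ≡ check i j
  generator-dual = from-yes (Fin.all? λ i → Fin.all? λ j →
    (transpose generator ·ₘ (λ i → ⊖ A i)) i j Fin.≟ check i j)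

  generator-parity : ∀ i → head (generator i) ≡ γ * sum (tail (generator i))
  generator-parity = from-yes (Fin.all? λ i → head (generator i) Fin.≟ γ * sum (tail (generator i)))

  -- The nonzero s range over a decidable finite set, and the exponents s² meet all nine quadratic
  -- residues in just the form in which `IsQuadraticResidue` presents them.
  generator-roots : ∀ i s → s ≢ zero → eval (tail (generator i)) (α KD.^ toℕ (RawRing._*_ (GF 19) s s)) ≡ K.0#
  generator-roots = from-yes (Fin.all? λ i → Fin.all? λ s → ¬? (s Fin.≟ zero) →-dec
    (≡-dec Fin._≟_ (≡-dec Fin._≟_ Fin._≟_) (eval (tail (generator i)) (α KD.^ toℕ (RawRing._*_ (GF 19) s s))) K.0#))

  generator∈QR₂₀ : ∀ i → generator i ∈ QR₂₀
  generator∈QR₂₀ i = (λ { r (r≢0 , s , refl) → generator-roots i s (λ { refl → r≢0 refl }) }) , generator-parity i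

  QR₂₀⇒equation : ∀ {x} → x ∈ QR₂₀ → ∀ j → x ∙ equation j ≡ 0#
  QR₂₀⇒equation {x} (h , e) 0F      = parity-equation {x = x} γ e
  QR₂₀⇒equation {x} (h , e) (suc k) = trans (∙-0∷ x (power m (root l)))
    (eval≡0⇒ {c = tail x} {root l} (h (residue l) (residue-isQuadraticResidue l)) m)
    where
    l = proj₁ (Fin.remQuot {3} 3 k)
    m = proj₂ (Fin.remQuot {3} 3 k)

  QR₂₀-systematic : ∀ {x} → x ∈ QR₂₀ → right 10 x ≋ left 10 x ᵥ* A
  QR₂₀-systematic {x} x∈QR = systematic equations elimination equations·elimination≡check {x} (QR₂₀⇒equation {x} x∈QR)

  module QR = Code QR₂₀-isSubspace generator∈QR₂₀ (λ {x} → QR₂₀-systematic {x})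

  QR₂₀-selfDual : IsSelfDual QR₂₀
  QR₂₀-selfDual = (λ {x} x∈QR {y} y∈QR → QR.self-orthogonal generator-orthogonal {x} {y} x∈QR y∈QR)
                , (λ {x} x∈QR⊥ → QR.dual⇒systematic generator-dual {x} (λ {y} → x∈QR⊥ {y}))

-- Lower bounds for weights by enumeration of few coefficients.

module WordWeights where
  open import Data.Bool.Base using (Bool; true; _∧_; T)
  import Data.Bool.Properties as Bool
  open import Data.Fin.Base using (_↑ˡ_; _↑ʳ_)
  open import Data.List.Base as List using (List)
  open import Data.Bool.ListAction using (all)
  open import Data.List.Membership.Propositional using (_∈_)
  import Data.List.Relation.Unary.All as All
  import Data.List.Relation.Unary.All.Properties as All
  open import Data.Nat.Base using (_<_)
  open import Data.List.Membership.DecPropositional ℕ._≟_ using (_∈?_)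
  open import Data.Nat.DivMod using (_mod_; m%n<n)
  open import Data.Unit.Base using (tt)
  open import Data.Vec.Base as Vec using (Vec; []; _∷_; lookup)
  open import Data.Vec.Functional using (Vector; tail)
  open import Function.Bundles using (Equivalence)
  open import Relation.Binary.PropositionalEquality
  open GF7
  open MatrixAlgebra GF7-commutativeRing
  open CommutativeRing GF7-commutativeRing using (+-identityˡ; +-identityʳ; +-assoc; +-comm; zeroˡ; *-identityˡ)
  open RawRing (GF 7)
  open LinearAlgebra (GF 7) hiding (zero)
  open Codes 7
  open import Algebra.Properties.CommutativeMonoid.Sum ℕ.+-0-commutativeMonoid as ℕΣ using ()

  nz : Fin 7 → ℕ
  nz zero    = 0
  nz (suc _) = 1

  -- The weight as a sum of indicators, to which the laws for splitting and comparing finite sums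
  -- apply.
  support : ∀ {n} → Word n → ℕ
  support x = ℕΣ.sum (nz ∘ x)

  weight≡support : ∀ {n} (x : Word n) → weight x ≡ support x
  weight≡support {ℕ.zero}  x = refl
  weight≡support {ℕ.suc n} x with x zero
  ... | zero  = weight≡support (x ∘ suc)
  ... | suc _ = cong ℕ.suc (weight≡support (x ∘ suc))

  nz-scale : ∀ c a → nz (suc c * a) ≡ nz a
  nz-scale = from-yes (Fin.all? λ c → Fin.all? λ a → nz (suc c * a) ℕ.≟ nz a)

  support-scale : ∀ {n} c (x : Word n) → support (suc c ⊛ x) ≡ support x
  support-scale c x = ℕΣ.sum-cong-≗ (λ i → nz-scale c (x i))

  support-cong : ∀ {n} {x y : Word n} → x ≋ y → support x ≡ support y
  support-cong x≋y = ℕΣ.sum-cong-≗ (λ i → cong nz (x≋y i))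

  support≡0 : ∀ {n} (x : Word n) → support x ≡ 0 → x ≋ 𝟎
  support≡0 {ℕ.suc n} x eq i with x zero in eq₀
  support≡0 {ℕ.suc n} x eq zero    | zero = eq₀
  support≡0 {ℕ.suc n} x eq (suc i) | zero = support≡0 (x ∘ suc) eq i

  support-𝟎 : ∀ {n} → support (𝟎 {n}) ≡ 0
  support-𝟎 {ℕ.zero}  = refl
  support-𝟎 {ℕ.suc n} = support-𝟎 {n}

  nzℕ : ℕ → ℕ
  nzℕ ℕ.zero    = 0
  nzℕ (ℕ.suc _) = 1

  nzℕ-mod : ∀ m → nzℕ (m ℕ.% 7) ≡ nz (m mod 7)
  nzℕ-mod m = lemma (m ℕ.% 7) (m%n<n m 7)
    where
    lemma : ∀ k (k<7 : k ℕ.< 7) → nzℕ k ≡ nz (Fin.fromℕ< k<7)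
    lemma ℕ.zero    _ = refl
    lemma (ℕ.suc _) _ = refl

  -- The enumeration works with unreduced natural numbers; residues modulo 7 are taken only when
  -- nonzero entries are counted.
  Represents : ∀ {n} → Vec ℕ n → Word n → Set
  Represents v x = ∀ i → lookup v i mod 7 ≡ x i

  mod-+ : ∀ m n → (m ℕ.+ n) mod 7 ≡ (m mod 7) + (n mod 7)
  mod-+ m n = toℤ-injective (≡ₚ-trans (≡ₚ-sym (mod-≡ₚ (m ℕ.+ n)))
    (≡ₚ-trans (≡ₚ-+ (mod-≡ₚ m) (mod-≡ₚ n)) (mod-≡ₚ (toℕ (m mod 7) ℕ.+ toℕ (n mod 7)))))
    where open Reduction 7

  mod-* : ∀ m n → (m ℕ.* n) mod 7 ≡ (m mod 7) * (n mod 7)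
  mod-* m n = toℤ-injective (≡ₚ-trans (≡ₚ-sym (mod-≡ₚ (m ℕ.* n)))
    (≡ₚ-trans (subst₂ _≡ₚ_ (sym (ℤ.pos-* m n)) (sym (ℤ.pos-* (toℕ (m mod 7)) (toℕ (n mod 7)))) (≡ₚ-* (mod-≡ₚ m) (mod-≡ₚ n)))
      (mod-≡ₚ (toℕ (m mod 7) ℕ.* toℕ (n mod 7)))))
    where
    open Reduction 7
    import Data.Integer.Properties as ℤ

  addScaled : ∀ {n} → ℕ → Vec ℕ n → Vec ℕ n → Vec ℕ n
  addScaled c = Vec.zipWith (λ m k → c ℕ.* m ℕ.+ k)

  addScaled-represents : ∀ {n} (c : Fin 7) {r v : Vec ℕ n} {x y : Word n} →
    Represents r x → Represents v y → Represents (addScaled (toℕ c) r v) ((c ⊛ x) ⊕ y)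
  addScaled-represents c {r} {v} hx hy i = trans (cong (_mod 7) (VecP.lookup-zipWith _ i r v))
    (trans (mod-+ (toℕ c ℕ.* lookup r i) (lookup v i))
      (cong₂ _+_ (trans (mod-* (toℕ c) (lookup r i)) (cong₂ _*_ (toℕ-mod c) (hx i))) (hy i)))
    where
    import Data.Vec.Properties as VecP
    toℕ-mod : ∀ c → toℕ c mod 7 ≡ c
    toℕ-mod = from-yes (Fin.all? λ c → toℕ c mod 7 Fin.≟ c)

  nonzeros : ∀ {n} → Vec ℕ n → ℕ
  nonzeros []      = 0
  nonzeros (m ∷ v) = nzℕ (m ℕ.% 7) ℕ.+ nonzeros v

  nonzeros-represents : ∀ {n} {v : Vec ℕ n} {x : Word n} → Represents v x → nonzeros v ≡ support x
  nonzeros-represents {v = []}    h = refl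
  nonzeros-represents {v = m ∷ v} h = cong₂ ℕ._+_ (trans (nzℕ-mod m) (cong nz (h zero))) (nonzeros-represents {v = v} (h ∘ suc))

  scalars : List ℕ
  scalars = 1 List.∷ 2 List.∷ 3 List.∷ 4 List.∷ 5 List.∷ 6 List.∷ List.[]

  -- heavy rs b d v : every combination v + Σ aᵢ rᵢ with at most b nonzero
  -- coefficients aᵢ satisfies wt a + wt (v + Σ aᵢ rᵢ) ≥ d.
  heavy : ∀ {m n} → Vec (Vec ℕ n) m → ℕ → ℕ → Vec ℕ n → Bool
  heavy []       b         d v = d ℕ.≤ᵇ nonzeros v
  heavy (r ∷ rs) ℕ.zero    d v = d ℕ.≤ᵇ nonzeros v
  heavy (r ∷ rs) (ℕ.suc b) d v = heavy rs (ℕ.suc b) d v ∧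
    all (λ c → heavy rs b (ℕ.pred d) (addScaled c r v)) scalars

  RepresentsRows : ∀ {m n} → Vec (Vec ℕ n) m → Matrix m n → Set
  RepresentsRows R M = ∀ i → Represents (lookup R i) (M i)

  scalar∈scalars : ∀ (c : Fin 6) → toℕ (suc c) ∈ scalars
  scalar∈scalars = from-yes (Fin.all? λ (c : Fin 6) → toℕ (suc c) ∈? scalars)

  ᵥ*-𝟎 : ∀ {m n} {a : Word m} (M : Matrix m n) (y : Word n) → a ≋ 𝟎 → y ⊕ (a ᵥ* M) ≋ y
  ᵥ*-𝟎 {a = a} M y a≋0 j = trans (cong (y j +_) (∙-zeroˡ {x = a} a≋0)) (+-identityʳ (y j))

  pred≤⇒≤suc : ∀ d {k} → ℕ.pred d ≤ k → d ≤ ℕ.suc k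
  pred≤⇒≤suc ℕ.zero    _ = z≤n
  pred≤⇒≤suc (ℕ.suc d) h = s≤s h

  heavy-sound : ∀ {m n} (R : Vec (Vec ℕ n) m) (M : Matrix m n) → RepresentsRows R M →
    ∀ b d {v : Vec ℕ n} {y : Word n} → Represents v y → T (heavy R b d v) →
    (a : Word m) → support a ≤ b → d ≤ support a ℕ.+ support (y ⊕ (a ᵥ* M))
  heavy-sound [] M _ b d {v} {y} v~y h a _ =
    ℕ.≤-trans (ℕ.≤ᵇ⇒≤ d _ h) (ℕ.≤-reflexive (trans (nonzeros-represents {v = v} v~y)
      (sym (support-cong {x = y ⊕ (a ᵥ* M)} (ᵥ*-𝟎 {a = a} M y λ ())))))
  heavy-sound (r ∷ R) M _ ℕ.zero d {v} {y} v~y h a a≤b =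
    ℕ.≤-trans (ℕ.≤ᵇ⇒≤ d _ h) (ℕ.≤-trans (ℕ.≤-reflexive (trans (nonzeros-represents {v = v} v~y)
      (sym (support-cong {x = y ⊕ (a ᵥ* M)} (ᵥ*-𝟎 {a = a} M y (support≡0 a (ℕ.n≤0⇒n≡0 a≤b)))))))
      (ℕ.m≤n+m _ (support a)))
  heavy-sound (r ∷ R) M R~M (ℕ.suc b) d {v} {y} v~y h a a≤b = go (a zero) refl
    where
    splitting : T (heavy R (ℕ.suc b) d v) × T (all (λ c → heavy R b (ℕ.pred d) (addScaled c r v)) scalars)
    splitting = Equivalence.to Bool.T-∧ h
    t = tail a ᵥ* tail M
    go : ∀ c → a zero ≡ c → d ≤ support a ℕ.+ support (y ⊕ (a ᵥ* M))
    go zero a₀ = ℕ.≤-trans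
      (heavy-sound R (tail M) (R~M ∘ suc) (ℕ.suc b) d v~y (proj₁ splitting) (tail a)
        (ℕ.≤-trans (ℕ.m≤n+m _ (nz (a zero))) a≤b))
      (ℕ.+-mono-≤ (ℕ.m≤n+m _ (nz (a zero))) (ℕ.≤-reflexive (support-cong {x = y ⊕ t} λ j →
        cong (y j +_) (sym (trans (cong (λ c → c * M zero j + t j) a₀)
          (trans (cong (_+ t j) (zeroˡ (M zero j))) (+-identityˡ _)))))))
    go (suc c) a₀ = ℕ.≤-trans (pred≤⇒≤suc d
      (heavy-sound R (tail M) (R~M ∘ suc) b (ℕ.pred d) {addScaled (toℕ (suc c)) r v}
        (addScaled-represents (suc c) {r} {v} {M zero} {y} (R~M zero) v~y)
        (All.lookup (All.all⁺ (λ c → heavy R b (ℕ.pred d) (addScaled c r v)) scalars (proj₂ splitting)) (scalar∈scalars c)) (tail a)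
        (ℕ.≤-pred (subst (λ c → nz c ℕ.+ support (tail a) ≤ ℕ.suc b) a₀ a≤b))))
      (ℕ.≤-reflexive (cong₂ ℕ._+_ (cong (λ c → nz c ℕ.+ support (tail a)) (sym a₀))
        (support-cong {x = ((suc c ⊛ M zero) ⊕ y) ⊕ t} λ j →
          trans (cong (_+ t j) (+-comm (suc c * M zero j) (y j)))
            (trans (+-assoc (y j) (suc c * M zero j) _)
              (cong (λ c → y j + (c * M zero j + t j)) (sym a₀))))))

  -- The row r carries the first nonzero coefficient, normalised to 1. It uses up one coefficient of
  -- the budget and accounts for one unit of weight, hence the two predecessors.
  allHeavy : ∀ {m n} → Vec (Vec ℕ n) m → ℕ → ℕ → Bool
  allHeavy []      b d = true
  allHeavy (r ∷ R) b d = allHeavy R b d ∧ heavy R (ℕ.pred b) (ℕ.pred d) r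

  inverse : ∀ (c : Fin 6) → ∃ λ e → suc e * suc c ≡ 1#
  inverse = from-yes (Fin.all? λ c → Fin.any? λ e → suc e * suc c Fin.≟ 1#)

  -- Scaling the first nonzero coefficient to 1 divides the search space by 6.
  allHeavy-sound : ∀ {m n} (R : Vec (Vec ℕ n) m) (M : Matrix m n) → RepresentsRows R M →
    ∀ b d → T (allHeavy R b d) → (a : Word m) → ¬ (a ≋ 𝟎) → support a ≤ b →
    d ≤ support a ℕ.+ support (a ᵥ* M)
  allHeavy-sound [] M _ b d h a a≢0 _ = contradiction (λ ()) a≢0
  allHeavy-sound (r ∷ R) M R~M b d h a a≢0 a≤b = go (a zero) refl
    where
    splitting : T (allHeavy R b d) × T (heavy R (ℕ.pred b) (ℕ.pred d) r)
    splitting = Equivalence.to Bool.T-∧ h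
    t = tail a ᵥ* tail M
    go : ∀ c → a zero ≡ c → d ≤ support a ℕ.+ support (a ᵥ* M)
    go zero a₀ = ℕ.≤-trans
      (allHeavy-sound R (tail M) (R~M ∘ suc) b d (proj₁ splitting) (tail a)
        (λ t≋0 → a≢0 λ { zero → a₀ ; (suc i) → t≋0 i }) (ℕ.≤-trans (ℕ.m≤n+m _ (nz (a zero))) a≤b))
      (ℕ.+-mono-≤ (ℕ.m≤n+m _ (nz (a zero))) (ℕ.≤-reflexive (support-cong {x = t} λ j →
        sym (trans (cong (λ c → c * M zero j + t j) a₀)
          (trans (cong (_+ t j) (zeroˡ (M zero j))) (+-identityˡ _))))))
    go (suc c) a₀ with e , ec≡1 ← inverse c = ℕ.≤-trans (pred≤⇒≤suc d
      (heavy-sound R (tail M) (R~M ∘ suc) (ℕ.pred b) (ℕ.pred d) (R~M zero) (proj₂ splitting) (suc e ⊛ tail a)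
        (ℕ.≤-trans (ℕ.≤-reflexive (support-scale e (tail a)))
          (ℕ.pred-mono-≤ (subst (λ c → nz c ℕ.+ support (tail a) ≤ b) a₀ a≤b)))))
      (ℕ.≤-reflexive (cong₂ ℕ._+_
        (trans (cong ℕ.suc (support-scale e (tail a))) (cong (λ c → nz c ℕ.+ support (tail a)) (sym a₀)))
        (trans (support-cong {x = M zero ⊕ ((suc e ⊛ tail a) ᵥ* tail M)} λ j →
            trans (cong (_+ ((suc e ⊛ tail a) ᵥ* tail M) j)
              (trans (sym (*-identityˡ (M zero j))) (cong (_* M zero j) (sym (trans (cong (suc e *_) a₀) ec≡1)))))
            (ᵥ*-⊛ (suc e) a M j))
          (support-scale e (a ᵥ* M)))))

  ℕ-sum-++ : ∀ m {n} (f : Vector ℕ (m ℕ.+ n)) →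
    ℕΣ.sum f ≡ ℕΣ.sum (f ∘ (_↑ˡ n)) ℕ.+ ℕΣ.sum (f ∘ (m ↑ʳ_))
  ℕ-sum-++ ℕ.zero    f = refl
  ℕ-sum-++ (ℕ.suc m) f = trans (cong (f zero ℕ.+_) (ℕ-sum-++ m (f ∘ suc))) (sym (ℕ.+-assoc (f zero) _ _))

  -- A light word has few nonzero entries in one of its two halves.
  halves-heavy : ∀ {m n} (A : Matrix m n) (B : Matrix n m) (R : Vec (Vec ℕ n) m) (S : Vec (Vec ℕ m) n) →
    RepresentsRows R A → RepresentsRows S B → ∀ b c d → d ≤ ℕ.suc b ℕ.+ ℕ.suc c →
    allHeavy R b d ≡ true → allHeavy S c d ≡ true →
    {x : Word (m ℕ.+ n)} → right m x ≋ left m x ᵥ* A → left m x ≋ right m x ᵥ* B →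
    ¬ (x ≋ 𝟎) → d ≤ weight x
  halves-heavy {m} A B R S R~A S~B b c d d≤ hR hS {x} v≋uA u≋vB x≢0 =
    subst (d ≤_) (sym (trans (weight≡support x) (ℕ-sum-++ m (nz ∘ x))))
      (bound (support u ℕ.≤? b) (support v ℕ.≤? c))
    where
    u = left m x
    v = right m x
    bound : Dec (support u ≤ b) → Dec (support v ≤ c) → d ≤ support u ℕ.+ support v
    bound (yes u≤b) _ = subst (λ k → d ≤ support u ℕ.+ k) (sym (support-cong {x = v} {u ᵥ* A} v≋uA))
      (allHeavy-sound R A R~A b d (subst T (sym hR) tt) u
        (λ u≋0 → x≢0 (split-ext m u≋0 (λ j → trans (v≋uA j) (∙-zeroˡ {x = u} u≋0)))) u≤b)
    bound (no _) (yes v≤c) = subst (d ≤_) (ℕ.+-comm (support v) (support u))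
      (subst (λ k → d ≤ support v ℕ.+ k) (sym (support-cong {x = u} {v ᵥ* B} u≋vB))
        (allHeavy-sound S B S~B c d (subst T (sym hS) tt) v
          (λ v≋0 → x≢0 (split-ext m (λ j → trans (u≋vB j) (∙-zeroˡ {x = v} v≋0)) v≋0)) v≤c))
    bound (no u≰b) (no v≰c) = ℕ.≤-trans d≤ (ℕ.+-mono-≤ (ℕ.≰⇒> u≰b) (ℕ.≰⇒> v≰c))

-- Minimum weight 9 of the extended quadratic residue code.

module MinimumWeight where
  open import Data.Bool.Base using (true)
  open import Data.Fin.Patterns using (8F)
  open import Data.Vec.Base as Vec using (Vec)
  open import Relation.Binary.PropositionalEquality
  open QuadraticResidueCode
  open WordWeights
  open GF7
  open MatrixAlgebra GF7-commutativeRing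
  open RawRing (GF 7)
  open LinearAlgebra (GF 7) hiding (zero)
  open Codes 7
  open import Algebra.Properties.CommutativeMonoid.Sum ℕ.+-0-commutativeMonoid as ℕΣ using ()
  open Systematic A using (generator)

  -- An entry 0 of A becomes 7 here, which is harmless because tables represent words modulo 7.
  -Aᵀ-table : Vec (Vec ℕ 10) 10
  -Aᵀ-table = Vec.transpose (Vec.map (Vec.map (7 ℕ.∸_)) A-table)

  -Aᵀ : Matrix 10 10
  -Aᵀ j i = - A i j

  -Aᵀ-represented : RepresentsRows -Aᵀ-table -Aᵀ
  -Aᵀ-represented = from-yes (Fin.all? λ i → Fin.all? λ j → fromTable -Aᵀ-table i j Fin.≟ -Aᵀ i j)

  A-heavy : allHeavy A-table 4 9 ≡ true
  A-heavy = refl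

  -Aᵀ-heavy : allHeavy -Aᵀ-table 4 9 ≡ true
  -Aᵀ-heavy = refl

  QR₂₀-minWeight : HasMinWeight QR₂₀ 9
  QR₂₀-minWeight = record
    -- Row 8 of A has exactly two zeros, so this generator row has weight 1 + 8.
    { attained = generator 8F , generator∈QR₂₀ 8F , (λ h → contradiction (h 8F) λ ()) , refl
    -- The bound 4 for each half suffices: with at least five nonzero entries in both halves the
    -- weight is already 10.
    ; minimal  = λ {x} x∈QR → halves-heavy A -Aᵀ A-table -Aᵀ-table (λ _ _ → refl) -Aᵀ-represented 4 4 9
        (ℕ.n≤1+n 9) A-heavy -Aᵀ-heavy {x} (QR₂₀-systematic {x} x∈QR)
        (QR.co-systematic generator-orthogonal {x} x∈QR) }

  QR₂₀-isCode : Is[ 20 , 10 , 9 ]Code QR₂₀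
  QR₂₀-isCode = record
    { subspace  = QR₂₀-isSubspace
    ; dimension = generator , QR.basis
    ; minWeight = QR₂₀-minWeight }

-- A checker for case distinctions over skew matrices.

module Checker where
  open import Data.Bool.Base using (Bool; true; false; _∧_; if_then_else_)
  import Data.Bool.Properties as Bool
  open import Data.List.Base as List using (List; []; _∷_; [_]; _++_; map; concatMap; upTo)
  import Data.List.Properties as List
  open import Data.List.Relation.Unary.All using ([]; _∷_)
  open import Data.List.Relation.Unary.AllPairs using (_∷_)
  open import Data.List.Relation.Binary.Pointwise using ([]; _∷_)
  open import Data.Maybe.Base as Maybe using (Maybe; just; nothing; maybe′)
  open import Data.Nat.Base using (_≤ᵇ_)
  import Data.Nat.ListAction as ℕL
  import Data.Nat.ListAction.Properties as ℕL
  open import Data.Product.Base using (map₂)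
  open import Data.Vec.Base as Vec using (Vec; lookup)
  open import Relation.Binary.PropositionalEquality hiding ([_])
  open import Relation.Nullary.Decidable using (does)
  open WordWeights
  open RawRing (GF 7)
  open LinearAlgebra (GF 7) using (⟦_⟧; Matrix)

  data Entry : Set where
    none plus minus : Entry

  opposite : Entry → Entry
  opposite none  = none
  opposite plus  = minus
  opposite minus = plus

  agree disagree : Entry → Entry → ℕ
  agree plus  plus  = 1
  agree minus minus = 1
  agree _     _     = 0
  disagree plus  minus = 1
  disagree minus plus  = 1
  disagree _     _     = 0

  -- The entry at row k of the codeword 3 e_w − S_w attached to a vertex w of a
  -- skew matrix S, as a function of S_w k (which is `none` only for k = w).
  value : Entry → Fin 7
  value none  = suc (suc (suc zero))
  value plus  = - 1#
  value minus = 1#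

  Pattern : Set
  Pattern = List Entry

  -- The pattern of a vertex lists its entries in the rows of the named vertices,
  -- the last named vertex first; a cell counts the vertices of a given pattern.
  Cell : Set
  Cell = Pattern × ℕ

  cell : Pattern → ℕ → List Cell
  cell t 0             = []
  cell t c@(ℕ.suc _) = [ t , c ]

  -- An entry `none` shows that the vertex has been named before; such a vertex must not be named
  -- again.
  hasNone : Pattern → Bool
  hasNone []         = false
  hasNone (none ∷ _) = true
  hasNone (_ ∷ t)    = hasNone t

  -- A pattern with an entry `none` belongs to a single named vertex, so the
  -- entry of a new row there is determined by skewness.
  forced : Pattern → Pattern → Maybe Entry
  forced (e ∷ _)  (none ∷ _)  = just (opposite e)
  forced (_ ∷ t₀) (plus ∷ t)  = forced t₀ t
  forced (_ ∷ t₀) (minus ∷ t) = forced t₀ t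
  forced _        _           = nothing

  -- The vertices of a cell cannot be told apart by the rows named so far, so a new row splits the
  -- cell in c + 1 essentially different ways, according to its number a of entries `plus`.
  choices : Pattern → Cell → List (List Cell)
  choices t₀ (t , c) = maybe′ (λ s → [ cell (s ∷ t) c ])
    (map (λ a → cell (plus ∷ t) a ++ cell (minus ∷ t) (c ℕ.∸ a)) (upTo (ℕ.suc c))) (forced t₀ t)

  Counter : Set
  Counter = ℕ × ℕ

  -- Two rows of a skew Hadamard matrix of order 20 agree in 9 and disagree in 9 of
  -- the columns off their diagonal entries.
  tally : Entry → ℕ → Pattern → List Counter → List Counter
  tally s c (e ∷ t) ((a , b) ∷ cs) = (agree s e ℕ.* c ℕ.+ a , disagree s e ℕ.* c ℕ.+ b) ∷ tally s c t cs
  tally s c _       cs             = cs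

  tallyCells : List Cell → List Counter → List Counter
  tallyCells []                 cs = cs
  tallyCells (([]    , c) ∷ xs) cs = tallyCells xs cs
  tallyCells ((s ∷ t , c) ∷ xs) cs = tallyCells xs (tally s c t cs)

  -- Upper bounds are enough. Off the two diagonal positions 18 columns are counted, so a complete
  -- row with both counts at most 9 has both equal to 9, while a partial row can be rejected as soon
  -- as one bound is exceeded.
  within : List Counter → Bool
  within []             = true
  within ((a , b) ∷ cs) = (a ≤ᵇ 9) ∧ ((b ≤ᵇ 9) ∧ within cs)

  -- The counters are tested after every cell instead of after the whole row, so that most of the
  -- product of the individual choices is never formed.
  expand : Pattern → List Cell → List Counter → List (List Cell)
  extend : Pattern → List Cell → List Counter → List Cell → List (List Cell)

  expand t₀ []       cs = [ [] ]
  expand t₀ (x ∷ xs) cs = concatMap (extend t₀ xs cs) (choices t₀ x)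

  extend t₀ xs cs ch = if within cs′ then map (ch ++_) (expand t₀ xs cs′) else []
    where cs′ = tallyCells ch cs

  pick : {A : Set} → ℕ → List A → Maybe (A × List A)
  pick _         []       = nothing
  pick 0         (x ∷ xs) = just (x , xs)
  pick (ℕ.suc k) (x ∷ xs) = Maybe.map (map₂ (x ∷_)) (pick k xs)

  -- The value `nothing` rejects a certificate that points to a missing or empty cell or to a vertex
  -- already named. Otherwise the chosen vertex leaves its cell, receives a singleton cell with
  -- `none` in front, and starts one zero counter for each row named before.
  children : Maybe (Cell × List Cell) → Maybe (List (List Cell))
  children nothing                   = nothing
  children (just ((t₀ , 0) , _))     = nothing
  children (just ((t₀ , ℕ.suc c) , rest)) = if hasNone t₀ then nothing else
    just (map ((none ∷ t₀ , 1) ∷_) (expand t₀ ((t₀ , c) ∷ rest) (map (λ _ → 0 , 0) t₀)))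

  combination : List (Fin 7) → Pattern → Fin 7
  combination (l ∷ ls) (e ∷ t) = l * value e + combination ls t
  combination _        _       = 0#

  combinationWeight : List (Fin 7) → List Cell → ℕ
  combinationWeight ls = ℕL.sum ∘ map (λ (t , c) → c ℕ.* nz (combination ls t))

  -- `light ls`: the combination of the named codewords with coefficients ls has
  -- weight between 1 and 8.  `split i cs`: name a vertex of the i-th cell and
  -- continue with one certificate for each way its row can split the cells.
  -- `leaf Λ pos`: pos gives for every coordinate the cell of a vertex and a sign
  -- under which the combinations Λ become the rows of a generator matrix.
  data Certificate (k n : ℕ) : Set where
    light : List (Fin 7) → Certificate k n
    leaf  : Vec (List (Fin 7)) k → Vec (ℕ × Sign) n → Certificate k n
    split : ℕ → List (Certificate k n) → Certificate k n

  patternAt : ℕ → List Cell → Maybe Pattern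
  patternAt k cells with pick k cells
  ... | just ((t , ℕ.suc _) , _) = just t
  ... | _                        = nothing

  module _ {k n : ℕ} (G : Matrix k n) where

    matches : Vec (List (Fin 7)) k → Vec (ℕ × Sign) n → List Cell → Fin n → Bool
    matches Λ pos cells c = maybe′
      (λ t → does (Fin.all? λ l → combination (lookup Λ l) t Fin.≟ ⟦ proj₂ (lookup pos c) ⟧ * G l c))
      false (patternAt (proj₁ (lookup pos c)) cells)

    run : Certificate k n → List Cell → Bool
    runAll : List (Certificate k n) → List (List Cell) → Bool
    runSplit : List (Certificate k n) → Maybe (List (List Cell)) → Bool

    run (light ls) cells = (1 ≤ᵇ combinationWeight ls cells) ∧ (combinationWeight ls cells ≤ᵇ 8)
    run (leaf Λ pos) cells = does (Fin.all? λ c → matches Λ pos cells c Bool.≟ true)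
    run (split i cs) cells = runSplit cs (children (pick i cells))

    runSplit cs nothing   = false
    runSplit cs (just xs) = runAll cs xs

    -- A split without any child is closed by counting alone: no row is compatible with the rows
    -- named so far.
    runAll cs       []       = true
    runAll []       (_ ∷ _)  = false
    runAll (c ∷ cs) (x ∷ xs) = run c x ∧ runAll cs xs

-- The certificate: light words and identifications with the code.

module SkewHadamardCertificate where
  open import Data.Bool.Base using (true)
  open import Data.List.Base using (List; []; _∷_)
  open import Data.Nat.DivMod using (_mod_)
  open import Data.Vec.Base using (Vec) renaming (_∷_ to _∷ᵛ_; [] to []ᵛ)
  open import Relation.Binary.PropositionalEquality using (_≡_; refl)
  open QuadraticResidueCode
  open Checker
  open GF7
  open MatrixAlgebra.Systematic GF7-commutativeRing A using (generator)

  -- Coefficient lists are written as numbers with base 7 digits, the first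
  -- coefficient being the last digit.
  word : ℕ → List (Fin 7)
  word = digits 10
    where
    digits : ℕ → ℕ → List (Fin 7)
    digits ℕ.zero    _ = []
    digits (ℕ.suc k) x = (x mod 7) ∷ digits k (x ℕ./ 7)

  -- Combinations bringing the ten named codewords into the systematic form of `generator`, up to
  -- relabelling. Like patterns, coefficient lists begin with the vertex named last.
  Λ1 : Vec (List (Fin 7)) 10
  Λ1 =
    word 58744887 ∷ᵛ word 111453697 ∷ᵛ word 156891023 ∷ᵛ word 192300628 ∷ᵛ word 250076501 ∷ᵛ word
    168828434 ∷ᵛ word 277946017 ∷ᵛ word 172190433 ∷ᵛ word 149396833 ∷ᵛ word 66558482 ∷ᵛ []ᵛ

  -- The indices are a permutation of 0, ..., 19: at a leaf the patterns separate all vertices. Cell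
  -- 19 belongs to the vertex whose row was normalised at the start, and it takes the extension
  -- coordinate of the code.
  pos1 : Vec (ℕ × Sign) 20
  pos1 =
    (19 , Sign.+) ∷ᵛ (12 , Sign.-) ∷ᵛ (2 , Sign.-) ∷ᵛ (8 , Sign.-) ∷ᵛ (9 , Sign.-) ∷ᵛ (16 ,
    Sign.-) ∷ᵛ (13 , Sign.-) ∷ᵛ (18 , Sign.-) ∷ᵛ (17 , Sign.-) ∷ᵛ (10 , Sign.-) ∷ᵛ (3 , Sign.-) ∷ᵛ
    (5 , Sign.-) ∷ᵛ (4 , Sign.-) ∷ᵛ (0 , Sign.-) ∷ᵛ (1 , Sign.-) ∷ᵛ (6 , Sign.-) ∷ᵛ (7 , Sign.-)
    ∷ᵛ (15 , Sign.-) ∷ᵛ (14 , Sign.-) ∷ᵛ (11 , Sign.-) ∷ᵛ []ᵛ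

  Λ2 : Vec (List (Fin 7)) 10
  Λ2 =
    word 196810547 ∷ᵛ word 71280650 ∷ᵛ word 271951344 ∷ᵛ word 231264195 ∷ᵛ word 251652498 ∷ᵛ word
    73315112 ∷ᵛ word 68271748 ∷ᵛ word 132056981 ∷ᵛ word 40372747 ∷ᵛ word 33365284 ∷ᵛ []ᵛ

  pos2 : Vec (ℕ × Sign) 20
  pos2 =
    (19 , Sign.+) ∷ᵛ (13 , Sign.-) ∷ᵛ (15 , Sign.-) ∷ᵛ (9 , Sign.-) ∷ᵛ (2 , Sign.-) ∷ᵛ (0 ,
    Sign.-) ∷ᵛ (14 , Sign.-) ∷ᵛ (4 , Sign.-) ∷ᵛ (18 , Sign.-) ∷ᵛ (12 , Sign.-) ∷ᵛ (16 , Sign.-) ∷ᵛ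
    (6 , Sign.-) ∷ᵛ (17 , Sign.-) ∷ᵛ (5 , Sign.-) ∷ᵛ (11 , Sign.-) ∷ᵛ (7 , Sign.-) ∷ᵛ (8 , Sign.-)
    ∷ᵛ (3 , Sign.-) ∷ᵛ (1 , Sign.-) ∷ᵛ (10 , Sign.-) ∷ᵛ []ᵛ

  Λ3 : Vec (List (Fin 7)) 10
  Λ3 =
    word 196810547 ∷ᵛ word 71583176 ∷ᵛ word 272153028 ∷ᵛ word 231163353 ∷ᵛ word 251249130 ∷ᵛ word
    73415954 ∷ᵛ word 67868380 ∷ᵛ word 132157823 ∷ᵛ word 40473589 ∷ᵛ word 33466126 ∷ᵛ []ᵛ

  pos3 : Vec (ℕ × Sign) 20
  pos3 =
    (19 , Sign.+) ∷ᵛ (13 , Sign.-) ∷ᵛ (15 , Sign.-) ∷ᵛ (9 , Sign.-) ∷ᵛ (2 , Sign.-) ∷ᵛ (0 ,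
    Sign.-) ∷ᵛ (14 , Sign.-) ∷ᵛ (4 , Sign.-) ∷ᵛ (17 , Sign.-) ∷ᵛ (10 , Sign.-) ∷ᵛ (18 , Sign.-) ∷ᵛ
    (5 , Sign.-) ∷ᵛ (16 , Sign.-) ∷ᵛ (6 , Sign.-) ∷ᵛ (12 , Sign.-) ∷ᵛ (7 , Sign.-) ∷ᵛ (8 , Sign.-)
    ∷ᵛ (3 , Sign.-) ∷ᵛ (1 , Sign.-) ∷ᵛ (11 , Sign.-) ∷ᵛ []ᵛ

  Λ4 : Vec (List (Fin 7)) 10
  Λ4 =
    word 78906526 ∷ᵛ word 235459299 ∷ᵛ word 203435850 ∷ᵛ word 31981170 ∷ᵛ word 215282786 ∷ᵛ word
    232942737 ∷ᵛ word 255837006 ∷ᵛ word 84881382 ∷ᵛ word 129645762 ∷ᵛ word 109131944 ∷ᵛ []ᵛ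

  pos4 : Vec (ℕ × Sign) 20
  pos4 =
    (19 , Sign.+) ∷ᵛ (11 , Sign.-) ∷ᵛ (15 , Sign.-) ∷ᵛ (7 , Sign.-) ∷ᵛ (9 , Sign.-) ∷ᵛ (13 ,
    Sign.-) ∷ᵛ (14 , Sign.-) ∷ᵛ (1 , Sign.-) ∷ᵛ (18 , Sign.-) ∷ᵛ (0 , Sign.-) ∷ᵛ (3 , Sign.-) ∷ᵛ
    (2 , Sign.-) ∷ᵛ (17 , Sign.-) ∷ᵛ (5 , Sign.-) ∷ᵛ (10 , Sign.-) ∷ᵛ (4 , Sign.-) ∷ᵛ (6 , Sign.-)
    ∷ᵛ (16 , Sign.-) ∷ᵛ (12 , Sign.-) ∷ᵛ (8 , Sign.-) ∷ᵛ []ᵛ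

  -- Found by a computer search that names, at each step, a vertex of a cell
  -- leaving the fewest cases.
  certificate : Certificate 10 20
  certificate =
    split 1 ( (split 1 ( (split 1 ( light (word 2115) ∷ (split 1 ( (split 15 ( light (word 2794) ∷ light (word 17200) ∷ light (word 103251) ∷ light (word 2794) ∷ (split 11 (
    light (word 14708) ∷ light (word 101144) ∷ (split 7 ( light (word 100934) ∷ light (word 100934) ∷ light (word 120394) ∷ light (word 5061309) ∷ light (word 823936) ∷ [])) ∷
    light (word 722709) ∷ (split 17 ( light (word 17200) ∷ light (word 4941651) ∷ light (word 826288) ∷ light (word 840694) ∷ light (word 17158) ∷ [])) ∷ (split 8 ( light (word 720308) ∷ light (word 706196) ∷ light (word 708002) ∷ light (word 14708) ∷ [])) ∷
    light (word 101144) ∷ light (word 31221) ∷ light (word 103587) ∷ [])) ∷ (split 15 (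
    light (word 118042) ∷ (split 16 ( light (word 103286) ∷ (split 8 ( (split 6 ( (leaf Λ1
    pos1) ∷ [])) ∷ [])) ∷ [])) ∷ light (word 2360) ∷ light (word 2360) ∷ light (word 14799)
    ∷ [])) ∷ light (word 19552) ∷ [])) ∷ (split 3 ( light (word 100899) ∷ light (word 400) ∷
    light (word 2794) ∷ light (word 101193) ∷ light (word 19258) ∷ light (word 100899) ∷
    light (word 100899) ∷ light (word 19552) ∷ [])) ∷ light (word 2752) ∷ (split 14 ( light (word 2794) ∷ light (word 16864) ∷ light (word 17200) ∷ light (word 103251) ∷ light (word 16864) ∷ light (word 2458) ∷ light (word 16864) ∷ light (word 19552) ∷ [])) ∷
    (split 11 ( light (word 16864) ∷ (split 13 ( light (word 120394) ∷ (split 7 ( [])) ∷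
    (split 7 ( (split 15 ( (split 15 ( (leaf Λ2 pos2) ∷ [])) ∷ [])) ∷ [])) ∷ light (word 101144)
    ∷ [])) ∷ (split 15 ( light (word 16472) ∷ light (word 102950) ∷ [])) ∷ (split 11 ( light (word 16472) ∷ light (word 115298) ∷ [])) ∷ (split 6 ( light (word 16514) ∷ light (word 14463) ∷ light (word 16472) ∷ light (word 400) ∷ (split 17 ( light (word 842752) ∷ []))
    ∷ light (word 705951) ∷ light (word 118000) ∷ (split 15 ( light (word 100934) ∷ [])) ∷
    light (word 19216) ∷ light (word 120058) ∷ light (word 120058) ∷ light (word 134464) ∷
    [])) ∷ (split 11 ( light (word 101235) ∷ (split 5 ( [])) ∷ light (word 115256) ∷ [])) ∷
    [])) ∷ light (word 14463) ∷ (split 6 ( light (word 103251) ∷ light (word 400) ∷ light (word 400) ∷ light (word 2794) ∷ light (word 101193) ∷ light (word 2458) ∷ light (word 400) ∷ light (word 19552) ∷ [])) ∷ [])) ∷ (split 2 ( (split 14 ( light (word 103293) ∷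
    light (word 2752) ∷ light (word 16864) ∷ light (word 17158) ∷ light (word 16864) ∷
    light (word 2458) ∷ light (word 16864) ∷ light (word 19552) ∷ [])) ∷ (split 11 ( light (word 16864) ∷ (split 14 ( light (word 14708) ∷ light (word 101480) ∷ [])) ∷ (split 13 (
    light (word 120100) ∷ (split 7 ( [])) ∷ (split 7 ( (split 15 ( (split 15 ( (leaf Λ3 pos3) ∷
    [])) ∷ [])) ∷ [])) ∷ light (word 102908) ∷ [])) ∷ (split 6 ( light (word 15044) ∷ (split
    15 ( light (word 100934) ∷ [])) ∷ light (word 14757) ∷ light (word 14708) ∷ light (word 400) ∷ (split 16 ( light (word 840694) ∷ [])) ∷ light (word 706245) ∷ light (word 117706) ∷ light (word 19216) ∷ light (word 120058) ∷ light (word 120058) ∷ light (word 134464) ∷ [])) ∷ (split 11 ( light (word 14708) ∷ light (word 115592) ∷ [])) ∷ (split 11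
    ( light (word 101235) ∷ (split 5 ( [])) ∷ light (word 115256) ∷ [])) ∷ [])) ∷ light (word 14463) ∷ (split 6 ( light (word 103293) ∷ light (word 400) ∷ light (word 400) ∷ light (word 101235) ∷ light (word 2752) ∷ light (word 2458) ∷ light (word 400) ∷ light (word 19552) ∷ [])) ∷ light (word 400) ∷ (split 2 ( light (word 103587) ∷ light (word 400) ∷
    light (word 400) ∷ light (word 2794) ∷ light (word 101193) ∷ light (word 100899) ∷
    light (word 400) ∷ light (word 19258) ∷ [])) ∷ (split 2 ( light (word 103587) ∷ light (word 103587) ∷ light (word 2794) ∷ (split 15 ( light (word 725103) ∷ (split 11 ( light (word 806744) ∷ light (word 720308) ∷ light (word 806786) ∷ light (word 115256) ∷ []))
    ∷ light (word 14799) ∷ (split 15 ( light (word 722751) ∷ light (word 706196) ∷ light (word 706196) ∷ light (word 720350) ∷ [])) ∷ light (word 101144) ∷ light (word 19503) ∷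
    light (word 115256) ∷ (split 7 ( light (word 102950) ∷ light (word 16472) ∷ light (word 120100) ∷ light (word 115298) ∷ [])) ∷ light (word 115256) ∷ [])) ∷ light (word 100899)
    ∷ (split 16 ( (split 4 ( (split 17 ( (split 7 ( (leaf Λ4 pos4) ∷ [])) ∷ [])) ∷ [])) ∷ light (word 645) ∷ light (word 102908) ∷ light (word 102908) ∷ light (word 118000) ∷ [])) ∷
    light (word 19258) ∷ [])) ∷ [])) ∷ light (word 400) ∷ [])) ∷ [])) ∷ [])

  -- The initial cells are those of one named vertex and of the 19 others, whose entries in its row
  -- have been made `plus` by changes of sign.
  certificate-accepted : run generator certificate ((none ∷ [] , 1) ∷ (plus ∷ [] , 19) ∷ []) ≡ true
  certificate-accepted = refl

-- Soundness of the checker.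

module CheckerSoundness where
  open import Data.Bool.Base using (Bool; true; false; _∧_; T)
  import Data.Bool.Properties as Bool
  open import Data.List.Base as List using (List; []; _∷_; [_]; _++_; map; concatMap; upTo; allFin; length)
  import Data.List.Properties as List
  open import Data.List.Membership.Propositional using (_∈_)
  import Data.List.Membership.Propositional.Properties as Membership
  open import Data.List.Relation.Unary.All as All using (All; []; _∷_)
  import Data.List.Relation.Unary.All.Properties as All
  open import Data.List.Relation.Unary.Any as Any using (Any; here; there)
  import Data.List.Relation.Unary.AllPairs as AllPairs
  open import Data.List.Relation.Unary.Unique.Propositional.Properties using (allFin⁺)
  open import Data.List.Relation.Binary.Permutation.Propositional using (_↭_; ↭-refl; ↭-sym; ↭-trans; ↭-prep; ↭-reflexive; ↭⇒↭ₛ)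
  import Data.List.Relation.Binary.Permutation.Propositional.Properties as Perm
  import Data.List.Relation.Binary.Permutation.Setoid.Properties as PermSetoid
  open import Data.List.Relation.Binary.Pointwise as Pointwise using (Pointwise; []; _∷_)
  open import Data.Maybe.Base as Maybe using (Maybe; just; nothing)
  open import Data.Nat.Base using (_≤ᵇ_)
  import Data.Nat.ListAction as ℕL
  import Data.Nat.ListAction.Properties as ℕL
  open import Data.Product.Base using (map₂)
  open import Data.Unit.Base using (tt)
  open import Data.Vec.Base as Vec using (Vec; lookup)
  open import Function.Bundles using (Equivalence)
  open import Relation.Binary.PropositionalEquality hiding ([_])
  open import Relation.Nullary.Decidable using (does)
  open WordWeights
  open Checker
  open GF7
  open import Algebra.Properties.CommutativeMonoid.Sum ℕ.+-0-commutativeMonoid as ℕΣ using ()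

  does-sound : ∀ {P : Set} (P? : Dec P) → does P? ≡ true → P
  does-sound (yes p) _ = p

  ∧-true : ∀ {a b} → a ∧ b ≡ true → a ≡ true × b ≡ true
  ∧-true {true} {true} _ = refl , refl

  ≤ᵇ-true : ∀ {m n} → (m ≤ᵇ n) ≡ true → m ≤ n
  ≤ᵇ-true {m} {n} eq = ℕ.≤ᵇ⇒≤ m n (subst T (sym eq) tt)

  true-≤ᵇ : ∀ {m n} → m ≤ n → (m ≤ᵇ n) ≡ true
  true-≤ᵇ m≤n = Equivalence.to Bool.T-≡ (ℕ.≤⇒≤ᵇ m≤n)

  pick-↭ : ∀ {A : Set} k {xs : List A} {y ys} → pick k xs ≡ just (y , ys) → xs ↭ y ∷ ys
  pick-↭ 0         {x ∷ xs} refl = ↭-refl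
  pick-↭ (ℕ.suc k) {x ∷ xs} eq with pick k xs in eq′
  pick-↭ (ℕ.suc k) {x ∷ xs} refl | just (y , ys) =
    ↭-trans (↭-prep x (pick-↭ k eq′)) (_↭_.swap x y ↭-refl)

  pick-map : ∀ {A B : Set} (f : A → B) k (xs : List A) {z zs} → pick k (map f xs) ≡ just (z , zs) →
             ∃ λ y → ∃ λ ys → pick k xs ≡ just (y , ys) × f y ≡ z × map f ys ≡ zs
  pick-map f 0         (x ∷ xs) refl = x , xs , refl , refl , refl
  pick-map f (ℕ.suc k) (x ∷ xs) eq with pick k (map f xs) in eq′
  pick-map f (ℕ.suc k) (x ∷ xs) refl | just (z , zs)
    with y , ys , p , q , r ← pick-map f k xs eq′ = y , x ∷ ys , cong (Maybe.map (map₂ (x ∷_))) p , q , cong (f x ∷_) r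

  hasNone-false : ∀ {t} → hasNone t ≡ false → ∀ {e} → e ∈ t → e ≢ none
  hasNone-false {plus ∷ t}  eq (here refl) ()
  hasNone-false {plus ∷ t}  eq (there e∈t) = hasNone-false eq e∈t
  hasNone-false {minus ∷ t} eq (here refl) ()
  hasNone-false {minus ∷ t} eq (there e∈t) = hasNone-false eq e∈t

  -- Blocks list the vertices behind the cells.
  module Blocks {n : ℕ} (S : Fin n → Fin n → Entry) where

    V : Set
    V = Fin n

    Block : Set
    Block = Pattern × List V

    toCell : Block → Cell
    toCell (t , vs) = t , length vs

    vertices : List Block → List V
    vertices = concatMap proj₂

    patternOf : List V → V → Pattern
    patternOf ws v = map (λ w → S w v) ws

    Good : List V → Block → Set
    Good ws (t , vs) = All (λ v → patternOf ws v ≡ t) vs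

    block : Pattern → List V → List Block
    block t []         = []
    block t vs@(_ ∷ _) = [ t , vs ]

    toCell-block : ∀ t vs → map toCell (block t vs) ≡ cell t (length vs)
    toCell-block t []      = refl
    toCell-block t (_ ∷ _) = refl

    vertices-block : ∀ t vs → vertices (block t vs) ≡ vs
    vertices-block t []       = refl
    vertices-block t (v ∷ vs) = cong (v ∷_) (List.++-identityʳ vs)

    good-block : ∀ ws {t} vs → Good ws (t , vs) → All (Good ws) (block t vs)
    good-block ws []      _ = []
    good-block ws (_ ∷ _) g = g ∷ []

    vertices-++ : ∀ bs bs′ → vertices (bs ++ bs′) ≡ vertices bs ++ vertices bs′
    vertices-++ = List.concatMap-++ proj₂

    vertices-↭ : ∀ {bs bs′} → bs ↭ bs′ → vertices bs ↭ vertices bs′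
    vertices-↭ _↭_.refl                = ↭-refl
    vertices-↭ (_↭_.prep b p)          = Perm.++⁺ˡ (proj₂ b) (vertices-↭ p)
    vertices-↭ (_↭_.swap b c p)        = ↭-trans (Perm.shifts (proj₂ b) (proj₂ c))
      (Perm.++⁺ˡ (proj₂ c) (Perm.++⁺ˡ (proj₂ b) (vertices-↭ p)))
    vertices-↭ (_↭_.trans p q)         = ↭-trans (vertices-↭ p) (vertices-↭ q)

    Σᴸ : (V → ℕ) → List V → ℕ
    Σᴸ f vs = ℕL.sum (map f vs)

    Σᴸ-↭ : ∀ f {vs us} → vs ↭ us → Σᴸ f vs ≡ Σᴸ f us
    Σᴸ-↭ f p = ℕL.sum-↭ (Perm.map⁺ f p)

    Σᴸ-++ : ∀ f vs us → Σᴸ f (vs ++ us) ≡ Σᴸ f vs ℕ.+ Σᴸ f us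
    Σᴸ-++ f vs us = trans (cong ℕL.sum (List.map-++ f vs us)) (ℕL.sum-++ (map f vs) (map f us))

    Σᴸ-const : ∀ f c {vs} → All (λ v → f v ≡ c) vs → Σᴸ f vs ≡ c ℕ.* length vs
    Σᴸ-const f c []       = sym (ℕ.*-zeroʳ c)
    Σᴸ-const f c {v ∷ vs} (p ∷ ps) = trans (cong₂ ℕ._+_ p (Σᴸ-const f c ps)) (sym (ℕ.*-suc c (length vs)))

    Σᴸ-allFin : ∀ {m} (f : Fin m → ℕ) → ℕL.sum (map f (allFin m)) ≡ ℕΣ.sum f
    Σᴸ-allFin f = trans (cong ℕL.sum (List.map-tabulate (λ i → i) f)) (go f)
      where
      go : ∀ {m} (f : Fin m → ℕ) → ℕL.sum (List.tabulate f) ≡ ℕΣ.sum f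
      go {ℕ.zero}  f = refl
      go {ℕ.suc m} f = cong (f zero ℕ.+_) (go (f ∘ suc))

    -- The invariant of the search. Stating `cover` as a permutation of all vertices expresses at
    -- once that blocks are disjoint and exhaustive, and lets weights and counts be summed block by
    -- block in any order.
    record Config (cells : List Cell) : Set where
      field
        named  : List V
        blocks : List Block
        cells≡ : map toCell blocks ≡ cells
        good   : All (Good named) blocks
        cover  : vertices blocks ↭ allFin n

    module Splitting (ws : List V) (w : V) where

      t₀ : Pattern
      t₀ = patternOf ws w

      agreement disagreement : V → V → ℕ
      agreement    w′ u = agree (S w u) (S w′ u)
      disagreement w′ u = disagree (S w u) (S w′ u)

      -- The vertices not yet tallied are counted together with the counter. The sum stays below 9
      -- while vertices move from one to the other, so the counter alone is always within its bound.
      Bound : List V → V → Counter → Set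
      Bound us w′ (a , b) = (Σᴸ (agreement w′) us ℕ.+ a ≤ 9) × (Σᴸ (disagreement w′) us ℕ.+ b ≤ 9)

      tally-step : ∀ (f : V → ℕ) {vs} us e a → All (λ v → f v ≡ e) vs → Σᴸ f (vs ++ us) ℕ.+ a ≤ 9 →
                   Σᴸ f us ℕ.+ (e ℕ.* length vs ℕ.+ a) ≤ 9
      tally-step f {vs} us e a h = subst (_≤ 9) (begin
        Σᴸ f (vs ++ us) ℕ.+ a                    ≡⟨ cong (ℕ._+ a) (Σᴸ-++ f vs us) ⟩
        Σᴸ f vs ℕ.+ Σᴸ f us ℕ.+ a                ≡⟨ cong (λ k → k ℕ.+ Σᴸ f us ℕ.+ a) (Σᴸ-const f e h) ⟩
        e ℕ.* length vs ℕ.+ Σᴸ f us ℕ.+ a        ≡⟨ cong (ℕ._+ a) (ℕ.+-comm (e ℕ.* length vs) _) ⟩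
        Σᴸ f us ℕ.+ e ℕ.* length vs ℕ.+ a        ≡⟨ ℕ.+-assoc (Σᴸ f us) _ a ⟩
        Σᴸ f us ℕ.+ (e ℕ.* length vs ℕ.+ a)      ∎)
        where open ≡-Reasoning

      tally-bound : ∀ {vs} us {ws cs} s t → All (λ v → S w v ≡ s) vs → All (λ v → patternOf ws v ≡ t) vs →
                    Pointwise (Bound (vs ++ us)) ws cs → Pointwise (Bound us) ws (tally s (length vs) t cs)
      tally-bound us s []      hs ht []       = []
      tally-bound us s (e ∷ t) hs ht []       = []
      tally-bound {[]}    us s []      hs ht         (b ∷ bs) = b ∷ bs
      tally-bound {_ ∷ _} us s []      hs (() ∷ _) (b ∷ bs)
      tally-bound {vs} us {w′ ∷ _} {(a , b) ∷ _} s (e ∷ t) hs ht ((ha , hb) ∷ bs) =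
        (tally-step (agreement w′) us (agree s e) a (All.zipWith (λ (p , q) → cong₂ agree p (List.∷-injectiveˡ q)) (hs , ht)) ha
        , tally-step (disagreement w′) us (disagree s e) b (All.zipWith (λ (p , q) → cong₂ disagree p (List.∷-injectiveˡ q)) (hs , ht)) hb)
        ∷ tally-bound us s t hs (All.map List.∷-injectiveʳ ht) bs

      tallyCells-bound : ∀ bs {us ws cs} → All (Good (w ∷ ws)) bs → Pointwise (Bound (vertices bs ++ us)) ws cs →
                         Pointwise (Bound us) ws (tallyCells (map toCell bs) cs)
      tallyCells-bound []                    []       h = h
      tallyCells-bound (([] , []) ∷ bs)      (g ∷ gs) h = tallyCells-bound bs gs h
      tallyCells-bound (([] , v ∷ vs) ∷ bs)  ((() ∷ _) ∷ gs) h
      tallyCells-bound ((s ∷ t , vs) ∷ bs) {us} {ws′} {cs} (g ∷ gs) h = tallyCells-bound bs gs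
        (tally-bound {vs} (vertices bs ++ us) s t (All.map List.∷-injectiveˡ g) (All.map List.∷-injectiveʳ g)
          (subst (λ z → Pointwise (Bound z) ws′ cs) (List.++-assoc vs (vertices bs) us) h))

      within-true : ∀ {us ws cs} → Pointwise (Bound us) ws cs → within cs ≡ true
      within-true []                = refl
      within-true {us} {w′ ∷ _} ((ha , hb) ∷ bs)
        rewrite true-≤ᵇ (ℕ.m+n≤o⇒n≤o (Σᴸ (agreement w′) us) ha)
              | true-≤ᵇ (ℕ.m+n≤o⇒n≤o (Σᴸ (disagreement w′) us) hb) = within-true {us} bs

      partition : ∀ vs → All (λ v → S w v ≢ none) vs → ∃ λ ps → ∃ λ ms →
                  ps ++ ms ↭ vs × All (λ v → S w v ≡ plus) ps × All (λ v → S w v ≡ minus) ms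
      partition []       []       = [] , [] , ↭-refl , [] , []
      partition (v ∷ vs) (h ∷ hs) with partition vs hs | S w v in eq
      ... | _                        | none  = contradiction refl h
      ... | ps , ms , p , hps , hms | plus  = v ∷ ps , ms , ↭-prep v p , eq ∷ hps , hms
      ... | ps , ms , p , hps , hms | minus =
        ps , v ∷ ms , ↭-trans (Perm.shift v ps ms) (↭-prep v p) , hps , eq ∷ hms

      module _ (off : ∀ {v u} → S v u ≡ none → v ≡ u) (skew : ∀ v u → S u v ≡ opposite (S v u)) where

        -- An entry `none` in the row of w′ identifies v with w′, whose entry in the new row is
        -- opposite to the known entry of w in the row of w′.
        forced-sound : ∀ ws v {s} → forced (patternOf ws w) (patternOf ws v) ≡ just s → S w v ≡ s
        forced-sound (w′ ∷ ws) v eq with S w′ v in eq′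
        forced-sound (w′ ∷ ws) v refl | none = trans (cong (S w) (sym (off eq′))) (skew w′ w)
        forced-sound (w′ ∷ ws) v eq   | plus  = forced-sound ws v eq
        forced-sound (w′ ∷ ws) v eq   | minus = forced-sound ws v eq

        good-∷ : ∀ {t s vs} → Good ws (t , vs) → All (λ v → S w v ≡ s) vs → Good (w ∷ ws) (s ∷ t , vs)
        good-∷ g h = All.zipWith (λ (p , q) → cong₂ _∷_ q p) (g , h)

        -- The actual entries of row w divide the block, and this division is listed because its
        -- number of entries `plus` does not exceed the size of the block.
        split-block : ∀ t vs → Good ws (t , vs) → All (λ v → S w v ≢ none) vs →
                      ∃ λ bs → vertices bs ↭ vs × All (Good (w ∷ ws)) bs × map toCell bs ∈ choices t₀ (t , length vs)
        split-block t vs g h with forced t₀ t in eq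
        ... | just s = block (s ∷ t) vs , ↭-reflexive (vertices-block (s ∷ t) vs)
          , good-block (w ∷ ws) vs (good-∷ g (All.map (λ {v} p → forced-sound ws v (trans (cong (forced t₀) p) eq)) g))
          , here (toCell-block (s ∷ t) vs)
        ... | nothing with ps , ms , p , hps , hms ← partition vs h =
          block (plus ∷ t) ps ++ block (minus ∷ t) ms
          , ↭-trans (↭-reflexive (trans (vertices-++ (block (plus ∷ t) ps) _)
              (cong₂ _++_ (vertices-block (plus ∷ t) ps) (vertices-block (minus ∷ t) ms)))) p
          , All.++⁺ (good-block (w ∷ ws) ps (good-∷ (All.++⁻ˡ ps g′) hps)) (good-block (w ∷ ws) ms (good-∷ (All.++⁻ʳ ps g′) hms))
          , subst (_∈ map f (upTo (ℕ.suc (length vs)))) (sym cells)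
              (Membership.∈-map⁺ f (Membership.∈-upTo⁺ (s≤s (subst (length ps ≤_) lengths (ℕ.m≤m+n _ _)))))
          where
          f : ℕ → List Cell
          f a = cell (plus ∷ t) a ++ cell (minus ∷ t) (length vs ℕ.∸ a)
          g′ : All (λ v → patternOf ws v ≡ t) (ps ++ ms)
          g′ = Perm.All-resp-↭ (↭-sym p) g
          lengths : length ps ℕ.+ length ms ≡ length vs
          lengths = trans (sym (List.length-++ ps)) (Perm.↭-length p)
          cells : map toCell (block (plus ∷ t) ps ++ block (minus ∷ t) ms) ≡ f (length ps)
          cells = trans (List.map-++ toCell (block (plus ∷ t) ps) _) (cong₂ _++_ (toCell-block (plus ∷ t) ps)
            (trans (toCell-block (minus ∷ t) ms) (cong (cell (minus ∷ t))
              (trans (sym (ℕ.m+n∸m≡n (length ps) (length ms))) (cong (ℕ._∸ length ps) lengths)))))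

        -- The division induced by S survives every pruning test, since its partial counts never
        -- exceed the full counts, which are at most 9.
        expand-sound : ∀ blocks {cs} → All (Good ws) blocks → All (λ v → S w v ≢ none) (vertices blocks) →
                       Pointwise (Bound (vertices blocks)) ws cs →
                       ∃ λ bs → vertices bs ↭ vertices blocks × All (Good (w ∷ ws)) bs
                              × map toCell bs ∈ expand t₀ (map toCell blocks) cs
        expand-sound []                []       h b = [] , ↭-refl , [] , here refl
        expand-sound ((t , vs) ∷ rest) {cs} (g ∷ gs) h b
          with bs , p , gbs , m ← split-block t vs g (All.++⁻ˡ vs h) = result
          where
          cs′ : List Counter
          cs′ = tallyCells (map toCell bs) cs
          bound′ : Pointwise (Bound (vertices rest)) ws cs′
          bound′ = tallyCells-bound bs gbs (Pointwise.map (λ {w′} {c} → permute w′ c) b)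
            where
            permute : ∀ w′ c → Bound (vs ++ vertices rest) w′ c → Bound (vertices bs ++ vertices rest) w′ c
            permute w′ (a , b) (ha , hb) =
                subst (λ k → k ℕ.+ a ≤ 9) (Σᴸ-↭ (agreement w′) (Perm.++⁺ʳ (vertices rest) (↭-sym p))) ha
              , subst (λ k → k ℕ.+ b ≤ 9) (Σᴸ-↭ (disagreement w′) (Perm.++⁺ʳ (vertices rest) (↭-sym p))) hb
          result : ∃ λ bs → vertices bs ↭ vs ++ vertices rest × All (Good (w ∷ ws)) bs
                          × map toCell bs ∈ expand t₀ ((t , length vs) ∷ map toCell rest) cs
          result with bs′ , p′ , gbs′ , m′ ← expand-sound rest gs (All.++⁻ʳ vs h) bound′ =
              bs ++ bs′ , ↭-trans (↭-reflexive (vertices-++ bs bs′)) (Perm.++⁺ p p′) , All.++⁺ gbs gbs′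
            , Membership.∈-concatMap⁺ (extend t₀ (map toCell rest) cs) (Any.map extended m)
            where
            extended : ∀ {ch} → map toCell bs ≡ ch → map toCell (bs ++ bs′) ∈ extend t₀ (map toCell rest) cs ch
            extended refl rewrite within-true {vertices rest} bound′ | List.map-++ toCell bs bs′ =
              Membership.∈-map⁺ (map toCell bs ++_) m′

      named-splits : (∀ v → S v v ≡ none) → (∀ {v u} → S v u ≡ none → v ≡ u) → (∀ v u → S u v ≡ opposite (S v u)) →
                     (∀ w′ → w ≢ w′ → Σᴸ (agreement w′) (allFin n) ≤ 9 × Σᴸ (disagreement w′) (allFin n) ≤ 9) →
                     ∀ vs rest → hasNone t₀ ≡ false → All (Good ws) ((t₀ , vs) ∷ rest) →
                     w ∷ vertices ((t₀ , vs) ∷ rest) ↭ allFin n →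
                     ∃ λ bs → map toCell bs ∈ expand t₀ ((t₀ , length vs) ∷ map toCell rest) (map (λ _ → 0 , 0) t₀)
                            × All (Good (w ∷ ws)) bs × w ∷ vertices bs ↭ allFin n
      named-splits diag off skew balanced vs rest noNone g cover = result
        where
        others : List V
        others = vertices ((t₀ , vs) ∷ rest)
        -- The list of all vertices has no repetition, so w does not recur among the others, and row
        -- w has no entry `none` there.
        fresh : All (w ≢_) others
        fresh = AllPairs.head (PermSetoid.Unique-resp-↭ (setoid V) (↭⇒↭ₛ (↭-sym cover)) (allFin⁺ n))
        -- Had w been named before, its pattern would contain its diagonal entry `none`.
        named≢ : All (w ≢_) ws
        named≢ = All.tabulate λ {w′} w′∈ws w≡w′ → hasNone-false noNone
          (Membership.∈-map⁺ (λ w′ → S w′ w) w′∈ws) (trans (cong (λ z → S z w) (sym w≡w′)) (diag w))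
        others≤ : ∀ (f : V → ℕ) → Σᴸ f (allFin n) ≤ 9 → Σᴸ f others ℕ.+ 0 ≤ 9
        others≤ f h = ℕ.≤-trans (ℕ.≤-reflexive (ℕ.+-identityʳ _))
          (ℕ.≤-trans (ℕ.m≤n+m _ (f w)) (ℕ.≤-trans (ℕ.≤-reflexive (Σᴸ-↭ f cover)) h))
        bounds : ∀ ws → All (w ≢_) ws → Pointwise (Bound others) ws (map (λ _ → 0 , 0) (patternOf ws w))
        bounds []       []       = []
        bounds (w′ ∷ ws) (h ∷ hs) =
          (others≤ (agreement w′) (proj₁ (balanced w′ h)) , others≤ (disagreement w′) (proj₂ (balanced w′ h))) ∷ bounds ws hs
        result : ∃ λ bs → map toCell bs ∈ expand t₀ ((t₀ , length vs) ∷ map toCell rest) (map (λ _ → 0 , 0) t₀)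
                        × All (Good (w ∷ ws)) bs × w ∷ vertices bs ↭ allFin n
        result with bs , p , gbs , m ← expand-sound off skew ((t₀ , vs) ∷ rest) g
                      (All.map (λ w≢v e → w≢v (off e)) fresh) (bounds ws named≢)
          = bs , m , gbs , ↭-trans (↭-prep w p) cover

  module Soundness {k n : ℕ} (G : LinearAlgebra.Matrix (GF 7) k n) (S : Fin n → Fin n → Entry)
    (diag : ∀ v → S v v ≡ none) (off : ∀ {v u} → S v u ≡ none → v ≡ u)
    (skew : ∀ v u → S u v ≡ opposite (S v u))
    (balanced : ∀ w w′ → w ≢ w′ → ℕΣ.sum (λ u → agree (S w u) (S w′ u)) ≤ 9
                                  × ℕΣ.sum (λ u → disagree (S w u) (S w′ u)) ≤ 9)
    (C : Codes.Code 7 n) (subspace : LinearAlgebra.IsSubspace (GF 7) C)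
    (heavy : ∀ {x} → C x → ¬ LinearAlgebra._≋_ (GF 7) x (LinearAlgebra.𝟎 (GF 7)) → 9 ≤ Codes.weight 7 x)
    (d : Fin n → Sign)
    (word∈C : ∀ w → C (λ v → RawRing._*_ (GF 7) (LinearAlgebra.⟦_⟧ (GF 7) (d v)) (value (S w v))))
    where

    open RawRing (GF 7)
    open LinearAlgebra (GF 7) using (⟦_⟧; 𝟎; _≋_; _⊕_; _⊛_; module IsSubspace)
    open Codes 7 using (Word)
    open Blocks S

    word : V → Word n
    word w v = ⟦ d v ⟧ * value (S w v)

    combine : List (Fin 7) → List V → Word n
    combine (l ∷ ls) (w ∷ ws) = (l ⊛ word w) ⊕ combine ls ws
    combine _        _        = 𝟎

    combine∈C : ∀ ls ws → C (combine ls ws)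
    combine∈C (l ∷ ls) (w ∷ ws) = IsSubspace.add subspace (IsSubspace.scal subspace l (word∈C w)) (combine∈C ls ws)
    combine∈C []       _        = IsSubspace.zero subspace
    combine∈C (_ ∷ _)  []       = IsSubspace.zero subspace

    combine-value : ∀ ls ws v → combine ls ws v ≡ ⟦ d v ⟧ * combination ls (patternOf ws v)
    combine-value (l ∷ ls) (w ∷ ws) v = trans (cong (l * word w v +_) (combine-value ls ws v))
      (MatrixAlgebra.factor GF7-commutativeRing l ⟦ d v ⟧ (value (S w v)) (combination ls (patternOf ws v)))
    combine-value []       _  v = sym (CommutativeRing.zeroʳ GF7-commutativeRing ⟦ d v ⟧)
    combine-value (_ ∷ _)  [] v = sym (CommutativeRing.zeroʳ GF7-commutativeRing ⟦ d v ⟧)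

    nz-sign : ∀ s a → nz (⟦ s ⟧ * a) ≡ nz a
    nz-sign Sign.+ = nz-scale zero
    nz-sign Sign.- = nz-scale (suc (suc (suc (suc (suc zero)))))

    module _ {cells : List Cell} (config : Config cells) where
      open Config config

      -- Whether a coordinate vanishes depends only on the pattern of its vertex, because the sign
      -- `d v` is a unit; hence the cells determine the weight of a true codeword.
      support-combine : ∀ ls → support (combine ls named) ≡ combinationWeight ls cells
      support-combine ls = begin
        support (combine ls named)       ≡⟨ ℕΣ.sum-cong-≗ (λ v → trans (cong nz (combine-value ls named v)) (nz-sign (d v) _)) ⟩
        ℕΣ.sum f                          ≡⟨ Σᴸ-allFin f ⟨
        Σᴸ f (allFin n)                   ≡⟨ Σᴸ-↭ f cover ⟨
        Σᴸ f (vertices blocks)            ≡⟨ blockwise blocks good ⟩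
        combinationWeight ls (map toCell blocks) ≡⟨ cong (combinationWeight ls) cells≡ ⟩
        combinationWeight ls cells        ∎
        where
        open ≡-Reasoning
        f : V → ℕ
        f v = nz (combination ls (patternOf named v))
        blockwise : ∀ bs → All (Good named) bs → Σᴸ f (vertices bs) ≡ combinationWeight ls (map toCell bs)
        blockwise []              []       = refl
        blockwise ((t , vs) ∷ bs) (g ∷ gs) = trans (Σᴸ-++ f vs (vertices bs)) (cong₂ ℕ._+_
          (trans (Σᴸ-const f _ (All.map (cong (nz ∘ combination ls)) g)) (ℕ.*-comm _ (length vs)))
          (blockwise bs gs))

      ¬light : ∀ ls → (1 ≤ᵇ combinationWeight ls cells) ∧ (combinationWeight ls cells ≤ᵇ 8) ≢ true
      ¬light ls eq with h₁ , h₈ ← ∧-true eq = ℕ.<⇒≱ {8} (ℕ.≤-trans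
          (heavy (combine∈C ls named) λ x≋0 → ℕ.<⇒≱ {0} (≤ᵇ-true h₁)
            (ℕ.≤-reflexive (trans (sym (support-combine ls)) (trans (support-cong {x = combine ls named} x≋0) (support-𝟎 {n})))))
          (ℕ.≤-reflexive (trans (weight≡support (combine ls named)) (support-combine ls))))
        (≤ᵇ-true h₈)

      vertexAt : ∀ i {t} → patternAt i cells ≡ just t → ∃ λ v → patternOf named v ≡ t
      vertexAt i {t} eq with pick i cells in eq′
      vertexAt i refl | just ((t , ℕ.suc _) , rest)
        with (_ , v ∷ _) , _ , picked , refl , _ ← pick-map toCell i blocks (trans (cong (pick i) cells≡) eq′)
        with (v≡ ∷ _) ∷ _ ← Perm.All-resp-↭ (pick-↭ i picked) good = v , v≡

    -- Coordinate c of the target code is assigned the vertex g c so that, for all rows of G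
    -- simultaneously, some codeword of C shows the entries of that row up to signs depending on the
    -- coordinate alone.
    Labelling : Set
    Labelling = ∃ λ (g : Fin n → Fin n) → ∃ λ (s : Fin n → Sign) → ∀ l →
      ∃ λ x → C x × ∀ c → x (g c) ≡ ⟦ d (g c) ⟧ * (⟦ s c ⟧ * G l c)

    module _ {cells : List Cell} (config : Config cells) (Λ : Vec (List (Fin 7)) k) (pos : Vec (ℕ × Sign) n) where
      open Config config

      matches-sound : ∀ c → matches G Λ pos cells c ≡ true → ∃ λ v →
                      ∀ l → combination (lookup Λ l) (patternOf named v) ≡ ⟦ proj₂ (lookup pos c) ⟧ * G l c
      matches-sound c eq with patternAt (proj₁ (lookup pos c)) cells in eq′
      ... | just t with v , refl ← vertexAt config (proj₁ (lookup pos c)) eq′ = v ,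
        does-sound (Fin.all? λ l → combination (lookup Λ l) (patternOf named v) Fin.≟ ⟦ proj₂ (lookup pos c) ⟧ * G l c) eq

      leaf-sound : (∀ c → matches G Λ pos cells c ≡ true) → Labelling
      leaf-sound h = (λ c → proj₁ (matches-sound c (h c))) , (λ c → proj₂ (lookup pos c)) , λ l →
        combine (lookup Λ l) named , combine∈C (lookup Λ l) named , λ c →
          trans (combine-value (lookup Λ l) named _) (cong (⟦ d _ ⟧ *_) (proj₂ (matches-sound c (h c)) l))

    children-sound : ∀ {cells} i → Config cells → ∀ {xs} → children (pick i cells) ≡ just xs →
                     ∃ λ cells′ → cells′ ∈ xs × Config cells′
    children-sound {cells} i config eq with pick i cells in eq₁
    ... | just ((t₀ , ℕ.suc c) , rest) with hasNone t₀ in eq₂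
    children-sound {cells} i config refl | just ((t₀ , ℕ.suc c) , rest) | false
      with (_ , w ∷ vs) , rest′ , picked , refl , refl ← pick-map toCell i (Config.blocks config) (trans (cong (pick i) (Config.cells≡ config)) eq₁)
      with (w≡ ∷ g) ∷ gs ← Perm.All-resp-↭ (pick-↭ i picked) (Config.good config)
      = result w≡ g
      where
      open Config config
      result : patternOf named w ≡ t₀ → All (λ v → patternOf named v ≡ t₀) vs → ∃ λ cells′ →
        cells′ ∈ map ((none ∷ t₀ , 1) ∷_) (expand t₀ ((t₀ , length vs) ∷ map toCell rest′) (map (λ _ → 0 , 0) t₀)) × Config cells′
      result refl g
        with bs , m , gbs , p ← Splitting.named-splits named w diag off skew
          (λ w′ w≢w′ → ℕ.≤-trans (ℕ.≤-reflexive (Σᴸ-allFin (λ u → agree (S w u) (S w′ u)))) (proj₁ (balanced w w′ w≢w′))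
                     , ℕ.≤-trans (ℕ.≤-reflexive (Σᴸ-allFin (λ u → disagree (S w u) (S w′ u)))) (proj₂ (balanced w w′ w≢w′)))
          vs rest′ eq₂ (g ∷ gs) (↭-trans (↭-sym (vertices-↭ {blocks} (pick-↭ i picked))) cover)
        = _ , Membership.∈-map⁺ _ m , record
          { named  = w ∷ named
          ; blocks = (none ∷ patternOf named w , [ w ]) ∷ bs
          ; cells≡ = refl
          ; good   = (cong (_∷ patternOf named w) (diag w) ∷ []) ∷ gbs
          ; cover  = p }

    -- A light word contradicts the minimum weight, and a split without children contradicts the
    -- existence of the configuration; every surviving branch therefore ends in a leaf, which yields
    -- the labelling.
    run-sound : ∀ cert {cells} → Config cells → run G cert cells ≡ true → Labelling
    runAll-sound : ∀ certs {xs} → runAll G certs xs ≡ true → ∀ {cells} → cells ∈ xs → Config cells → Labelling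

    run-sound (light ls) config eq = contradiction eq (¬light config ls)
    run-sound (leaf Λ pos) {cells} config eq =
      leaf-sound config Λ pos (does-sound (Fin.all? λ c → matches G Λ pos cells c Bool.≟ true) eq)
    run-sound (split i certs) {cells} config eq with children (pick i cells) in eq′
    ... | just xs with cells′ , m , config′ ← children-sound i config eq′ = runAll-sound certs eq m config′

    runAll-sound (cert ∷ certs) eq (here refl) config = run-sound cert config (proj₁ (∧-true eq))
    runAll-sound (cert ∷ certs) {x ∷ _} eq (there m) config = runAll-sound certs (proj₂ (∧-true {run G cert x} eq)) m config

-- Integer vectors of norm 28 with odd entries.

module OddVectors where
  open import Data.Integer.Base using (+_; -[1+_]; _%ℕ_; _/ℕ_; _◃_)
  import Data.Integer.DivMod as ℤ
  open import Data.Integer.Divisibility as ℤ using (_∣_)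
  import Data.Nat.Divisibility as ℕ
  import Data.Nat.Tactic.RingSolver as ℕSolver
  import Data.Sign.Properties as Sign
  import Data.Integer.Divisibility.Signed as ℤD
  open import Data.Vec.Functional using (Vector)
  open import Relation.Binary.PropositionalEquality
  open import Relation.Nullary.Decidable using (from-no)
  import Algebra.Properties.CommutativeMonoid.Sum ℕ.+-0-commutativeMonoid as ℕΣ
  open import Algebra.Properties.Semiring.Sum ℤ.+-*-semiring using (sum; sum-cong-≗; ∑-distrib-+; *-distribˡ-sum)
  import Algebra.Properties.Semiring.Sum ℕ.+-*-semiring as ℕΣS
  module ℤM = MatrixAlgebra ℤ.+-*-commutativeRing

  sum-+ : ∀ {n} (f : Fin n → ℕ) → + ℕΣ.sum f ≡ sum (λ i → + f i)
  sum-+ {ℕ.zero}  f = refl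
  sum-+ {ℕ.suc n} f = trans (ℤ.pos-+ (f zero) _) (cong (λ z → + f zero ℤ.+ z) (sum-+ (f ∘ suc)))

  sum-const : ∀ n c → sum {n} (λ _ → c) ≡ + n ℤ.* c
  sum-const ℕ.zero    c = refl
  sum-const (ℕ.suc n) c = trans (cong (λ z → c ℤ.+ z) (sum-const n c)) (sym (trans (cong (ℤ._* c) (ℤ.pos-+ 1 n)) (identity c (+ n))))
    where
    identity : ∀ c n → (+ 1 ℤ.+ n) ℤ.* c ≡ c ℤ.+ n ℤ.* c
    identity = solve-∀

  unit-sum : ∀ {n} (f : Fin n → ℕ) → ℕΣ.sum f ≡ 1 → ∃ λ i → f i ≡ 1 × ∀ j → j ≢ i → f j ≡ 0
  unit-sum {ℕ.suc n} f eq with f zero in f₀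
  ... | 0 with i , fi , h ← unit-sum (f ∘ suc) eq =
    suc i , fi , λ { zero _ → f₀ ; (suc j) j≢i → h j (j≢i ∘ cong suc) }
  ... | 1 = zero , f₀ , λ { zero j≢i → contradiction refl j≢i ; (suc j) _ → all-zero (f ∘ suc) (ℕ.suc-injective eq) j }
    where
    all-zero : ∀ {n} (f : Fin n → ℕ) → ℕΣ.sum f ≡ 0 → ∀ j → f j ≡ 0
    all-zero f eq zero    = ℕ.m+n≡0⇒m≡0 (f zero) eq
    all-zero f eq (suc j) = all-zero (f ∘ suc) (ℕ.m+n≡0⇒n≡0 (f zero) eq) j

  abstract
    even⊎odd : ∀ c → ∃ λ q → (c ≡ + 2 ℤ.* q) ⊎ (c ≡ + 1 ℤ.+ + 2 ℤ.* q)
    even⊎odd c with c %ℕ 2 | ℤ.n%ℕd<d c 2 | ℤ.a≡a%ℕn+[a/ℕn]*n c 2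
    ... | 0 | _ | eq = c /ℕ 2 , inj₁ (trans eq (trans (ℤ.+-identityˡ _) (ℤ.*-comm (c /ℕ 2) (+ 2))))
    ... | 1 | _ | eq = c /ℕ 2 , inj₂ (trans eq (cong (λ z → + 1 ℤ.+ z) (ℤ.*-comm (c /ℕ 2) (+ 2))))
    ... | ℕ.suc (ℕ.suc _) | s≤s (s≤s ()) | _

  -- The difference b² - b is a product of two consecutive integers.
  triangle : ∀ b → ∃ λ q → b ℤ.* b ≡ b ℤ.+ + 2 ℤ.* q
  triangle b with even⊎odd b
  ... | q , inj₁ refl = q ℤ.* (+ 2 ℤ.* q ℤ.- + 1) , identity q
    where
    identity : ∀ q → (+ 2 ℤ.* q) ℤ.* (+ 2 ℤ.* q) ≡ + 2 ℤ.* q ℤ.+ + 2 ℤ.* (q ℤ.* (+ 2 ℤ.* q ℤ.- + 1))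
    identity = solve-∀
  ... | q , inj₂ refl = q ℤ.* (+ 1 ℤ.+ + 2 ℤ.* q) , identity q
    where
    identity : ∀ q → (+ 1 ℤ.+ + 2 ℤ.* q) ℤ.* (+ 1 ℤ.+ + 2 ℤ.* q) ≡
               (+ 1 ℤ.+ + 2 ℤ.* q) ℤ.+ + 2 ℤ.* (q ℤ.* (+ 1 ℤ.+ + 2 ℤ.* q))
    identity = solve-∀

  ∣2⇒half : ∀ {z} → + 2 ℤ.∣ z → ∃ λ e → z ≡ + 2 ℤ.* e
  ∣2⇒half {z} (ℕ.divides q eq) with even⊎odd z
  ... | e , inj₁ z≡ = e , z≡
  ... | e , inj₂ z≡ = contradiction (∣odd z (ℕ.divides q eq) e z≡) (from-no (2 ℕ.∣? 1))
    where
    identity : ∀ z e → z ≡ + 1 ℤ.+ + 2 ℤ.* e → + 1 ≡ z ℤ.- + 2 ℤ.* e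
    identity z e refl = lemma e
      where
      lemma : ∀ e → + 1 ≡ (+ 1 ℤ.+ + 2 ℤ.* e) ℤ.- + 2 ℤ.* e
      lemma = solve-∀
    ∣odd : ∀ z → 2 ℕ.∣ ℤ.∣ z ∣ → ∀ e → z ≡ + 1 ℤ.+ + 2 ℤ.* e → 2 ℕ.∣ 1
    ∣odd z 2∣z e z≡ = ℤD.∣⇒∣ᵤ {+ 2} {+ 1} (subst (ℤD._∣_ (+ 2)) (sym (identity z e z≡))
      (ℤD.∣m∣n⇒∣m-n {+ 2} {z} (ℤD.∣ᵤ⇒∣ 2∣z) (ℤD.divides e (ℤ.*-comm (+ 2) e))))

  -- Since b² ≡ b (mod 2) and Σ b is even, Σ (c + 2b)² = 28 gives 5c² ≡ 7 (mod 2).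
  abstract
    odd-shift : ∀ {n} (c : ℤ) (b : Vector ℤ n) e → sum b ≡ + 2 ℤ.* e → n ≡ 20 →
                sum (λ j → (c ℤ.+ + 2 ℤ.* b j) ℤ.* (c ℤ.+ + 2 ℤ.* b j)) ≡ + 28 →
                ∃ λ m → c ≡ + 1 ℤ.+ + 2 ℤ.* m
    odd-shift {n} c b e Σb n≡20 norm with even⊎odd c
    ... | m , inj₂ c≡ = m , c≡
    ... | m , inj₁ c≡ = contradiction (seven-even total) (from-no (2 ℕ.∣? 7))
      where
      q : Vector ℤ n
      q j = proj₁ (triangle (b j))
      expansion : ∀ j → (c ℤ.+ + 2 ℤ.* b j) ℤ.* (c ℤ.+ + 2 ℤ.* b j) ≡ c ℤ.* c ℤ.+ ((+ 4 ℤ.* c ℤ.+ + 4) ℤ.* b j ℤ.+ + 8 ℤ.* q j)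
      expansion j = trans (identity₁ c (b j)) (trans (cong (λ z → c ℤ.* c ℤ.+ (+ 4 ℤ.* c ℤ.* b j ℤ.+ + 4 ℤ.* z)) (proj₂ (triangle (b j))))
        (identity₂ c (b j) (q j)))
        where
        identity₁ : ∀ c b → (c ℤ.+ + 2 ℤ.* b) ℤ.* (c ℤ.+ + 2 ℤ.* b) ≡ c ℤ.* c ℤ.+ (+ 4 ℤ.* c ℤ.* b ℤ.+ + 4 ℤ.* (b ℤ.* b))
        identity₁ = solve-∀
        identity₂ : ∀ c b q → c ℤ.* c ℤ.+ (+ 4 ℤ.* c ℤ.* b ℤ.+ + 4 ℤ.* (b ℤ.+ + 2 ℤ.* q)) ≡
                    c ℤ.* c ℤ.+ ((+ 4 ℤ.* c ℤ.+ + 4) ℤ.* b ℤ.+ + 8 ℤ.* q)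
        identity₂ = solve-∀
      total : + 28 ≡ + 20 ℤ.* (c ℤ.* c) ℤ.+ ((+ 4 ℤ.* c ℤ.+ + 4) ℤ.* (+ 2 ℤ.* e) ℤ.+ + 8 ℤ.* sum q)
      total = begin
        + 28
          ≡⟨ norm ⟨
        sum (λ j → (c ℤ.+ + 2 ℤ.* b j) ℤ.* (c ℤ.+ + 2 ℤ.* b j))
          ≡⟨ sum-cong-≗ expansion ⟩
        sum (λ j → c ℤ.* c ℤ.+ ((+ 4 ℤ.* c ℤ.+ + 4) ℤ.* b j ℤ.+ + 8 ℤ.* q j))
          ≡⟨ ∑-distrib-+ (λ _ → c ℤ.* c) (λ j → (+ 4 ℤ.* c ℤ.+ + 4) ℤ.* b j ℤ.+ + 8 ℤ.* q j) ⟩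
        sum {n} (λ _ → c ℤ.* c) ℤ.+ sum (λ j → (+ 4 ℤ.* c ℤ.+ + 4) ℤ.* b j ℤ.+ + 8 ℤ.* q j)
          ≡⟨ cong₂ ℤ._+_ (trans (sum-const n (c ℤ.* c)) (cong (λ n → + n ℤ.* (c ℤ.* c)) n≡20))
               (∑-distrib-+ (λ j → (+ 4 ℤ.* c ℤ.+ + 4) ℤ.* b j) (λ j → + 8 ℤ.* q j)) ⟩
        + 20 ℤ.* (c ℤ.* c) ℤ.+ (sum (λ j → (+ 4 ℤ.* c ℤ.+ + 4) ℤ.* b j) ℤ.+ sum (λ j → + 8 ℤ.* q j))
          ≡⟨ cong (λ z → + 20 ℤ.* (c ℤ.* c) ℤ.+ z) (cong₂ ℤ._+_
               (trans (sym (*-distribˡ-sum (+ 4 ℤ.* c ℤ.+ + 4) b)) (cong (λ z → (+ 4 ℤ.* c ℤ.+ + 4) ℤ.* z) Σb))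
               (sym (*-distribˡ-sum (+ 8) q))) ⟩
        + 20 ℤ.* (c ℤ.* c) ℤ.+ ((+ 4 ℤ.* c ℤ.+ + 4) ℤ.* (+ 2 ℤ.* e) ℤ.+ + 8 ℤ.* sum q) ∎
        where open ≡-Reasoning
      seven-even : + 28 ≡ + 20 ℤ.* (c ℤ.* c) ℤ.+ ((+ 4 ℤ.* c ℤ.+ + 4) ℤ.* (+ 2 ℤ.* e) ℤ.+ + 8 ℤ.* sum q) → 2 ℕ.∣ 7
      seven-even h = ℤD.∣⇒∣ᵤ {+ 2} {+ 7} (ℤD.divides half (ℤ.*-cancelˡ-≡ (+ 4) (+ 7) (half ℤ.* + 2)
        (trans h (trans (cong (λ c → + 20 ℤ.* (c ℤ.* c) ℤ.+ ((+ 4 ℤ.* c ℤ.+ + 4) ℤ.* (+ 2 ℤ.* e) ℤ.+ + 8 ℤ.* sum q)) c≡) (identity m e (sum q))))))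
        where
        half : ℤ
        half = + 10 ℤ.* m ℤ.* m ℤ.+ (+ 2 ℤ.* m ℤ.+ + 1) ℤ.* e ℤ.+ sum q
        identity : ∀ m e t → + 20 ℤ.* ((+ 2 ℤ.* m) ℤ.* (+ 2 ℤ.* m)) ℤ.+ ((+ 4 ℤ.* (+ 2 ℤ.* m) ℤ.+ + 4) ℤ.* (+ 2 ℤ.* e) ℤ.+ + 8 ℤ.* t) ≡
                   + 4 ℤ.* ((+ 10 ℤ.* m ℤ.* m ℤ.+ (+ 2 ℤ.* m ℤ.+ + 1) ℤ.* e ℤ.+ t) ℤ.* + 2)
        identity = solve-∀

  tri : ℕ → ℕ
  tri 0         = 0
  tri (ℕ.suc k) = ℕ.suc k ℕ.+ tri k

  tri≡0 : ∀ k → tri k ≡ 0 → k ≡ 0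
  tri≡0 0 _ = refl

  tri≡1 : ∀ k → tri k ≡ 1 → k ≡ 1
  tri≡1 1 _ = refl
  tri≡1 (ℕ.suc (ℕ.suc k)) ()

  odd² : ∀ k → (1 ℕ.+ 2 ℕ.* k) ℕ.* (1 ℕ.+ 2 ℕ.* k) ≡ 1 ℕ.+ 8 ℕ.* tri k
  odd² 0         = refl
  odd² (ℕ.suc k) = trans (identity₁ k) (trans (cong (ℕ._+ 8 ℕ.* ℕ.suc k) (odd² k)) (identity₂ k (tri k)))
    where
    identity₁ : ∀ k → (1 ℕ.+ 2 ℕ.* (1 ℕ.+ k)) ℕ.* (1 ℕ.+ 2 ℕ.* (1 ℕ.+ k)) ≡ (1 ℕ.+ 2 ℕ.* k) ℕ.* (1 ℕ.+ 2 ℕ.* k) ℕ.+ 8 ℕ.* (1 ℕ.+ k)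
    identity₁ = ℕSolver.solve-∀
    identity₂ : ∀ k t → 1 ℕ.+ 8 ℕ.* t ℕ.+ 8 ℕ.* (1 ℕ.+ k) ≡ 1 ℕ.+ 8 ℕ.* (1 ℕ.+ k ℕ.+ t)
    identity₂ = ℕSolver.solve-∀

  -- Splitting an odd integer into a sign and an index k makes its size readable: k = 0 is ±1 and k
  -- = 1 is ±3.
  odd : Sign → ℕ → ℤ
  odd s k = s ◃ (1 ℕ.+ 2 ℕ.* k)

  abstract
    odd-form : ∀ h → ∃ λ s → ∃ λ k → + 1 ℤ.+ + 2 ℤ.* h ≡ odd s k
    odd-form (+ k)    = Sign.+ , k , trans (cong (λ z → + 1 ℤ.+ z) (sym (ℤ.pos-* 2 k))) (sym (ℤ.pos-+ 1 (2 ℕ.* k)))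
    odd-form -[1+ k ] = Sign.- , k , trans (cong (λ z → + 1 ℤ.+ + 2 ℤ.* z) (identity₁ k))
      (trans (identity₂ (+ k)) (cong ℤ.-_ (trans (cong (λ z → + 1 ℤ.+ z) (sym (ℤ.pos-* 2 k))) (sym (ℤ.pos-+ 1 (2 ℕ.* k))))))
      where
      identity₁ : ∀ k → -[1+ k ] ≡ ℤ.- (+ 1 ℤ.+ + k)
      identity₁ k = cong ℤ.-_ (ℤ.pos-+ 1 k)
      identity₂ : ∀ k → + 1 ℤ.+ + 2 ℤ.* (ℤ.- (+ 1 ℤ.+ k)) ≡ ℤ.- (+ 1 ℤ.+ + 2 ℤ.* k)
      identity₂ = solve-∀

  odd-* : ∀ s t k → odd (s Sign.* t) k ≡ (s ◃ 1) ℤ.* odd t k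
  odd-* s t k = trans (cong (s Sign.* t ◃_) (sym (ℕ.*-identityˡ (1 ℕ.+ 2 ℕ.* k)))) (ℤ.◃-distrib-* s t 1 (1 ℕ.+ 2 ℕ.* k))

  odd-square : ∀ s k → odd s k ℤ.* odd s k ≡ + (1 ℕ.+ 8 ℕ.* tri k)
  odd-square s k = trans (sym (ℤ.◃-distrib-* s s (1 ℕ.+ 2 ℕ.* k) (1 ℕ.+ 2 ℕ.* k)))
    (trans (cong (_◃ ((1 ℕ.+ 2 ℕ.* k) ℕ.* (1 ℕ.+ 2 ℕ.* k))) (Sign.s*s≡+ s)) (trans (ℤ.+◃n≡+n _) (cong +_ (odd² k))))

  -- As (1 + 2k)² = 1 + 8 tri k, the excess 28 − 20 leaves one triangular number 1.
  abstract
    single-three : ∀ {n} → n ≡ 20 → (s : Fin n → Sign) (k : Fin n → ℕ) →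
                   sum (λ i → odd (s i) (k i) ℤ.* odd (s i) (k i)) ≡ + 28 →
                   ∃ λ i → k i ≡ 1 × ∀ j → j ≢ i → k j ≡ 0
    single-three {n} n≡20 s k norm = conclude (unit-sum (tri ∘ k) Σtri)
      where
      conclude : (∃ λ i → tri (k i) ≡ 1 × ∀ j → j ≢ i → tri (k j) ≡ 0) → ∃ λ i → k i ≡ 1 × ∀ j → j ≢ i → k j ≡ 0
      conclude (i , ti , h) = i , tri≡1 (k i) ti , λ j j≢i → tri≡0 (k j) (h j j≢i)
      squares : + 28 ≡ + (20 ℕ.+ 8 ℕ.* ℕΣ.sum (tri ∘ k))
      squares = begin
        + 28                                            ≡⟨ norm ⟨
        sum (λ i → odd (s i) (k i) ℤ.* odd (s i) (k i)) ≡⟨ sum-cong-≗ (λ i → odd-square (s i) (k i)) ⟩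
        sum (λ i → + (1 ℕ.+ 8 ℕ.* tri (k i)))           ≡⟨ sum-+ (λ i → 1 ℕ.+ 8 ℕ.* tri (k i)) ⟨
        + ℕΣ.sum (λ i → 1 ℕ.+ 8 ℕ.* tri (k i))          ≡⟨ cong +_ (ℕΣ.∑-distrib-+ (λ _ → 1) (λ i → 8 ℕ.* tri (k i))) ⟩
        + (ℕΣ.sum {n} (λ _ → 1) ℕ.+ ℕΣ.sum (λ i → 8 ℕ.* tri (k i)))
          ≡⟨ cong₂ (λ a b → + (a ℕ.+ b)) (trans (ones n) n≡20) (sym (ℕΣS.*-distribˡ-sum 8 (tri ∘ k))) ⟩
        + (20 ℕ.+ 8 ℕ.* ℕΣ.sum (tri ∘ k))               ∎
        where
        open ≡-Reasoning
        ones : ∀ n → ℕΣ.sum {n} (λ _ → 1) ≡ n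
        ones ℕ.zero    = refl
        ones (ℕ.suc n) = cong ℕ.suc (ones n)
      Σtri : ℕΣ.sum (tri ∘ k) ≡ 1
      Σtri = sym (ℕ.*-cancelˡ-≡ 1 _ 8 (ℕ.+-cancelˡ-≡ 20 8 _ (ℤ.+-injective squares)))

-- From a frame to a balanced skew matrix.

module FrameMatrices where
  open import Data.Integer.Base using (+_; _◃_)
  import Data.Sign.Properties as Sign
  open import Relation.Binary.PropositionalEquality
  import Algebra.Properties.CommutativeMonoid.Sum ℕ.+-0-commutativeMonoid as ℕΣ
  open import Algebra.Properties.Semiring.Sum ℤ.+-*-semiring using (sum; sum-cong-≗; ∑-distrib-+; *-distribˡ-sum)
  open WordWeights
  open Checker
  open OddVectors
  ℤ-rawRing : RawRing _ _
  ℤ-rawRing = CommutativeRing.rawRing ℤ.+-*-commutativeRing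

  open LinearAlgebra ℤ-rawRing using () renaming (𝐈 to 𝐈ᶻ)

  valueℤ : Entry → ℤ
  valueℤ none  = + 3
  valueℤ plus  = ℤ.- + 1
  valueℤ minus = + 1

  reduce-value : ∀ e → reduce 7 (valueℤ e) ≡ value e
  reduce-value none  = refl
  reduce-value plus  = refl
  reduce-value minus = refl

  act : Sign → Entry → Entry
  act Sign.+ e = e
  act Sign.- e = opposite e

  sum-𝐈ᶻ : ∀ {n} (j : Fin n) (f : Fin n → ℤ) → sum (λ i → f i ℤ.* 𝐈ᶻ i j) ≡ f j
  sum-𝐈ᶻ j f = ℤM.∙-𝐈 f j

  module FromFrame {n : ℕ} (n≡20 : n ≡ 20)
    (C : Codes.Code 7 n) (subspace : LinearAlgebra.IsSubspace (GF 7) C)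
    (heavy : ∀ {x} → C x → ¬ LinearAlgebra._≋_ (GF 7) x (LinearAlgebra.𝟎 (GF 7)) → 9 ≤ Codes.weight 7 x)
    (F : Fin n → Fin n → ℤ)
    (F-odd : ∀ i j → ∃ λ h → F i j ≡ + 1 ℤ.+ + 2 ℤ.* h)
    (rows : ∀ i → sum (λ j → F i j ℤ.* F i j) ≡ + 28)
    (columns : ∀ j k → sum (λ i → F i j ℤ.* F i k) ≡ + 28 ℤ.* 𝐈ᶻ j k)
    (column∈C : ∀ j → C (λ i → reduce 7 (F i j)))
    where

    s : Fin n → Fin n → Sign
    s i j = proj₁ (odd-form (proj₁ (F-odd i j)))

    K : Fin n → Fin n → ℕ
    K i j = proj₁ (proj₂ (odd-form (proj₁ (F-odd i j))))

    F≡ : ∀ i j → F i j ≡ odd (s i j) (K i j)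
    F≡ i j = trans (proj₂ (F-odd i j)) (proj₂ (proj₂ (odd-form (proj₁ (F-odd i j)))))

    row-three : ∀ i → ∃ λ j → K i j ≡ 1 × ∀ k → k ≢ j → K i k ≡ 0
    row-three i = single-three n≡20 (s i) (K i)
      (trans (sum-cong-≗ (λ j → cong₂ ℤ._*_ (sym (F≡ i j)) (sym (F≡ i j)))) (rows i))

    column-three : ∀ j → ∃ λ i → K i j ≡ 1 × ∀ k → k ≢ i → K k j ≡ 0
    column-three j = single-three n≡20 (λ i → s i j) (λ i → K i j)
      (trans (sum-cong-≗ (λ i → cong₂ ℤ._*_ (sym (F≡ i j)) (sym (F≡ i j))))
        (trans (columns j j) (cong (λ z → + 28 ℤ.* z) (ℤM.𝐈-refl j))))

    π : Fin n → Fin n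
    π i = proj₁ (row-three i)

    K-diag : ∀ i → K i (π i) ≡ 1
    K-diag i = proj₁ (proj₂ (row-three i))

    -- The columns of F have norm 28 as well, so a column contains only one entry ±3 and cannot
    -- serve two rows.
    π-injective : ∀ {i j} → π i ≡ π j → i ≡ j
    π-injective {i} {j} eq = trans (unique i refl) (sym (unique j eq))
      where
      unique : ∀ k → π i ≡ π k → k ≡ proj₁ (column-three (π i))
      unique k eq = go (k Fin.≟ _)
        where
        go : Dec (k ≡ proj₁ (column-three (π i))) → k ≡ proj₁ (column-three (π i))
        go (yes k≡) = k≡
        go (no k≢)  = contradiction
          (trans (sym (K-diag k)) (trans (cong (K k) (sym eq)) (proj₂ (proj₂ (column-three (π i))) k k≢))) λ ()

    K-off : ∀ {i j} → i ≢ j → K i (π j) ≡ 0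
    K-off {i} {j} i≢j = proj₂ (proj₂ (row-three i)) (π j) (λ eq → i≢j (sym (π-injective eq)))

    σ : Fin n → Sign
    σ j = s j (π j)

    -- Each entry ±3 is moved to the diagonal and made positive. Only columns are permuted and
    -- negated: columns are the codewords, so the coordinates i of C stay in place.
    T : Fin n → Fin n → ℤ
    T i j = (σ j ◃ 1) ℤ.* F i (π j)

    -- Off the diagonal S is −Tᵀ: row j of S encodes the codeword in column j of T.
    entry : Sign → Entry
    entry Sign.+ = minus
    entry Sign.- = plus

    S-dec : ∀ j i → Dec (i ≡ j) → Entry
    S-dec j i (yes _) = none
    S-dec j i (no _)  = entry (σ j Sign.* s i (π j))

    S : Fin n → Fin n → Entry
    S j i = S-dec j i (i Fin.≟ j)

    T≡odd : ∀ i j → T i j ≡ odd (σ j Sign.* s i (π j)) (K i (π j))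
    T≡odd i j = trans (cong (λ z → (σ j ◃ 1) ℤ.* z) (F≡ i (π j))) (sym (odd-* (σ j) (s i (π j)) (K i (π j))))

    entry-value : ∀ t → odd t 0 ≡ valueℤ (entry t)
    entry-value Sign.+ = refl
    entry-value Sign.- = refl

    T≡S : ∀ i j → T i j ≡ valueℤ (S j i)
    T≡S i j = go (i Fin.≟ j)
      where
      go : (d : Dec (i ≡ j)) → T i j ≡ valueℤ (S-dec j i d)
      go (yes refl) = trans (T≡odd i i) (cong₂ odd (Sign.s*s≡+ (σ i)) (K-diag i))
      go (no i≢j)   = trans (T≡odd i j) (trans (cong (odd (σ j Sign.* s i (π j))) (K-off i≢j)) (entry-value _))

    S-diag : ∀ i → S i i ≡ none
    S-diag i = go (i Fin.≟ i)
      where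
      go : (d : Dec (i ≡ i)) → S-dec i i d ≡ none
      go (yes _)  = refl
      go (no i≢i) = contradiction refl i≢i

    S-off : ∀ {j i} → S j i ≡ none → j ≡ i
    S-off {j} {i} eq = go (i Fin.≟ j) eq
      where
      entry≢none : ∀ t → entry t ≢ none
      entry≢none Sign.+ ()
      entry≢none Sign.- ()
      go : (d : Dec (i ≡ j)) → S-dec j i d ≡ none → j ≡ i
      go (yes i≡j) _  = sym i≡j
      go (no _)    eq = contradiction eq (entry≢none _)

    word∈C : ∀ j → C (λ i → value (S j i))
    word∈C j = LinearAlgebra.IsSubspace.resp subspace
      (λ i → trans (sym (Reduction.reduce-* 7 (σ j ◃ 1) (F i (π j)))) (trans (cong (reduce 7) (T≡S i j)) (reduce-value (S j i))))
      (LinearAlgebra.IsSubspace.scal subspace (reduce 7 (σ j ◃ 1)) (column∈C (π j)))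

    orthogonal : ∀ {j k} → j ≢ k → sum (λ i → valueℤ (S j i) ℤ.* valueℤ (S k i)) ≡ 0ℤ
    orthogonal {j} {k} j≢k = begin
      sum (λ i → valueℤ (S j i) ℤ.* valueℤ (S k i))
        ≡⟨ sum-cong-≗ (λ i → trans (cong₂ ℤ._*_ (sym (T≡S i j)) (sym (T≡S i k)))
             (identity (σ j ◃ 1) (σ k ◃ 1) (F i (π j)) (F i (π k)))) ⟩
      sum (λ i → ((σ j ◃ 1) ℤ.* (σ k ◃ 1)) ℤ.* (F i (π j) ℤ.* F i (π k)))
        ≡⟨ *-distribˡ-sum ((σ j ◃ 1) ℤ.* (σ k ◃ 1)) (λ i → F i (π j) ℤ.* F i (π k)) ⟨
      ((σ j ◃ 1) ℤ.* (σ k ◃ 1)) ℤ.* sum (λ i → F i (π j) ℤ.* F i (π k))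
        ≡⟨ cong (λ z → ((σ j ◃ 1) ℤ.* (σ k ◃ 1)) ℤ.* z) (trans (columns (π j) (π k))
             (cong (λ z → + 28 ℤ.* z) (ℤM.𝐈-off (j≢k ∘ π-injective)))) ⟩
      ((σ j ◃ 1) ℤ.* (σ k ◃ 1)) ℤ.* 0ℤ
        ≡⟨ ℤ.*-zeroʳ ((σ j ◃ 1) ℤ.* (σ k ◃ 1)) ⟩
      0ℤ ∎
      where
      open ≡-Reasoning
      identity : ∀ a b x y → (a ℤ.* x) ℤ.* (b ℤ.* y) ≡ (a ℤ.* b) ℤ.* (x ℤ.* y)
      identity = solve-∀

    open LinearAlgebra (GF 7) using (_⊕_; _⊛_)
    open RawRing (GF 7) using () renaming (_+_ to _+₇_; _*_ to _*₇_)

    -- 2 Σ f is compared with Σ (1 + c T_ij T_ik) = 20; the positions j and k,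
    -- where T has the entry 3, need the corrections a and b.
    count : ∀ {j k} → j ≢ k → (f : Fin n → ℕ) (a b c : ℤ) →
            (∀ i → + 2 ℤ.* + f i ℤ.+ (a ℤ.* 𝐈ᶻ i j ℤ.+ b ℤ.* 𝐈ᶻ i k) ≡ + 1 ℤ.+ c ℤ.* (valueℤ (S j i) ℤ.* valueℤ (S k i))) →
            + 2 ℤ.* + ℕΣ.sum f ℤ.+ (a ℤ.+ b) ≡ + 20
    count {j} {k} j≢k f a b c h = begin
      + 2 ℤ.* + ℕΣ.sum f ℤ.+ (a ℤ.+ b)
        ≡⟨ cong₂ (λ x y → + 2 ℤ.* x ℤ.+ y) (sum-+ f) (cong₂ ℤ._+_ (sym (sum-𝐈ᶻ j (λ _ → a))) (sym (sum-𝐈ᶻ k (λ _ → b)))) ⟩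
      + 2 ℤ.* sum (λ i → + f i) ℤ.+ (sum (λ i → a ℤ.* 𝐈ᶻ i j) ℤ.+ sum (λ i → b ℤ.* 𝐈ᶻ i k))
        ≡⟨ cong₂ ℤ._+_ (*-distribˡ-sum (+ 2) (λ i → + f i)) (sym (∑-distrib-+ (λ i → a ℤ.* 𝐈ᶻ i j) (λ i → b ℤ.* 𝐈ᶻ i k))) ⟩
      sum (λ i → + 2 ℤ.* + f i) ℤ.+ sum (λ i → a ℤ.* 𝐈ᶻ i j ℤ.+ b ℤ.* 𝐈ᶻ i k)
        ≡⟨ ∑-distrib-+ (λ i → + 2 ℤ.* + f i) (λ i → a ℤ.* 𝐈ᶻ i j ℤ.+ b ℤ.* 𝐈ᶻ i k) ⟨
      sum (λ i → + 2 ℤ.* + f i ℤ.+ (a ℤ.* 𝐈ᶻ i j ℤ.+ b ℤ.* 𝐈ᶻ i k))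
        ≡⟨ sum-cong-≗ h ⟩
      sum (λ i → + 1 ℤ.+ c ℤ.* (valueℤ (S j i) ℤ.* valueℤ (S k i)))
        ≡⟨ ∑-distrib-+ (λ _ → + 1) (λ i → c ℤ.* (valueℤ (S j i) ℤ.* valueℤ (S k i))) ⟩
      sum {n} (λ _ → + 1) ℤ.+ sum (λ i → c ℤ.* (valueℤ (S j i) ℤ.* valueℤ (S k i)))
        ≡⟨ cong₂ ℤ._+_ (trans (sum-const n (+ 1)) (trans (ℤ.*-identityʳ (+ n)) (cong +_ n≡20)))
             (trans (sym (*-distribˡ-sum c (λ i → valueℤ (S j i) ℤ.* valueℤ (S k i))))
               (trans (cong (λ z → c ℤ.* z) (orthogonal j≢k)) (ℤ.*-zeroʳ c))) ⟩
      + 20 ∎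
      where open ≡-Reasoning

    solve-count : ∀ {k} m a → + 2 ℤ.* + m ℤ.+ a ≡ + 20 → a ≡ + 20 ℤ.- + 2 ℤ.* + k → m ≡ k
    solve-count {k} m a eq refl = ℤ.+-injective (ℤ.*-cancelˡ-≡ (+ 2) (+ m) (+ k) (ℤ.i-j≡0⇒i≡j _ _
      (trans (identity (+ m) (+ k)) (trans (cong (ℤ._- + 20) eq) refl))))
      where
      identity : ∀ m k → + 2 ℤ.* m ℤ.- + 2 ℤ.* k ≡ (+ 2 ℤ.* m ℤ.+ (+ 20 ℤ.- + 2 ℤ.* k)) ℤ.- + 20
      identity = solve-∀

    pointwise : ∀ {j k} → j ≢ k → (f : Fin n → ℕ) (a b c : ℤ) →
      (+ 2 ℤ.* + f j ℤ.+ a ≡ + 1 ℤ.+ c ℤ.* (+ 3 ℤ.* valueℤ (S k j))) →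
      (+ 2 ℤ.* + f k ℤ.+ b ≡ + 1 ℤ.+ c ℤ.* (valueℤ (S j k) ℤ.* + 3)) →
      (∀ i → S j i ≢ none → S k i ≢ none → + 2 ℤ.* + f i ≡ + 1 ℤ.+ c ℤ.* (valueℤ (S j i) ℤ.* valueℤ (S k i))) →
      ∀ i → + 2 ℤ.* + f i ℤ.+ (a ℤ.* 𝐈ᶻ i j ℤ.+ b ℤ.* 𝐈ᶻ i k) ≡ + 1 ℤ.+ c ℤ.* (valueℤ (S j i) ℤ.* valueℤ (S k i))
    pointwise {j} {k} j≢k f a b c hj hk h i = go (i Fin.≟ j) (i Fin.≟ k)
      where
      Identity : Fin n → Set
      Identity i = + 2 ℤ.* + f i ℤ.+ (a ℤ.* 𝐈ᶻ i j ℤ.+ b ℤ.* 𝐈ᶻ i k) ≡ + 1 ℤ.+ c ℤ.* (valueℤ (S j i) ℤ.* valueℤ (S k i))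
      identityⱼ : ∀ a b → a ℤ.* + 1 ℤ.+ b ℤ.* + 0 ≡ a
      identityⱼ = solve-∀
      identityₖ : ∀ a b → a ℤ.* + 0 ℤ.+ b ℤ.* + 1 ≡ b
      identityₖ = solve-∀
      identity : ∀ a b → a ℤ.* + 0 ℤ.+ b ℤ.* + 0 ≡ + 0
      identity = solve-∀
      go : Dec (i ≡ j) → Dec (i ≡ k) → Identity i
      go (yes i≡j) _ = subst Identity (sym i≡j) (trans (cong (λ z → + 2 ℤ.* + f j ℤ.+ z)
        (trans (cong₂ (λ x y → a ℤ.* x ℤ.+ b ℤ.* y) (ℤM.𝐈-refl j) (ℤM.𝐈-off j≢k)) (identityⱼ a b)))
        (trans hj (cong (λ e → + 1 ℤ.+ c ℤ.* (valueℤ e ℤ.* valueℤ (S k j))) (sym (S-diag j)))))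
      go (no _) (yes i≡k) = subst Identity (sym i≡k) (trans (cong (λ z → + 2 ℤ.* + f k ℤ.+ z)
        (trans (cong₂ (λ x y → a ℤ.* x ℤ.+ b ℤ.* y) (ℤM.𝐈-off (j≢k ∘ sym)) (ℤM.𝐈-refl k)) (identityₖ a b)))
        (trans hk (cong (λ e → + 1 ℤ.+ c ℤ.* (valueℤ (S j k) ℤ.* valueℤ e)) (sym (S-diag k)))))
      go (no i≢j) (no i≢k) = trans (cong (λ z → + 2 ℤ.* + f i ℤ.+ z)
        (trans (cong₂ (λ x y → a ℤ.* x ℤ.+ b ℤ.* y) (ℤM.𝐈-off i≢j) (ℤM.𝐈-off i≢k)) (identity a b)))
        (trans (ℤ.+-identityʳ _) (h i (i≢j ∘ sym ∘ S-off) (i≢k ∘ sym ∘ S-off)))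

    -- If S were symmetric at (j , k), the combination W_j ± W_k would have weight 8.
    light-combination : ∀ {j k} → j ≢ k → S j k ≡ S k j → support ((λ i → value (S j i)) ⊕ (value (S j k) ⊛ (λ i → value (S k i)))) ≡ 8
    -- Write e for the common value ±1. Orthogonality says that the 18 products away from j and k
    -- add up to -6 e, so 6 of them equal e and 12 equal -e. The combination is nonzero at those 6
    -- places and at j and k, where it is 4 and 4 e; each of the corrections +2 is 1 + 3 e² less 2.
    light-combination {j} {k} j≢k eq = solve-count _ (+ 2 ℤ.+ + 2)
      (count j≢k (λ i → nz (x i)) (+ 2) (+ 2) (valueℤ e) (pointwise j≢k (λ i → nz (x i)) (+ 2) (+ 2) (valueℤ e)
        (subst₂ (λ p q → + 2 ℤ.* + nz (value p +₇ value e *₇ value q) ℤ.+ + 2 ≡ + 1 ℤ.+ valueℤ e ℤ.* (+ 3 ℤ.* valueℤ q))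
          (sym (S-diag j)) eq (at-j e e≢none))
        (subst (λ p → + 2 ℤ.* + nz (value e +₇ value e *₇ value p) ℤ.+ + 2 ≡ + 1 ℤ.+ valueℤ e ℤ.* (valueℤ e ℤ.* + 3))
          (sym (S-diag k)) (at-k e e≢none))
        (λ i → off e (S j i) (S k i) e≢none))) refl
      where
      e : Entry
      e = S j k
      e≢none : e ≢ none
      e≢none = j≢k ∘ S-off
      x : Fin n → Fin 7
      x i = value (S j i) +₇ value e *₇ value (S k i)
      at-j : ∀ e → e ≢ none → + 2 ℤ.* + nz (value none +₇ value e *₇ value e) ℤ.+ + 2 ≡ + 1 ℤ.+ valueℤ e ℤ.* (+ 3 ℤ.* valueℤ e)
      at-j none  e≢ = contradiction refl e≢
      at-j plus  _  = refl
      at-j minus _  = refl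
      at-k : ∀ e → e ≢ none → + 2 ℤ.* + nz (value e +₇ value e *₇ value none) ℤ.+ + 2 ≡ + 1 ℤ.+ valueℤ e ℤ.* (valueℤ e ℤ.* + 3)
      at-k none  e≢ = contradiction refl e≢
      at-k plus  _  = refl
      at-k minus _  = refl
      off : ∀ e a b → e ≢ none → a ≢ none → b ≢ none → + 2 ℤ.* + nz (value a +₇ value e *₇ value b) ≡ + 1 ℤ.+ valueℤ e ℤ.* (valueℤ a ℤ.* valueℤ b)
      off none  a     b     h _ _ = contradiction refl h
      off plus  none  b     _ h _ = contradiction refl h
      off minus none  b     _ h _ = contradiction refl h
      off plus  plus  none  _ _ h = contradiction refl h
      off plus  minus none  _ _ h = contradiction refl h
      off minus plus  none  _ _ h = contradiction refl h
      off minus minus none  _ _ h = contradiction refl h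
      off plus  plus  plus  _ _ _ = refl
      off plus  plus  minus _ _ _ = refl
      off plus  minus plus  _ _ _ = refl
      off plus  minus minus _ _ _ = refl
      off minus plus  plus  _ _ _ = refl
      off minus plus  minus _ _ _ = refl
      off minus minus plus  _ _ _ = refl
      off minus minus minus _ _ _ = refl

    S-asymmetric : ∀ {j k} → j ≢ k → S j k ≢ S k j
    S-asymmetric {j} {k} j≢k eq = ℕ.<⇒≱ {8} (ℕ.≤-trans
      (heavy (LinearAlgebra.IsSubspace.add subspace (word∈C j) (LinearAlgebra.IsSubspace.scal subspace (value (S j k)) (word∈C k))) nonzero)
      (ℕ.≤-reflexive (trans (weight≡support x) weight-8))) ℕ.≤-refl
      where
      x : Fin n → Fin 7
      x = (λ i → value (S j i)) ⊕ (value (S j k) ⊛ (λ i → value (S k i)))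
      weight-8 : support x ≡ 8
      weight-8 = light-combination j≢k eq
      nonzero : ¬ LinearAlgebra._≋_ (GF 7) x (LinearAlgebra.𝟎 (GF 7))
      nonzero x≋0 = contradiction (trans (sym weight-8) (trans (support-cong {x = x} x≋0) (support-𝟎 {n}))) λ ()

    -- Off the diagonal there are only two possible entries, so being different means being
    -- opposite.
    S-skew : ∀ v u → S u v ≡ opposite (S v u)
    S-skew v u = go (v Fin.≟ u)
      where
      lemma : ∀ a b → a ≢ b → a ≢ none → b ≢ none → a ≡ opposite b
      lemma none  b     _ h _ = contradiction refl h
      lemma plus  none  _ _ h = contradiction refl h
      lemma minus none  _ _ h = contradiction refl h
      lemma plus  plus  h _ _ = contradiction refl h
      lemma minus minus h _ _ = contradiction refl h
      lemma plus  minus _ _ _ = refl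
      lemma minus plus  _ _ _ = refl
      go : Dec (v ≡ u) → S u v ≡ opposite (S v u)
      go (yes refl) = trans (S-diag v) (cong opposite (sym (S-diag v)))
      go (no v≢u)   = lemma (S u v) (S v u) (S-asymmetric (v≢u ∘ sym)) (v≢u ∘ sym ∘ S-off) (v≢u ∘ S-off)

    -- By skewness the two products involving a diagonal 3 cancel, so the remaining 18 products ±1
    -- add up to 0.
    S-balanced : ∀ {w w′} → w ≢ w′ → ℕΣ.sum (λ u → agree (S w u) (S w′ u)) ≡ 9
                                    × ℕΣ.sum (λ u → disagree (S w u) (S w′ u)) ≡ 9
    S-balanced {w} {w′} w≢w′ = agreements , disagreements
      where
      v : ℤ
      v = valueℤ (S w′ w)
      f g : Fin n → ℕ
      f u = agree (S w u) (S w′ u)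
      g u = disagree (S w u) (S w′ u)
      opposite-value : ∀ e → e ≢ none → valueℤ (opposite e) ≡ ℤ.- valueℤ e
      opposite-value none  h = contradiction refl h
      opposite-value plus  _ = refl
      opposite-value minus _ = refl
      S-w-w′ : valueℤ (S w w′) ≡ ℤ.- v
      S-w-w′ = trans (cong valueℤ (S-skew w′ w)) (opposite-value (S w′ w) (w≢w′ ∘ sym ∘ S-off))
      agree-noneʳ : ∀ e → agree e none ≡ 0
      agree-noneʳ none  = refl
      agree-noneʳ plus  = refl
      agree-noneʳ minus = refl
      disagree-noneʳ : ∀ e → disagree e none ≡ 0
      disagree-noneʳ none  = refl
      disagree-noneʳ plus  = refl
      disagree-noneʳ minus = refl
      f-w : f w ≡ 0
      f-w = cong (λ e → agree e (S w′ w)) (S-diag w)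
      f-w′ : f w′ ≡ 0
      f-w′ = trans (cong (agree (S w w′)) (S-diag w′)) (agree-noneʳ (S w w′))
      g-w : g w ≡ 0
      g-w = cong (λ e → disagree e (S w′ w)) (S-diag w)
      g-w′ : g w′ ≡ 0
      g-w′ = trans (cong (disagree (S w w′)) (S-diag w′)) (disagree-noneʳ (S w w′))
      agree-off : ∀ a b → a ≢ none → b ≢ none → + 2 ℤ.* + agree a b ≡ + 1 ℤ.+ + 1 ℤ.* (valueℤ a ℤ.* valueℤ b)
      agree-off none  b     h _ = contradiction refl h
      agree-off plus  none  _ h = contradiction refl h
      agree-off minus none  _ h = contradiction refl h
      agree-off plus  plus  _ _ = refl
      agree-off plus  minus _ _ = refl
      agree-off minus plus  _ _ = refl
      agree-off minus minus _ _ = refl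
      disagree-off : ∀ a b → a ≢ none → b ≢ none → + 2 ℤ.* + disagree a b ≡ + 1 ℤ.+ ℤ.- + 1 ℤ.* (valueℤ a ℤ.* valueℤ b)
      disagree-off none  b     h _ = contradiction refl h
      disagree-off plus  none  _ h = contradiction refl h
      disagree-off minus none  _ h = contradiction refl h
      disagree-off plus  plus  _ _ = refl
      disagree-off plus  minus _ _ = refl
      disagree-off minus plus  _ _ = refl
      disagree-off minus minus _ _ = refl
      agreements : ℕΣ.sum f ≡ 9
      -- Nothing is counted at w and w′, where one plus the product is 1 + 3 v and 1 - 3 v; these
      -- corrections add up to 2 and leave 18 = 2 · 9.
      agreements = solve-count _ _ (count w≢w′ f (+ 1 ℤ.+ + 3 ℤ.* v) (+ 1 ℤ.- + 3 ℤ.* v) (+ 1)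
        (pointwise w≢w′ f (+ 1 ℤ.+ + 3 ℤ.* v) (+ 1 ℤ.- + 3 ℤ.* v) (+ 1)
          (trans (cong (λ m → + 2 ℤ.* + m ℤ.+ (+ 1 ℤ.+ + 3 ℤ.* v)) f-w) (identity₁ v))
          (trans (cong (λ m → + 2 ℤ.* + m ℤ.+ (+ 1 ℤ.- + 3 ℤ.* v)) f-w′)
            (trans (identity₂ v) (cong (λ z → + 1 ℤ.+ + 1 ℤ.* (z ℤ.* + 3)) (sym S-w-w′))))
          (λ i → agree-off (S w i) (S w′ i)))) (identity₃ v)
        where
        identity₁ : ∀ v → + 0 ℤ.+ (+ 1 ℤ.+ + 3 ℤ.* v) ≡ + 1 ℤ.+ + 1 ℤ.* (+ 3 ℤ.* v)
        identity₁ = solve-∀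
        identity₂ : ∀ v → + 0 ℤ.+ (+ 1 ℤ.- + 3 ℤ.* v) ≡ + 1 ℤ.+ + 1 ℤ.* (ℤ.- v ℤ.* + 3)
        identity₂ = solve-∀
        identity₃ : ∀ v → (+ 1 ℤ.+ + 3 ℤ.* v) ℤ.+ (+ 1 ℤ.- + 3 ℤ.* v) ≡ + 2
        identity₃ = solve-∀
      disagreements : ℕΣ.sum g ≡ 9
      disagreements = solve-count _ _ (count w≢w′ g (+ 1 ℤ.- + 3 ℤ.* v) (+ 1 ℤ.+ + 3 ℤ.* v) (ℤ.- + 1)
        (pointwise w≢w′ g (+ 1 ℤ.- + 3 ℤ.* v) (+ 1 ℤ.+ + 3 ℤ.* v) (ℤ.- + 1)
          (trans (cong (λ m → + 2 ℤ.* + m ℤ.+ (+ 1 ℤ.- + 3 ℤ.* v)) g-w) (identity₁ v))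
          (trans (cong (λ m → + 2 ℤ.* + m ℤ.+ (+ 1 ℤ.+ + 3 ℤ.* v)) g-w′)
            (trans (identity₂ v) (cong (λ z → + 1 ℤ.+ ℤ.- + 1 ℤ.* (z ℤ.* + 3)) (sym S-w-w′))))
          (λ i → disagree-off (S w i) (S w′ i)))) (identity₃ v)
        where
        identity₁ : ∀ v → + 0 ℤ.+ (+ 1 ℤ.- + 3 ℤ.* v) ≡ + 1 ℤ.+ ℤ.- + 1 ℤ.* (+ 3 ℤ.* v)
        identity₁ = solve-∀
        identity₂ : ∀ v → + 0 ℤ.+ (+ 1 ℤ.+ + 3 ℤ.* v) ≡ + 1 ℤ.+ ℤ.- + 1 ℤ.* (ℤ.- v ℤ.* + 3)
        identity₂ = solve-∀
        identity₃ : ∀ v → (+ 1 ℤ.- + 3 ℤ.* v) ℤ.+ (+ 1 ℤ.+ + 3 ℤ.* v) ≡ + 2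
        identity₃ = solve-∀

-- Normalisation of signs; from a labelling to an equivalence.

module Equivalence where
  open import Data.Fin.Permutation as Permutation using (Permutation′; permutation; _⟨$⟩ʳ_; _⟨$⟩ˡ_)
  open import Data.List.Base as List using (List; []; _∷_; [_]; tabulate)
  import Data.List.Properties as List
  open import Data.List.Relation.Unary.All as All using (All; []; _∷_)
  import Data.List.Relation.Unary.All.Properties as All
  open import Data.List.Relation.Binary.Permutation.Propositional using (↭-reflexive)
  import Data.Sign.Properties as Sign
  open import Relation.Binary.PropositionalEquality hiding ([_])
  open import Relation.Unary using (_∈_)
  import Algebra.Properties.CommutativeMonoid.Sum ℕ.+-0-commutativeMonoid as ℕΣ
  open Checker
  open CheckerSoundness
  open FrameMatrices using (act)
  open GF7 using (GF7-commutativeRing)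
  open RawRing (GF 7)
  open LinearAlgebra (GF 7) hiding (zero)
  open Codes 7

  agree-act : ∀ s a b → agree (act s a) (act s b) ≡ agree a b
  agree-act Sign.+ a     b     = refl
  agree-act Sign.- none  b     = refl
  agree-act Sign.- plus  none  = refl
  agree-act Sign.- plus  plus  = refl
  agree-act Sign.- plus  minus = refl
  agree-act Sign.- minus none  = refl
  agree-act Sign.- minus plus  = refl
  agree-act Sign.- minus minus = refl

  disagree-act : ∀ s a b → disagree (act s a) (act s b) ≡ disagree a b
  disagree-act Sign.+ a     b     = refl
  disagree-act Sign.- none  b     = refl
  disagree-act Sign.- plus  none  = refl
  disagree-act Sign.- plus  plus  = refl
  disagree-act Sign.- plus  minus = refl
  disagree-act Sign.- minus none  = refl
  disagree-act Sign.- minus plus  = refl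
  disagree-act Sign.- minus minus = refl

  agree-oppositeʳ : ∀ a b → agree a (opposite b) ≡ disagree a b
  agree-oppositeʳ none  b     = refl
  agree-oppositeʳ plus  none  = refl
  agree-oppositeʳ plus  plus  = refl
  agree-oppositeʳ plus  minus = refl
  agree-oppositeʳ minus none  = refl
  agree-oppositeʳ minus plus  = refl
  agree-oppositeʳ minus minus = refl

  disagree-oppositeʳ : ∀ a b → disagree a (opposite b) ≡ agree a b
  disagree-oppositeʳ none  b     = refl
  disagree-oppositeʳ plus  none  = refl
  disagree-oppositeʳ plus  plus  = refl
  disagree-oppositeʳ plus  minus = refl
  disagree-oppositeʳ minus none  = refl
  disagree-oppositeʳ minus plus  = refl
  disagree-oppositeʳ minus minus = refl

  act-opposite : ∀ s e → act (Sign.opposite s) e ≡ opposite (act s e)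
  act-opposite Sign.+ e     = refl
  act-opposite Sign.- none  = refl
  act-opposite Sign.- plus  = refl
  act-opposite Sign.- minus = refl

  act≡none : ∀ s e → act s e ≡ none → e ≡ none
  act≡none Sign.+ e    eq = eq
  act≡none Sign.- none eq = refl

  opposite-act : ∀ s e → opposite (act s e) ≡ act s (opposite e)
  opposite-act Sign.+ e = refl
  opposite-act Sign.- e = refl

  -- A change of sign can be absorbed into the entries ±1. The entry `none` is its own opposite
  -- while its value 3 is not, so there the two signs have to coincide.
  value-act : ∀ p q e → (e ≡ none → p ≡ q) → ⟦ p ⟧ * value e ≡ ⟦ q ⟧ * value (act (p Sign.* q) e)
  value-act Sign.+ Sign.+ e     h = refl
  value-act Sign.- Sign.- none  h = refl
  value-act Sign.- Sign.- plus  h = refl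
  value-act Sign.- Sign.- minus h = refl
  value-act Sign.+ Sign.- none  h = contradiction (h refl) λ ()
  value-act Sign.+ Sign.- plus  h = refl
  value-act Sign.+ Sign.- minus h = refl
  value-act Sign.- Sign.+ none  h = contradiction (h refl) λ ()
  value-act Sign.- Sign.+ plus  h = refl
  value-act Sign.- Sign.+ minus h = refl

  entrySign : Entry → Sign
  entrySign none  = Sign.+
  entrySign plus  = Sign.+
  entrySign minus = Sign.-

  act-entrySign : ∀ e → e ≢ none → act (entrySign e) e ≡ plus
  act-entrySign none  h = contradiction refl h
  act-entrySign plus  _ = refl
  act-entrySign minus _ = refl

  -- Conjugating S by the signs of its first row makes that row positive.
  module Normalise {m : ℕ} (S : Fin (ℕ.suc m) → Fin (ℕ.suc m) → Entry)
    (diag : ∀ v → S v v ≡ none) (off : ∀ {v u} → S v u ≡ none → v ≡ u)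
    (skew : ∀ v u → S u v ≡ opposite (S v u))
    (balanced : ∀ {w w′} → w ≢ w′ → ℕΣ.sum (λ u → agree (S w u) (S w′ u)) ≡ 9
                                  × ℕΣ.sum (λ u → disagree (S w u) (S w′ u)) ≡ 9)
    (C : Code (ℕ.suc m)) (subspace : IsSubspace C)
    (word∈C : ∀ w → C (λ v → value (S w v)))
    where

    δ : Fin (ℕ.suc m) → Sign
    δ v = entrySign (S zero v)

    S′ : Fin (ℕ.suc m) → Fin (ℕ.suc m) → Entry
    S′ v u = act (δ v Sign.* δ u) (S v u)

    diag′ : ∀ v → S′ v v ≡ none
    diag′ v = trans (cong (act (δ v Sign.* δ v)) (diag v)) (act-none (δ v Sign.* δ v))
      where
      act-none : ∀ s → act s none ≡ none
      act-none Sign.+ = refl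
      act-none Sign.- = refl

    off′ : ∀ {v u} → S′ v u ≡ none → v ≡ u
    off′ {v} {u} eq = off (act≡none (δ v Sign.* δ u) (S v u) eq)

    skew′ : ∀ v u → S′ u v ≡ opposite (S′ v u)
    skew′ v u = trans (cong₂ act (Sign.*-comm (δ u) (δ v)) (skew v u)) (sym (opposite-act (δ v Sign.* δ u) (S v u)))

    -- The factor δ u is common to both rows and cancels. If δ w and δ w′ differ, agreements and
    -- disagreements change places, which does no harm because both counts are 9.
    balanced′ : ∀ w w′ → w ≢ w′ → ℕΣ.sum (λ u → agree (S′ w u) (S′ w′ u)) ≤ 9
                                × ℕΣ.sum (λ u → disagree (S′ w u) (S′ w′ u)) ≤ 9
    balanced′ w w′ w≢w′ = go (δ w) (δ w′)
      where
      A = proj₁ (balanced w≢w′)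
      B = proj₂ (balanced w≢w′)
      go : ∀ p q → ℕΣ.sum (λ u → agree (act (p Sign.* δ u) (S w u)) (act (q Sign.* δ u) (S w′ u))) ≤ 9
                 × ℕΣ.sum (λ u → disagree (act (p Sign.* δ u) (S w u)) (act (q Sign.* δ u) (S w′ u))) ≤ 9
      same : ∀ p → ℕΣ.sum (λ u → agree (act (p Sign.* δ u) (S w u)) (act (p Sign.* δ u) (S w′ u))) ≤ 9
                 × ℕΣ.sum (λ u → disagree (act (p Sign.* δ u) (S w u)) (act (p Sign.* δ u) (S w′ u))) ≤ 9
      same p = ℕ.≤-reflexive (trans (ℕΣ.sum-cong-≗ (λ u → agree-act (p Sign.* δ u) (S w u) (S w′ u))) A)
             , ℕ.≤-reflexive (trans (ℕΣ.sum-cong-≗ (λ u → disagree-act (p Sign.* δ u) (S w u) (S w′ u))) B)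
      opp-agree : ∀ s a b → agree (act s a) (act (Sign.opposite s) b) ≡ disagree a b
      opp-agree s a b = trans (cong (agree (act s a)) (act-opposite s b))
        (trans (agree-oppositeʳ (act s a) (act s b)) (disagree-act s a b))
      opp-disagree : ∀ s a b → disagree (act s a) (act (Sign.opposite s) b) ≡ agree a b
      opp-disagree s a b = trans (cong (disagree (act s a)) (act-opposite s b))
        (trans (disagree-oppositeʳ (act s a) (act s b)) (agree-act s a b))
      opp² : ∀ s → Sign.opposite (Sign.opposite s) ≡ s
      opp² Sign.+ = refl
      opp² Sign.- = refl
      go Sign.+ Sign.+ = same Sign.+
      go Sign.- Sign.- = same Sign.-
      go Sign.+ Sign.- = ℕ.≤-reflexive (trans (ℕΣ.sum-cong-≗ (λ u → opp-agree (δ u) (S w u) (S w′ u))) B)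
                       , ℕ.≤-reflexive (trans (ℕΣ.sum-cong-≗ (λ u → opp-disagree (δ u) (S w u) (S w′ u))) A)
      go Sign.- Sign.+ =
          ℕ.≤-reflexive (trans (ℕΣ.sum-cong-≗ (λ u → trans
            (cong (λ s → agree (act (Sign.opposite (δ u)) (S w u)) (act s (S w′ u))) (sym (opp² (δ u))))
            (opp-agree (Sign.opposite (δ u)) (S w u) (S w′ u)))) B)
        , ℕ.≤-reflexive (trans (ℕΣ.sum-cong-≗ (λ u → trans
            (cong (λ s → disagree (act (Sign.opposite (δ u)) (S w u)) (act s (S w′ u))) (sym (opp² (δ u))))
            (opp-disagree (Sign.opposite (δ u)) (S w u) (S w′ u)))) A)

    word′∈C : ∀ w → C (λ v → ⟦ δ v ⟧ * value (S′ w v))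
    word′∈C w = IsSubspace.resp subspace (λ v → value-act (δ w) (δ v) (S w v) (λ e → cong δ (off e)))
      (IsSubspace.scal subspace ⟦ δ w ⟧ (word∈C w))

    open Blocks S′

    first-row : ∀ j → S′ zero (suc j) ≡ plus
    first-row j = trans (cong (λ e → act (entrySign e Sign.* δ (suc j)) (S zero (suc j))) (diag zero))
      (act-entrySign (S zero (suc j)) (λ e → contradiction (off e) λ ()))

    start : Config ((none ∷ [] , 1) ∷ (plus ∷ [] , m) ∷ [])
    start = record
      { named  = [ zero ]
      ; blocks = (none ∷ [] , [ zero ]) ∷ (plus ∷ [] , tabulate suc) ∷ []
      ; cells≡ = cong (λ k → (none ∷ [] , 1) ∷ (plus ∷ [] , k) ∷ []) (List.length-tabulate suc)
      ; good   = (cong [_] (diag′ zero) ∷ []) ∷ All.tabulate⁺ (λ j → cong [_] (first-row j)) ∷ []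
      ; cover  = ↭-reflexive (cong (zero ∷_) (List.++-identityʳ (tabulate suc))) }

  -- By the pigeonhole principle: punching out a missed value would inject the set into a smaller
  -- one. The map becomes the inverse direction of σ, since a labelling leads from coordinates of Q
  -- to coordinates of C and a monomial matrix leads back.
  injective⇒permutation : ∀ {n} (f : Fin n → Fin n) → (∀ {i j} → f i ≡ f j → i ≡ j) →
                          ∃ λ (σ : Permutation′ n) → ∀ i → σ ⟨$⟩ˡ i ≡ f i
  injective⇒permutation {ℕ.zero}  f inj = Permutation.id , λ ()
  injective⇒permutation {ℕ.suc n} f inj = permutation f⁻¹ f inverseˡ inverseʳ , λ _ → refl
    where
    preimage : ∀ y → ∃ λ x → f x ≡ y
    preimage y = go (Fin.any? λ x → f x Fin.≟ y)
      where
      go : Dec (∃ λ x → f x ≡ y) → ∃ λ x → f x ≡ y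
      go (yes p) = p
      go (no ¬p) = contradiction (Fin.injective⇒≤ {f = λ x → Fin.punchOut (missed x)}
        (λ {x} {x′} eq → inj (Fin.punchOut-injective (missed x) (missed x′) eq))) (ℕ.<⇒≱ ℕ.≤-refl)
        where
        missed : ∀ x → y ≢ f x
        missed x y≡fx = ¬p (x , sym y≡fx)
    f⁻¹ : Fin (ℕ.suc n) → Fin (ℕ.suc n)
    f⁻¹ y = proj₁ (preimage y)
    inverseʳ : ∀ y → f (f⁻¹ y) ≡ y
    inverseʳ y = proj₂ (preimage y)
    inverseˡ : ∀ x → f⁻¹ (f x) ≡ x
    inverseˡ x = inj (inverseʳ (f x))

  -- The labelling carries codewords of C to the generators of Q up to signs;
  -- self-duality of both codes turns this inclusion into an equality.
  module _ {k n : ℕ} {C Q : Code n} (C-subspace : IsSubspace C) (Q-subspace : IsSubspace Q)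
    (C-selfDual : IsSelfDual C) (Q-selfDual : IsSelfDual Q) (G : Matrix k n) (G-basis : IsBasis Q G)
    (G-distinct : ∀ c c′ s s′ → (∀ l → ⟦ s ⟧ * G l c ≡ ⟦ s′ ⟧ * G l c′) → c ≡ c′)
    where
    open MatrixAlgebra GF7-commutativeRing hiding (combination)
    private
      module R = CommutativeRing GF7-commutativeRing
      module A = MatrixAlgebra GF7-commutativeRing
      import Algebra.Properties.Semiring.Sum
      module Σ₇ = Algebra.Properties.Semiring.Sum (CommutativeRing.semiring GF7-commutativeRing)

    sign-square : ∀ s a → ⟦ s ⟧ * (⟦ s ⟧ * a) ≡ a
    sign-square Sign.+ a = trans (R.*-identityˡ (1# * a)) (R.*-identityˡ a)
    sign-square Sign.- a = trans (sym (R.*-assoc (- 1#) (- 1#) a)) (R.*-identityˡ a)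

    labelling⇒equivalent : (d : Fin n → Sign) →
      (∃ λ (g : Fin n → Fin n) → ∃ λ (s : Fin n → Sign) → ∀ l →
         ∃ λ x → C x × ∀ c → x (g c) ≡ ⟦ d (g c) ⟧ * (⟦ s c ⟧ * G l c)) → Equivalent C Q
    labelling⇒equivalent d (g , s , words) = M , M-monomial , Q⊆image , image⊆Q
      where
      -- Two coordinates sharing a vertex would have columns of G that agree up to sign.
      g-injective : ∀ {c c′} → g c ≡ g c′ → c ≡ c′
      g-injective {c} {c′} eq = G-distinct c c′ (s c) (s c′) λ l →
        trans (sym (sign-square (d (g c)) _)) (trans (cong (⟦ d (g c) ⟧ *_)
          (trans (sym (proj₂ (proj₂ (words l)) c)) (trans (cong (proj₁ (words l)) eq)
            (trans (proj₂ (proj₂ (words l)) c′) (cong (λ v → ⟦ d v ⟧ * (⟦ s c′ ⟧ * G l c′)) (sym eq))))))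
          (sign-square (d (g c)) _))

      σ : Permutation′ n
      σ = proj₁ (injective⇒permutation g g-injective)

      σ⁻¹≡g : ∀ c → σ ⟨$⟩ˡ c ≡ g c
      σ⁻¹≡g = proj₂ (injective⇒permutation g g-injective)

      σ∘g : ∀ c → σ ⟨$⟩ʳ g c ≡ c
      σ∘g c = trans (cong (σ ⟨$⟩ʳ_) (sym (σ⁻¹≡g c))) (Permutation.inverseʳ σ)

      g∘σ : ∀ v → g (σ ⟨$⟩ʳ v) ≡ v
      g∘σ v = trans (sym (σ⁻¹≡g (σ ⟨$⟩ʳ v))) (Permutation.inverseˡ σ)

      sign : Fin n → Sign
      sign v = d v Sign.* s (σ ⟨$⟩ʳ v)

      M : Matrix n n
      M v c = ⟦ sign v ⟧ * 𝐈 v (g c)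

      on-perm : ∀ v → M v (σ ⟨$⟩ʳ v) ≡ ⟦ sign v ⟧
      on-perm v = trans (cong (λ u → ⟦ sign v ⟧ * 𝐈 v u) (g∘σ v))
        (trans (cong (⟦ sign v ⟧ *_) (𝐈-refl v)) (R.*-identityʳ ⟦ sign v ⟧))

      off-perm : ∀ v c → c ≢ σ ⟨$⟩ʳ v → M v c ≡ 0#
      off-perm v c c≢ = trans (cong (⟦ sign v ⟧ *_) (𝐈-off λ v≡gc → c≢ (trans (sym (σ∘g c)) (cong (σ ⟨$⟩ʳ_) (sym v≡gc)))))
        (R.zeroʳ ⟦ sign v ⟧)

      M-monomial : IsMonomial M
      M-monomial = record { σ = σ ; sign = sign ; on-perm = on-perm ; off-perm = off-perm }

      sign-g : ∀ c → ⟦ sign (g c) ⟧ ≡ ⟦ d (g c) ⟧ * ⟦ s c ⟧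
      sign-g c = trans (cong (λ c → ⟦ d (g _) Sign.* s c ⟧) (σ∘g c)) (⟦*⟧ (d (g c)) (s c))
        where
        ⟦*⟧ : ∀ p q → ⟦ p Sign.* q ⟧ ≡ ⟦ p ⟧ * ⟦ q ⟧
        ⟦*⟧ Sign.+ Sign.+ = refl
        ⟦*⟧ Sign.+ Sign.- = refl
        ⟦*⟧ Sign.- Sign.+ = refl
        ⟦*⟧ Sign.- Sign.- = refl

      image-entry : ∀ (x : Word n) c → (x ᵥ* M) c ≡ ⟦ sign (g c) ⟧ * x (g c)
      image-entry x c = trans (A.∙-single x (λ v → M v c) (g c) (λ v v≢ → trans (cong (⟦ sign v ⟧ *_) (𝐈-off v≢)) (R.zeroʳ ⟦ sign v ⟧)))
        (trans (cong (x (g c) *_) (trans (cong (⟦ sign (g c) ⟧ *_) (𝐈-refl (g c))) (R.*-identityʳ ⟦ sign (g c) ⟧)))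
          (R.*-comm (x (g c)) ⟦ sign (g c) ⟧))

      isometry : ∀ (x y : Word n) → (x ᵥ* M) ∙ (y ᵥ* M) ≡ x ∙ y
      isometry x y = trans (Σ₇.sum-cong-≗ entrywise) (sym (Σ₇.sum-permute (λ v → x v * y v) (Permutation.flip σ)))
        where
        cancel : ∀ t a b → (⟦ t ⟧ * a) * (⟦ t ⟧ * b) ≡ a * b
        cancel t a b = trans (A.sign-cancel ⟦ t ⟧ a b) (sign-square t (a * b))
        entrywise : ∀ c → (x ᵥ* M) c * (y ᵥ* M) c ≡ x (Permutation.flip σ ⟨$⟩ʳ c) * y (Permutation.flip σ ⟨$⟩ʳ c)
        entrywise c = trans (cong₂ _*_ (image-entry x c) (image-entry y c))
          (trans (cancel (sign (g c)) (x (g c)) (y (g c))) (cong (λ v → x v * y v) (sym (σ⁻¹≡g c))))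

      X : Matrix k n
      X l = proj₁ (words l)

      X-image : ∀ l → X l ᵥ* M ≋ G l
      X-image l c = trans (image-entry (X l) c) (trans (cong₂ _*_ (sign-g c) (proj₂ (proj₂ (words l)) c))
        (trans (A.sign-regroup ⟦ d (g c) ⟧ ⟦ s c ⟧ (G l c))
          (trans (sign-square (d (g c)) _) (sign-square (s c) (G l c)))))

      Q⊆image : ∀ {y} → y ∈ Q → y ∈ image C M
      Q⊆image {y} y∈Q = a ᵥ* X , A.combination C-subspace a X (λ l → proj₁ (proj₂ (words l))) , λ c →
        trans (proj₂ (IsBasis.spanning G-basis y∈Q) c)
          (sym (trans (A.ᵥ*-assoc a X M c) (A.ᵥ*-congˡ {x = a} X-image c)))
        where
        a : Word k
        a = proj₁ (IsBasis.spanning G-basis y∈Q)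

      image⊆Q : ∀ {y} → y ∈ image C M → y ∈ Q
      image⊆Q {y} (x , x∈C , y≋) = proj₂ Q-selfDual λ {z} z∈Q → orthogonal z (Q⊆image z∈Q)
        where
        orthogonal : ∀ z → z ∈ image C M → y ∙ z ≡ 0#
        orthogonal z (x′ , x′∈C , z≋) = trans (A.∙-cong {x = y} {x ᵥ* M} {z} {x′ ᵥ* M} y≋ z≋)
          (trans (isometry x x′) (proj₁ C-selfDual x∈C x′∈C))

-- Construction A, the lattice D⁺ and frames.

module Lattices where
  open import Data.Integer.Base using (+_; -[1+_])
  open import Data.Integer.Divisibility as ℤ using (_∣_)
  import Data.Integer.Divisibility.Signed as ℤD
  open import Data.Vec.Functional using (Vector; transpose)
  open import Relation.Binary.PropositionalEquality as ≡ using (_≡_; cong; cong₂)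
  open import Relation.Unary using (Pred; _∈_; _∪_; U)
  import Algebra.Properties.Semiring.Sum ℤ.+-*-semiring as ℤΣ
  open OddVectors using (∣2⇒half; odd-shift; sum-const)
  module ℤA = MatrixAlgebra ℤ.+-*-commutativeRing
  module Zℤ = LinearAlgebra (CommutativeRing.rawRing ℤ.+-*-commutativeRing)
  open Zℤ using () renaming (_∙_ to _∙ᶻ_; _ᵥ*_ to _ᵥ*ᶻ_; 𝐈 to 𝐈ᶻ)
  module 𝔽 = LinearAlgebra (GF 7)
  module 𝔽A = MatrixAlgebra GF7.GF7-commutativeRing

  reduce-sum : ∀ {n} (x y : Vector ℤ n) → reduce 7 (x ∙ᶻ y) ≡ (reduce 7 ∘ x) 𝔽.∙ (reduce 7 ∘ y)
  reduce-sum {ℕ.zero}  x y = ≡.refl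
  reduce-sum {ℕ.suc n} x y = ≡.trans (Reduction.reduce-+ 7 (x zero ℤ.* y zero) _)
    (cong₂ (RawRing._+_ (GF 7)) (Reduction.reduce-* 7 (x zero) (y zero)) (reduce-sum (x ∘ suc) (y ∘ suc)))

  record Scalars (R : CommutativeRing 0ℓ 0ℓ) : Set where
    open CommutativeRing R
    field
      ι           : ℤ → Carrier
      ι-+         : ∀ a b → ι (a ℤ.+ b) ≈ ι a + ι b
      ι-*         : ∀ a b → ι (a ℤ.* b) ≈ ι a * ι b
      ι-0         : ι 0ℤ ≈ 0#
      ι-1         : ι 1ℤ ≈ 1#
      ι-injective : ∀ {a b} → ι a ≈ ι b → a ≡ b
      ½           : Carrier
      ½*2         : ½ * ι (+ 2) ≈ 1#
      ⅐           : Carrier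
      ⅐*7         : ⅐ * ι (+ 7) ≈ 1#

  -- The coefficients lie in an abstract commutative ring, so that equality of
  -- real numbers is never unfolded.
  module LatticeTheory {R : CommutativeRing 0ℓ 0ℓ} (scalars : Scalars R) where

    open CommutativeRing R hiding (zero)
    open Scalars scalars
    open MatrixAlgebra R
    open LinearAlgebra rawRing hiding (zero; add; neg; resp; gen)
    open import Algebra.Properties.Semiring.Sum semiring using (sum; sum-cong-≋)
    open import Algebra.Properties.Ring ring using (-‿distribʳ-*; -‿distribˡ-*)
    open import Algebra.Properties.CommutativeSemigroup *-commutativeSemigroup using (x∙yz≈y∙xz; interchange)
    open import Relation.Binary.Reasoning.Setoid setoid

    private variable n : ℕ

    D₀ : (n : ℕ) → Pred (Vector Carrier n) 0ℓ
    D₀ n v = ∃ λ (a : Vector ℤ n) → (+ 2) ℤ.∣ ℤΣ.sum a × v ≋ ι ∘ a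

    D₀⁺ : (n : ℕ) → Pred (Vector Carrier n) 0ℓ
    D₀⁺ n = ⟨ D₀ n ∪ (_≋ (λ _ → ½)) ⟩

    construction : Matrix n n → Codes.Code 7 n → Pred (Vector Carrier n) 0ℓ
    construction {n} ε C v = ∃ λ (x : Vector ℤ n) → reduce 7 ∘ x ∈ C × v ≋ ⅐ ⊛ ((ι ∘ x) ᵥ* ε)

    ι-cong : ∀ {a b} → a ≡ b → ι a ≈ ι b
    ι-cong ≡.refl = refl

    ι-neg : ∀ a → ι (ℤ.- a) ≈ - ι a
    ι-neg a = begin
      ι (ℤ.- a)                      ≈⟨ +-identityˡ _ ⟨
      0# + ι (ℤ.- a)                 ≈⟨ +-congʳ (-‿inverseˡ (ι a)) ⟨
      - ι a + ι a + ι (ℤ.- a)        ≈⟨ +-assoc _ _ _ ⟩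
      - ι a + (ι a + ι (ℤ.- a))      ≈⟨ +-congˡ (trans (sym (ι-+ a (ℤ.- a))) (trans (ι-cong (ℤ.+-inverseʳ a)) ι-0)) ⟩
      - ι a + 0#                     ≈⟨ +-identityʳ _ ⟩
      - ι a                          ∎

    ι-sum : (f : Vector ℤ n) → ι (ℤΣ.sum f) ≈ sum (ι ∘ f)
    ι-sum {ℕ.zero}  f = ι-0
    ι-sum {ℕ.suc n} f = trans (ι-+ (f zero) _) (+-congˡ (ι-sum (f ∘ suc)))

    ι-∙ : (x y : Vector ℤ n) → ι (x ∙ᶻ y) ≈ (ι ∘ x) ∙ (ι ∘ y)
    ι-∙ x y = trans (ι-sum (λ i → x i ℤ.* y i)) (sum-cong-≋ (λ i → ι-* (x i) (y i)))

    ι-𝐈 : (i j : Fin n) → ι (𝐈ᶻ i j) ≈ 𝐈 i j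
    ι-𝐈 i j = go (i Fin.≟ j)
      where
      go : Dec (i ≡ j) → ι (𝐈ᶻ i j) ≈ 𝐈 i j
      go (yes ≡.refl) = trans (ι-cong (ℤA.𝐈-refl i)) (trans ι-1 (sym (reflexive (𝐈-refl i))))
      go (no i≢j)     = trans (ι-cong (ℤA.𝐈-off i≢j)) (trans ι-0 (sym (reflexive (𝐈-off i≢j))))

    -- D⁺ consists of the vectors ½ c 1 + b with c an integer and b in D.
    record HalfIntegral {n : ℕ} (v : Vector Carrier n) : Set where
      constructor halfIntegral
      field
        c    : ℤ
        b    : Vector ℤ n
        e    : ℤ
        even : ℤΣ.sum b ≡ + 2 ℤ.* e
        v≋   : v ≋ λ j → ½ * ι (c ℤ.+ + 2 ℤ.* b j)

    halve : ∀ c b → ½ * ι (c ℤ.+ + 2 ℤ.* b) ≈ ι c * ½ + ι b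
    halve c b = begin
      ½ * ι (c ℤ.+ + 2 ℤ.* b)            ≈⟨ *-congˡ (trans (ι-+ c (+ 2 ℤ.* b)) (+-congˡ (ι-* (+ 2) b))) ⟩
      ½ * (ι c + ι (+ 2) * ι b)          ≈⟨ distribˡ ½ _ _ ⟩
      ½ * ι c + ½ * (ι (+ 2) * ι b)      ≈⟨ +-cong (*-comm ½ (ι c)) (trans (sym (*-assoc _ _ _)) (trans (*-congʳ ½*2) (*-identityˡ (ι b)))) ⟩
      ι c * ½ + ι b                      ∎

    halfIntegral-+ : {x y : Vector Carrier n} → HalfIntegral x → HalfIntegral y → HalfIntegral (x ⊕ y)
    halfIntegral-+ (halfIntegral c b e even x≋) (halfIntegral d f g even′ y≋) = halfIntegral (c ℤ.+ d)
      (λ j → b j ℤ.+ f j) (e ℤ.+ g)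
      (≡.trans (ℤΣ.∑-distrib-+ b f) (≡.trans (cong₂ ℤ._+_ even even′) (≡.sym (ℤ.*-distribˡ-+ (+ 2) e g))))
      (λ j → trans (+-cong (x≋ j) (y≋ j)) (trans (sym (distribˡ ½ _ _))
        (*-congˡ (trans (sym (ι-+ (c ℤ.+ + 2 ℤ.* b j) (d ℤ.+ + 2 ℤ.* f j))) (ι-cong (identity c d (b j) (f j)))))))
      where
      identity : ∀ c d x y → (c ℤ.+ + 2 ℤ.* x) ℤ.+ (d ℤ.+ + 2 ℤ.* y) ≡ (c ℤ.+ d) ℤ.+ + 2 ℤ.* (x ℤ.+ y)
      identity = solve-∀

    halfIntegral-neg : {x : Vector Carrier n} → HalfIntegral x → HalfIntegral (⊖ x)
    halfIntegral-neg (halfIntegral c b e even x≋) = halfIntegral (ℤ.- c) (λ j → ℤ.- b j) (ℤ.- e)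
      (≡.trans (ℤA.sum-neg b) (≡.trans (cong ℤ.-_ even) (ℤ.neg-distribʳ-* (+ 2) e)))
      (λ j → trans (-‿cong (x≋ j)) (trans (-‿distribʳ-* ½ _)
        (*-congˡ (trans (sym (ι-neg (c ℤ.+ + 2 ℤ.* b j))) (ι-cong (identity c (b j)))))))
      where
      identity : ∀ c x → ℤ.- (c ℤ.+ + 2 ℤ.* x) ≡ ℤ.- c ℤ.+ + 2 ℤ.* (ℤ.- x)
      identity = solve-∀

    D⁺⇒halfIntegral : {v : Vector Carrier n} → v ∈ D₀⁺ n → HalfIntegral v
    D⁺⇒halfIntegral (⟨_⟩.gen (inj₁ (a , 2∣Σa , v≋a))) = halfIntegral 0ℤ a (proj₁ (∣2⇒half 2∣Σa)) (proj₂ (∣2⇒half 2∣Σa))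
      (λ j → trans (v≋a j) (sym (trans (halve 0ℤ (a j)) (trans (+-congʳ (trans (*-congʳ ι-0) (zeroˡ ½))) (+-identityˡ (ι (a j)))))))
    D⁺⇒halfIntegral {n} (⟨_⟩.gen (inj₂ v≋½)) = halfIntegral 1ℤ (λ _ → 0ℤ) 0ℤ (ℤΣ.sum-replicate-zero n)
      (λ j → trans (v≋½ j) (sym (trans (halve 1ℤ 0ℤ) (trans (+-cong (trans (*-congʳ ι-1) (*-identityˡ ½)) ι-0) (+-identityʳ ½)))))
    D⁺⇒halfIntegral {n} ⟨_⟩.zero = halfIntegral 0ℤ (λ _ → 0ℤ) 0ℤ (ℤΣ.sum-replicate-zero n)
      (λ j → sym (trans (*-congˡ ι-0) (zeroʳ ½)))
    D⁺⇒halfIntegral (⟨_⟩.add x y)    = halfIntegral-+ (D⁺⇒halfIntegral x) (D⁺⇒halfIntegral y)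
    D⁺⇒halfIntegral (⟨_⟩.neg x)      = halfIntegral-neg (D⁺⇒halfIntegral x)
    D⁺⇒halfIntegral (⟨_⟩.resp x≋y x) with halfIntegral c b e even x≋ ← D⁺⇒halfIntegral x =
      halfIntegral c b e even (λ j → trans (sym (x≋y j)) (x≋ j))

    natMultiple : ∀ {S} {x : Vector Carrier n} k → x ∈ ⟨ S ⟩ → ι (+ k) ⊛ x ∈ ⟨ S ⟩
    natMultiple {x = x} ℕ.zero    x∈ = ⟨_⟩.resp (λ j → sym (trans (*-congʳ ι-0) (zeroˡ (x j)))) ⟨_⟩.zero
    natMultiple {x = x} (ℕ.suc k) x∈ = ⟨_⟩.resp
      (λ j → trans (+-congʳ (trans (sym (*-identityˡ (x j))) (*-congʳ (sym ι-1))))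
        (trans (sym (distribʳ (x j) (ι 1ℤ) (ι (+ k)))) (*-congʳ (sym (ι-+ 1ℤ (+ k))))))
      (⟨_⟩.add x∈ (natMultiple k x∈))

    multiple : ∀ {S} {x : Vector Carrier n} c → x ∈ ⟨ S ⟩ → ι c ⊛ x ∈ ⟨ S ⟩
    multiple         (+ k)    x∈ = natMultiple k x∈
    multiple {x = x} -[1+ k ] x∈ = ⟨_⟩.resp
      (λ j → trans (-‿distribˡ-* (ι (+ ℕ.suc k)) (x j)) (*-congʳ (sym (ι-neg (+ ℕ.suc k)))))
      (⟨_⟩.neg (natMultiple (ℕ.suc k) x∈))

    halfIntegral⇒D⁺ : {v : Vector Carrier n} → HalfIntegral v → v ∈ D₀⁺ n
    halfIntegral⇒D⁺ (halfIntegral c b e even v≋) = ⟨_⟩.resp (λ j → sym (trans (v≋ j) (halve c (b j))))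
      (⟨_⟩.add (multiple c (⟨_⟩.gen (inj₂ (λ _ → refl))))
               (⟨_⟩.gen (inj₁ (b , ℤD.∣⇒∣ᵤ (ℤD.divides e (≡.trans even (ℤ.*-comm (+ 2) e))) , λ _ → refl))))

    basis-columns : {ε : Matrix n n} → IsBasis U ε → (∀ i j → ε i ∙ ε j ≈ ι (+ 7) * 𝐈 i j) →
                    ∀ j k → transpose ε j ∙ transpose ε k ≈ ι (+ 7) * 𝐈 j k
    basis-columns {ε = ε} basis gram = gram-transpose ε gram
      (λ j → proj₁ (IsBasis.spanning basis {𝐈 j} _)) (λ j → proj₂ (IsBasis.spanning basis {𝐈 j} _))

    module _ {n : ℕ} (n≡20 : n ≡ 20) (ε : Matrix n n)
      (gram : ∀ i j → ε i ∙ ε j ≈ ι (+ 7) * 𝐈 i j)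
      (gramᵀ : ∀ j k → transpose ε j ∙ transpose ε k ≈ ι (+ 7) * 𝐈 j k)
      where

      scale : Carrier
      scale = ½ * ⅐

      -- Since 7 · 28 = 14², the factor 1/14 balances the Gram matrices of ε and of F together.
      scale-28 : ∀ a → (scale * scale) * (ι (+ 7) * (ι (+ 28) * a)) ≈ a
      scale-28 a = begin
        (scale * scale) * (ι (+ 7) * (ι (+ 28) * a))
          ≈⟨ *-congˡ (*-congˡ (*-congʳ (trans (ι-* (+ 4) (+ 7)) (*-congʳ (ι-* (+ 2) (+ 2)))))) ⟩
        (scale * scale) * (ι (+ 7) * (((ι (+ 2) * ι (+ 2)) * ι (+ 7)) * a))
          ≈⟨ *-congˡ (trans (sym (*-assoc _ _ a)) (*-congʳ (trans (x∙yz≈y∙xz _ _ _) (interchange _ _ _ _)))) ⟩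
        (scale * scale) * (((ι (+ 2) * ι (+ 7)) * (ι (+ 2) * ι (+ 7))) * a)
          ≈⟨ *-assoc _ _ a ⟨
        ((scale * scale) * ((ι (+ 2) * ι (+ 7)) * (ι (+ 2) * ι (+ 7)))) * a
          ≈⟨ *-congʳ (trans (interchange _ _ _ _) (trans (*-cong unit unit) (*-identityˡ 1#))) ⟩
        1# * a ≈⟨ *-identityˡ a ⟩
        a ∎
        where
        unit : scale * (ι (+ 2) * ι (+ 7)) ≈ 1#
        unit = trans (interchange ½ ⅐ (ι (+ 2)) (ι (+ 7))) (trans (*-cong ½*2 ⅐*7) (*-identityˡ 1#))

      scale-7 : ∀ u → scale * ι (+ 7 ℤ.* u) ≈ ½ * ι u
      scale-7 u = begin
        scale * ι (+ 7 ℤ.* u)        ≈⟨ *-congˡ (ι-* (+ 7) u) ⟩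
        (½ * ⅐) * (ι (+ 7) * ι u)    ≈⟨ *-assoc ½ ⅐ _ ⟩
        ½ * (⅐ * (ι (+ 7) * ι u))    ≈⟨ *-congˡ (trans (sym (*-assoc ⅐ _ _)) (trans (*-congʳ ⅐*7) (*-identityˡ (ι u)))) ⟩
        ½ * ι u                      ∎

      -- A frame F in the lattice gives the isometry εᵢ ↦ ½ Fᵢ.
      module Forward (F B : Fin n → Fin n → ℤ) (E : Fin n → ℤ)
        (F≡ : ∀ i j → F i j ≡ + 1 ℤ.+ + 2 ℤ.* B i j) (ΣB : ∀ i → ℤΣ.sum (B i) ≡ + 2 ℤ.* E i)
        (rows : ∀ i k → F i ∙ᶻ F k ≡ + 28 ℤ.* 𝐈ᶻ i k)
        (columns : ∀ j k → transpose F j ∙ᶻ transpose F k ≡ + 28 ℤ.* 𝐈ᶻ j k)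
        {Q : Codes.Code 7 n} (subspace : 𝔽.IsSubspace Q) (orthogonal : ∀ {x y} → Q x → Q y → x 𝔽.∙ y ≡ RawRing.0# (GF 7))
        (column∈Q : ∀ j → Q (λ i → reduce 7 (F i j)))
        where

        ιF : Matrix n n
        ιF i j = ι (F i j)

        A : Matrix n n
        A a b = scale * (transpose ιF b ᵥ* ε) a

        columnsᴬ : ∀ b c → transpose A b ∙ transpose A c ≈ 𝐈 b c
        columnsᴬ b c = begin
          (scale ⊛ (transpose ιF b ᵥ* ε)) ∙ (scale ⊛ (transpose ιF c ᵥ* ε))
            ≈⟨ ∙-⊛⊛ scale scale (transpose ιF b ᵥ* ε) (transpose ιF c ᵥ* ε) ⟩
          scale * (scale * ((transpose ιF b ᵥ* ε) ∙ (transpose ιF c ᵥ* ε)))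
            ≈⟨ *-assoc scale scale _ ⟨
          (scale * scale) * ((transpose ιF b ᵥ* ε) ∙ (transpose ιF c ᵥ* ε))
            ≈⟨ *-congˡ (gram-∙ ε gram (transpose ιF b) (transpose ιF c)) ⟩
          (scale * scale) * (ι (+ 7) * (transpose ιF b ∙ transpose ιF c))
            ≈⟨ *-congˡ (*-congˡ (trans (sym (ι-∙ (transpose F b) (transpose F c)))
                 (trans (ι-cong (columns b c)) (trans (ι-* (+ 28) _) (*-congˡ (ι-𝐈 b c)))))) ⟩
          (scale * scale) * (ι (+ 7) * (ι (+ 28) * 𝐈 b c))
            ≈⟨ scale-28 (𝐈 b c) ⟩
          𝐈 b c ∎

        ιF-gram : ∀ i k → ιF i ∙ ιF k ≈ ι (+ 28) * 𝐈 i k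
        ιF-gram i k = trans (sym (ι-∙ (F i) (F k))) (trans (ι-cong (rows i k)) (trans (ι-* (+ 28) _) (*-congˡ (ι-𝐈 i k))))

        rowsᴬ : ∀ a b → A a ∙ A b ≈ 𝐈 a b
        rowsᴬ a b = begin
          A a ∙ A b
            ≈⟨ ∙-cong (λ j → *-congˡ (∙-comm (transpose ιF j) (transpose ε a))) (λ j → *-congˡ (∙-comm (transpose ιF j) (transpose ε b))) ⟩
          (scale ⊛ (transpose ε a ᵥ* ιF)) ∙ (scale ⊛ (transpose ε b ᵥ* ιF))
            ≈⟨ ∙-⊛⊛ scale scale (transpose ε a ᵥ* ιF) (transpose ε b ᵥ* ιF) ⟩
          scale * (scale * ((transpose ε a ᵥ* ιF) ∙ (transpose ε b ᵥ* ιF)))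
            ≈⟨ *-assoc scale scale _ ⟨
          (scale * scale) * ((transpose ε a ᵥ* ιF) ∙ (transpose ε b ᵥ* ιF))
            ≈⟨ *-congˡ (gram-∙ ιF ιF-gram (transpose ε a) (transpose ε b)) ⟩
          (scale * scale) * (ι (+ 28) * (transpose ε a ∙ transpose ε b))
            ≈⟨ *-congˡ (*-congˡ (gramᵀ a b)) ⟩
          (scale * scale) * (ι (+ 28) * (ι (+ 7) * 𝐈 a b))
            ≈⟨ *-congˡ (x∙yz≈y∙xz _ _ _) ⟩
          (scale * scale) * (ι (+ 7) * (ι (+ 28) * 𝐈 a b))
            ≈⟨ scale-28 (𝐈 a b) ⟩
          𝐈 a b ∎

        apply-A : (x : Vector ℤ n) → (⅐ ⊛ ((ι ∘ x) ᵥ* ε)) ᵥ* A ≋ λ b → scale * ι ((x ᵥ*ᶻ F) b)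
        apply-A x b = begin
          (⅐ ⊛ ((ι ∘ x) ᵥ* ε)) ∙ (scale ⊛ (transpose ιF b ᵥ* ε))
            ≈⟨ ∙-⊛⊛ ⅐ scale ((ι ∘ x) ᵥ* ε) (transpose ιF b ᵥ* ε) ⟩
          ⅐ * (scale * (((ι ∘ x) ᵥ* ε) ∙ (transpose ιF b ᵥ* ε)))
            ≈⟨ trans (x∙yz≈y∙xz _ _ _) (*-congˡ (*-congˡ (gram-∙ ε gram (ι ∘ x) (transpose ιF b)))) ⟩
          scale * (⅐ * (ι (+ 7) * ((ι ∘ x) ∙ transpose ιF b)))
            ≈⟨ *-congˡ (trans (sym (*-assoc ⅐ _ _)) (trans (*-congʳ ⅐*7) (*-identityˡ _))) ⟩
          scale * ((ι ∘ x) ∙ transpose ιF b)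
            ≈⟨ *-congˡ (ι-∙ x (transpose F b)) ⟨
          scale * ι ((x ᵥ*ᶻ F) b) ∎

        D⁺⊆image : ∀ {v} → v ∈ D₀⁺ n → v ∈ image (construction ε Q) A
        D⁺⊆image {v} v∈D⁺ = fromHalf (D⁺⇒halfIntegral v∈D⁺)
          where
          fromHalf : HalfIntegral v → v ∈ image (construction ε Q) A
          fromHalf (halfIntegral c b e even v≋) = ⅐ ⊛ ((ι ∘ z) ᵥ* ε) , (z , z∈Q , λ _ → refl) , λ j →
            trans (v≋ j) (trans (sym (scale-7 (u j))) (trans (*-congˡ (ι-cong (≡.sym (zF j)))) (sym (apply-A z j))))
            where
            u z : Vector ℤ n
            u j = c ℤ.+ + 2 ℤ.* b j
            -- This is ¼ F u, the solution of z F = 7 u because the columns of F have Gram matrix 28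
            -- I. Substituting F = 1 + 2 B shows that F u is divisible by 4: the length 20 and the
            -- even sums of b and of the rows of B supply the factors.
            z i = + 5 ℤ.* c ℤ.+ e ℤ.+ c ℤ.* E i ℤ.+ B i ∙ᶻ b
            F∙u : ∀ i → F i ∙ᶻ u ≡ + 4 ℤ.* z i
            F∙u i = ≡R.begin
              F i ∙ᶻ u
                ≡R.≡⟨ ℤΣ.sum-cong-≗ (λ j → ≡.trans (cong (ℤ._* u j) (F≡ i j)) (identity₁ (B i j) c (b j))) ⟩
              ℤΣ.sum (λ j → c ℤ.+ (+ 2 ℤ.* b j ℤ.+ (+ 2 ℤ.* c ℤ.* B i j ℤ.+ + 4 ℤ.* (B i j ℤ.* b j))))
                ≡R.≡⟨ ≡.trans (ℤΣ.∑-distrib-+ {n} (λ _ → c) (λ j → + 2 ℤ.* b j ℤ.+ (+ 2 ℤ.* c ℤ.* B i j ℤ.+ + 4 ℤ.* (B i j ℤ.* b j)))) (cong₂ ℤ._+_ (≡.trans (sum-const n c) (cong (λ n → + n ℤ.* c) n≡20))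
                   (≡.trans (ℤΣ.∑-distrib-+ (λ j → + 2 ℤ.* b j) (λ j → + 2 ℤ.* c ℤ.* B i j ℤ.+ + 4 ℤ.* (B i j ℤ.* b j))) (cong₂ ℤ._+_ (≡.sym (ℤΣ.*-distribˡ-sum (+ 2) b))
                     (≡.trans (ℤΣ.∑-distrib-+ (λ j → + 2 ℤ.* c ℤ.* B i j) (λ j → + 4 ℤ.* (B i j ℤ.* b j))) (cong₂ ℤ._+_
                       (≡.sym (ℤΣ.*-distribˡ-sum (+ 2 ℤ.* c) (B i))) (≡.sym (ℤΣ.*-distribˡ-sum (+ 4) (λ j → B i j ℤ.* b j)))))))) ⟩
              + 20 ℤ.* c ℤ.+ (+ 2 ℤ.* ℤΣ.sum b ℤ.+ (+ 2 ℤ.* c ℤ.* ℤΣ.sum (B i) ℤ.+ + 4 ℤ.* (B i ∙ᶻ b)))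
                ≡R.≡⟨ cong₂ (λ s t → + 20 ℤ.* c ℤ.+ (+ 2 ℤ.* s ℤ.+ (+ 2 ℤ.* c ℤ.* t ℤ.+ + 4 ℤ.* (B i ∙ᶻ b)))) even (ΣB i) ⟩
              + 20 ℤ.* c ℤ.+ (+ 2 ℤ.* (+ 2 ℤ.* e) ℤ.+ (+ 2 ℤ.* c ℤ.* (+ 2 ℤ.* E i) ℤ.+ + 4 ℤ.* (B i ∙ᶻ b)))
                ≡R.≡⟨ identity₂ c e (E i) (B i ∙ᶻ b) ⟩
              + 4 ℤ.* z i ≡R.∎
              where
              module ≡R = ≡.≡-Reasoning
              identity₁ : ∀ B c b → (+ 1 ℤ.+ + 2 ℤ.* B) ℤ.* (c ℤ.+ + 2 ℤ.* b) ≡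
                          c ℤ.+ (+ 2 ℤ.* b ℤ.+ (+ 2 ℤ.* c ℤ.* B ℤ.+ + 4 ℤ.* (B ℤ.* b)))
              identity₁ = solve-∀
              identity₂ : ∀ c e E t → + 20 ℤ.* c ℤ.+ (+ 2 ℤ.* (+ 2 ℤ.* e) ℤ.+ (+ 2 ℤ.* c ℤ.* (+ 2 ℤ.* E) ℤ.+ + 4 ℤ.* t)) ≡
                          + 4 ℤ.* (+ 5 ℤ.* c ℤ.+ e ℤ.+ c ℤ.* E ℤ.+ t)
              identity₂ = solve-∀
            zF : ∀ j → (z ᵥ*ᶻ F) j ≡ + 7 ℤ.* u j
            zF j = ℤ.*-cancelˡ-≡ (+ 4) _ _ (≡R.begin
              + 4 ℤ.* (z ∙ᶻ transpose F j)                        ≡R.≡⟨ ℤA.∙-⊛ˡ (+ 4) z (transpose F j) ⟨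
              (λ i → + 4 ℤ.* z i) ∙ᶻ transpose F j                ≡R.≡⟨ ℤA.∙-congʳ {y = transpose F j} (λ i → ≡.sym (F∙u i)) ⟩
              (λ i → F i ∙ᶻ u) ∙ᶻ transpose F j                   ≡R.≡⟨ ℤA.∙-congʳ {y = transpose F j} (λ i → ℤA.∙-comm (F i) u) ⟩
              (u ᵥ*ᶻ transpose F) ∙ᶻ transpose F j                ≡R.≡⟨ ℤA.gram-row {p = + 28} (transpose F) columns u j ⟩
              + 28 ℤ.* u j                                        ≡R.≡⟨ ℤ.*-assoc (+ 4) (+ 7) (u j) ⟩
              + 4 ℤ.* (+ 7 ℤ.* u j)                               ≡R.∎)
              where module ≡R = ≡.≡-Reasoning
            z∈Q : Q (reduce 7 ∘ z)
            -- Modulo 7, z equals 8 z = 2 (F u), and F u is a combination of columns of F, which are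
            -- codewords.
            z∈Q = 𝔽.IsSubspace.resp subspace doubled (𝔽.IsSubspace.scal subspace (reduce 7 (+ 2))
              (𝔽.IsSubspace.resp subspace (λ i → ≡.trans (𝔽A.∙-comm (reduce 7 ∘ u) (reduce 7 ∘ F i)) (≡.sym (reduce-sum (F i) u)))
                (𝔽A.combination subspace (reduce 7 ∘ u) (λ j i → reduce 7 (F i j)) column∈Q)))
              where
              identity : ∀ z → + 2 ℤ.* (+ 4 ℤ.* z) ≡ z ℤ.+ + 7 ℤ.* z
              identity = solve-∀
              doubled : ∀ i → RawRing._*_ (GF 7) (reduce 7 (+ 2)) (reduce 7 (F i ∙ᶻ u)) ≡ reduce 7 (z i)
              doubled i = ≡.trans (≡.sym (Reduction.reduce-* 7 (+ 2) (F i ∙ᶻ u)))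
                (≡.trans (cong (reduce 7) (≡.trans (cong (λ t → + 2 ℤ.* t) (F∙u i)) (identity (z i))))
                  (≡.trans (Reduction.reduce-+ 7 (z i) (+ 7 ℤ.* z i))
                    (≡.trans (cong (RawRing._+_ (GF 7) (reduce 7 (z i))) (Reduction.reduce-multiple 7 (z i)))
                      (CommutativeRing.+-identityʳ GF7.GF7-commutativeRing _))))

        image⊆D⁺ : ∀ {v} → v ∈ image (construction ε Q) A → v ∈ D₀⁺ n
        image⊆D⁺ {v} (y , (x , x∈Q , y≋) , v≋) = halfIntegral⇒D⁺ (halfIntegral X b e even λ j → begin
          v j                          ≈⟨ v≋ j ⟩
          (y ᵥ* A) j                   ≈⟨ ∙-congʳ {y = transpose A j} y≋ ⟩
          ((⅐ ⊛ ((ι ∘ x) ᵥ* ε)) ᵥ* A) j ≈⟨ apply-A x j ⟩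
          scale * ι ((x ᵥ*ᶻ F) j)      ≈⟨ *-congˡ (ι-cong (proj₂ (divisible j))) ⟩
          scale * ι (+ 7 ℤ.* u j)      ≈⟨ scale-7 (u j) ⟩
          ½ * ι (u j)                  ≈⟨ *-congˡ (ι-cong (u≡ j)) ⟩
          ½ * ι (X ℤ.+ + 2 ℤ.* b j)    ∎)
          where
          divisible : ∀ j → ∃ λ k → (x ᵥ*ᶻ F) j ≡ + 7 ℤ.* k
          divisible j = Reduction.reduce≡0 7 _ (≡.trans (reduce-sum x (transpose F j)) (orthogonal x∈Q (column∈Q j)))
          X : ℤ
          X = ℤΣ.sum x
          u xB b : Vector ℤ n
          u j  = proj₁ (divisible j)
          xB   = x ᵥ*ᶻ B
          -- Writing u = 7 u - 6 u avoids a division by 7: as 7 u is X + 2 xB, half of the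
          -- difference u - X is xB - 3 u.
          b j  = xB j ℤ.+ ℤ.- + 3 ℤ.* u j
          7u : ∀ j → + 7 ℤ.* u j ≡ X ℤ.+ + 2 ℤ.* xB j
          7u j = ≡.trans (≡.sym (proj₂ (divisible j))) (≡.trans
            (ℤΣ.sum-cong-≗ (λ i → ≡.trans (cong (λ t → x i ℤ.* t) (F≡ i j)) (identity (x i) (B i j))))
            (≡.trans (ℤΣ.∑-distrib-+ x (λ i → + 2 ℤ.* (x i ℤ.* B i j))) (cong (λ t → X ℤ.+ t) (≡.sym (ℤΣ.*-distribˡ-sum (+ 2) (λ i → x i ℤ.* B i j))))))
            where
            identity : ∀ x B → x ℤ.* (+ 1 ℤ.+ + 2 ℤ.* B) ≡ x ℤ.+ + 2 ℤ.* (x ℤ.* B)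
            identity = solve-∀
          u≡ : ∀ j → u j ≡ X ℤ.+ + 2 ℤ.* b j
          u≡ j = ≡.trans (identity₁ (u j)) (≡.trans (cong (λ t → t ℤ.+ ℤ.- + 6 ℤ.* u j) (7u j)) (identity₂ X (xB j) (u j)))
            where
            identity₁ : ∀ u → u ≡ + 7 ℤ.* u ℤ.+ ℤ.- + 6 ℤ.* u
            identity₁ = solve-∀
            identity₂ : ∀ X t u → (X ℤ.+ + 2 ℤ.* t) ℤ.+ ℤ.- + 6 ℤ.* u ≡ X ℤ.+ + 2 ℤ.* (t ℤ.+ ℤ.- + 3 ℤ.* u)
            identity₂ = solve-∀
          xE Σu : ℤ
          xE = x ∙ᶻ E
          Σu  = ℤΣ.sum u
          ΣxB : ℤΣ.sum xB ≡ + 2 ℤ.* xE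
          ΣxB = ≡.trans (ℤΣ.∑-comm (λ j i → x i ℤ.* B i j)) (≡.trans
            (ℤΣ.sum-cong-≗ (λ i → ≡.trans (≡.sym (ℤΣ.*-distribˡ-sum (x i) (B i))) (≡.trans (cong (λ t → x i ℤ.* t) (ΣB i)) (identity (x i) (E i)))))
            (≡.sym (ℤΣ.*-distribˡ-sum (+ 2) (λ i → x i ℤ.* E i))))
            where
            identity : ∀ x E → x ℤ.* (+ 2 ℤ.* E) ≡ + 2 ℤ.* (x ℤ.* E)
            identity = solve-∀
          7Σu : + 7 ℤ.* Σu ≡ + 20 ℤ.* X ℤ.+ + 4 ℤ.* xE
          7Σu = ≡.trans (ℤΣ.*-distribˡ-sum (+ 7) u) (≡.trans (ℤΣ.sum-cong-≗ 7u) (≡.trans (ℤΣ.∑-distrib-+ (λ _ → X) (λ j → + 2 ℤ.* xB j))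
            (cong₂ ℤ._+_ (≡.trans (sum-const n X) (cong (λ n → + n ℤ.* X) n≡20))
              (≡.trans (≡.sym (ℤΣ.*-distribˡ-sum (+ 2) xB)) (≡.trans (cong (λ t → + 2 ℤ.* t) ΣxB) (identity xE))))))
            where
            identity : ∀ t → + 2 ℤ.* (+ 2 ℤ.* t) ≡ + 4 ℤ.* t
            identity = solve-∀
          e : ℤ
          -- The same device makes the sum of u even: it equals 20 X + 4 xE minus six times itself.
          -- Substitution into the sum of b gives this half.
          e = xE ℤ.+ ℤ.- + 3 ℤ.* (+ 10 ℤ.* X ℤ.+ + 2 ℤ.* xE ℤ.+ ℤ.- + 3 ℤ.* Σu)
          even : ℤΣ.sum b ≡ + 2 ℤ.* e
          even = ≡.trans (ℤΣ.∑-distrib-+ xB (λ j → ℤ.- + 3 ℤ.* u j)) (≡.trans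
            (cong₂ ℤ._+_ ΣxB (≡.sym (ℤΣ.*-distribˡ-sum (ℤ.- + 3) u)))
            (≡.trans (identity₁ xE Σu) (≡.trans (cong (λ t → + 2 ℤ.* xE ℤ.+ ℤ.- + 3 ℤ.* (t ℤ.+ ℤ.- + 6 ℤ.* Σu)) 7Σu) (identity₂ X xE Σu))))
            where
            identity₁ : ∀ t Σu → + 2 ℤ.* t ℤ.+ ℤ.- + 3 ℤ.* Σu ≡ + 2 ℤ.* t ℤ.+ ℤ.- + 3 ℤ.* (+ 7 ℤ.* Σu ℤ.+ ℤ.- + 6 ℤ.* Σu)
            identity₁ = solve-∀
            identity₂ : ∀ X t Σu → + 2 ℤ.* t ℤ.+ ℤ.- + 3 ℤ.* ((+ 20 ℤ.* X ℤ.+ + 4 ℤ.* t) ℤ.+ ℤ.- + 6 ℤ.* Σu) ≡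
                        + 2 ℤ.* (t ℤ.+ ℤ.- + 3 ℤ.* (+ 10 ℤ.* X ℤ.+ + 2 ℤ.* t ℤ.+ ℤ.- + 3 ℤ.* Σu))
            identity₂ = solve-∀

      -- Conversely an isometry carries the vectors εᵢ to a frame ½ F.
      module Backward {C : Codes.Code 7 n} (subspace : 𝔽.IsSubspace C) (A : Matrix n n)
        (rowsᴬ : ∀ i j → A i ∙ A j ≈ 𝐈 i j) (columnsᴬ : ∀ i j → transpose A i ∙ transpose A j ≈ 𝐈 i j)
        (D⁺⊆image : ∀ {v} → v ∈ D₀⁺ n → v ∈ image (construction ε C) A)
        (image⊆D⁺ : ∀ {v} → v ∈ image (construction ε C) A → v ∈ D₀⁺ n)
        where

        -- The basis vector comes from the integer vector 7 𝐈 i, whose reduction is the zero word;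
        -- Construction A therefore contains the frame ε for every code.
        ε∈construction : ∀ i → ε i ∈ construction ε C
        ε∈construction i = (λ k → + 7 ℤ.* 𝐈ᶻ i k)
          , 𝔽.IsSubspace.resp subspace (λ k → ≡.sym (Reduction.reduce-multiple 7 (𝐈ᶻ i k))) (𝔽.IsSubspace.zero subspace)
          , λ j → begin
            ε i j                                             ≈⟨ 𝐈-∙ i (transpose ε j) ⟨
            𝐈 i ∙ transpose ε j                               ≈⟨ trans (*-congʳ ⅐*7) (*-identityˡ _) ⟨
            (⅐ * ι (+ 7)) * (𝐈 i ∙ transpose ε j)             ≈⟨ trans (*-assoc ⅐ _ _) (*-congˡ (sym (∙-⊛ˡ (ι (+ 7)) (𝐈 i) (transpose ε j)))) ⟩
            ⅐ * ((ι (+ 7) ⊛ 𝐈 i) ∙ transpose ε j)             ≈⟨ *-congˡ (∙-congʳ {y = transpose ε j} (λ k →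
                                                                   trans (*-congˡ (sym (ι-𝐈 i k))) (sym (ι-* (+ 7) (𝐈ᶻ i k))))) ⟩
            ⅐ * ((λ k → ι (+ 7 ℤ.* 𝐈ᶻ i k)) ∙ transpose ε j)  ∎

        f : Matrix n n
        f i = ε i ᵥ* A

        half : ∀ i → HalfIntegral (f i)
        half i = D⁺⇒halfIntegral (image⊆D⁺ (ε i , ε∈construction i , λ _ → refl))

        F : Fin n → Fin n → ℤ
        F i j = HalfIntegral.c (half i) ℤ.+ + 2 ℤ.* HalfIntegral.b (half i) j

        f≈ : ∀ i j → f i j ≈ ½ * ι (F i j)
        f≈ i = HalfIntegral.v≋ (half i)

        A-gram : ∀ i j → A i ∙ A j ≈ 1# * 𝐈 i j
        A-gram i j = trans (rowsᴬ i j) (sym (*-identityˡ _))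

        clear-halves : ∀ {a b} → ½ * (½ * ι a) ≈ ι (+ 7) * ι b → a ≡ + 28 ℤ.* b
        clear-halves {a} {b} h = ι-injective (begin
          ι a                                             ≈⟨ double a ⟩
          ι (+ 2) * (½ * ι a)                             ≈⟨ *-congˡ (trans (sym (*-identityˡ _)) (trans (*-congʳ (sym ½*2)) (trans (*-congʳ (*-comm ½ _)) (*-assoc _ ½ _)))) ⟩
          ι (+ 2) * (ι (+ 2) * (½ * (½ * ι a)))           ≈⟨ *-congˡ (*-congˡ (trans h (sym (ι-* (+ 7) b)))) ⟩
          ι (+ 2) * (ι (+ 2) * ι (+ 7 ℤ.* b))             ≈⟨ trans (*-congˡ (sym (ι-* (+ 2) _))) (sym (ι-* (+ 2) _)) ⟩
          ι (+ 2 ℤ.* (+ 2 ℤ.* (+ 7 ℤ.* b)))               ≈⟨ ι-cong (identity b) ⟩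
          ι (+ 28 ℤ.* b)                                  ∎)
          where
          double : ∀ a → ι a ≈ ι (+ 2) * (½ * ι a)
          double a = trans (sym (*-identityˡ _)) (trans (*-congʳ (sym ½*2)) (trans (*-congʳ (*-comm ½ _)) (*-assoc _ ½ _)))
          identity : ∀ b → + 2 ℤ.* (+ 2 ℤ.* (+ 7 ℤ.* b)) ≡ + 28 ℤ.* b
          identity = solve-∀

        rows : ∀ i → F i ∙ᶻ F i ≡ + 28
        rows i = clear-halves {b = 1ℤ} (begin
          ½ * (½ * ι (F i ∙ᶻ F i))                 ≈⟨ *-congˡ (*-congˡ (ι-∙ (F i) (F i))) ⟩
          ½ * (½ * ((ι ∘ F i) ∙ (ι ∘ F i)))        ≈⟨ ∙-⊛⊛ ½ ½ (ι ∘ F i) (ι ∘ F i) ⟨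
          (½ ⊛ (ι ∘ F i)) ∙ (½ ⊛ (ι ∘ F i))        ≈⟨ ∙-cong (λ j → sym (f≈ i j)) (λ j → sym (f≈ i j)) ⟩
          f i ∙ f i                                ≈⟨ gram-∙ A A-gram (ε i) (ε i) ⟩
          1# * (ε i ∙ ε i)                         ≈⟨ *-identityˡ _ ⟩
          ε i ∙ ε i                                ≈⟨ gram i i ⟩
          ι (+ 7) * 𝐈 i i                          ≈⟨ *-congˡ (trans (reflexive (𝐈-refl i)) (sym ι-1)) ⟩
          ι (+ 7) * ι 1ℤ                           ∎)

        columns : ∀ j k → transpose F j ∙ᶻ transpose F k ≡ + 28 ℤ.* 𝐈ᶻ j k
        columns j k = clear-halves (begin
          ½ * (½ * ι (transpose F j ∙ᶻ transpose F k))
            ≈⟨ *-congˡ (*-congˡ (ι-∙ (transpose F j) (transpose F k))) ⟩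
          ½ * (½ * ((ι ∘ transpose F j) ∙ (ι ∘ transpose F k)))
            ≈⟨ ∙-⊛⊛ ½ ½ (ι ∘ transpose F j) (ι ∘ transpose F k) ⟨
          (½ ⊛ (ι ∘ transpose F j)) ∙ (½ ⊛ (ι ∘ transpose F k))
            ≈⟨ ∙-cong (λ i → trans (sym (f≈ i j)) (∙-comm (ε i) (transpose A j))) (λ i → trans (sym (f≈ i k)) (∙-comm (ε i) (transpose A k))) ⟩
          (transpose A j ᵥ* transpose ε) ∙ (transpose A k ᵥ* transpose ε)
            ≈⟨ gram-∙ (transpose ε) gramᵀ (transpose A j) (transpose A k) ⟩
          ι (+ 7) * (transpose A j ∙ transpose A k)
            ≈⟨ *-congˡ (trans (columnsᴬ j k) (sym (ι-𝐈 j k))) ⟩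
          ι (+ 7) * ι (𝐈ᶻ j k) ∎)

        F-odd : ∀ i j → ∃ λ h → F i j ≡ + 1 ℤ.+ + 2 ℤ.* h
        F-odd i j = fromShift (odd-shift c b (HalfIntegral.e (half i)) (HalfIntegral.even (half i)) n≡20 (rows i))
          where
          c : ℤ
          c = HalfIntegral.c (half i)
          b : Vector ℤ n
          b = HalfIntegral.b (half i)
          identity : ∀ m b → (+ 1 ℤ.+ + 2 ℤ.* m) ℤ.+ + 2 ℤ.* b ≡ + 1 ℤ.+ + 2 ℤ.* (m ℤ.+ b)
          identity = solve-∀
          fromShift : (∃ λ m → c ≡ + 1 ℤ.+ + 2 ℤ.* m) → ∃ λ h → F i j ≡ + 1 ℤ.+ + 2 ℤ.* h
          fromShift (m , c≡) = m ℤ.+ b j , ≡.trans (cong (λ c → c ℤ.+ + 2 ℤ.* b j) c≡) (identity m (b j))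

        -- The vector 2 eⱼ of D⁺ has the coordinates F i j.
        column∈C : ∀ j → C (λ i → reduce 7 (F i j))
        column∈C j = fromImage (D⁺⊆image {2e} (⟨_⟩.gen (inj₁ ((λ k → + 2 ℤ.* 𝐈ᶻ j k) , 2∣Σ , λ _ → refl))))
          where
          2e : Vector Carrier n
          2e k = ι (+ 2 ℤ.* 𝐈ᶻ j k)
          2∣Σ : + 2 ℤ.∣ ℤΣ.sum (λ k → + 2 ℤ.* 𝐈ᶻ j k)
          2∣Σ = ℤD.∣⇒∣ᵤ (ℤD.divides (ℤΣ.sum (𝐈ᶻ j)) (≡.trans (≡.sym (ℤΣ.*-distribˡ-sum (+ 2) (𝐈ᶻ j))) (ℤ.*-comm (+ 2) _)))
          fromImage : 2e ∈ image (construction ε C) A → C (λ i → reduce 7 (F i j))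
          fromImage (y , (x , x∈C , y≋) , 2e≋) = 𝔽.IsSubspace.resp subspace (λ i → cong (reduce 7) (≡.sym (F≡x i))) x∈C
            where
            -- The inner product of 2 eⱼ with the image of ε i is computed twice: directly it is F i
            -- j, and pulled back through the isometry it is the i-th coordinate of the preimage,
            -- the integer x i.
            F≡x : ∀ i → F i j ≡ x i
            F≡x i = ι-injective (begin
              ι (F i j)                                ≈⟨ trans (*-congʳ ½*2) (*-identityˡ _) ⟨
              (½ * ι (+ 2)) * ι (F i j)                ≈⟨ trans (*-congʳ (*-comm ½ _)) (*-assoc _ ½ _) ⟩
              ι (+ 2) * (½ * ι (F i j))                ≈⟨ *-congˡ (f≈ i j) ⟨
              ι (+ 2) * f i j                          ≈⟨ *-congˡ (𝐈-∙ j (f i)) ⟨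
              ι (+ 2) * (𝐈 j ∙ f i)                    ≈⟨ ∙-⊛ˡ (ι (+ 2)) (𝐈 j) (f i) ⟨
              (ι (+ 2) ⊛ 𝐈 j) ∙ f i                    ≈⟨ ∙-congʳ {y = f i} (λ k → trans (*-congˡ (sym (ι-𝐈 j k))) (sym (ι-* (+ 2) (𝐈ᶻ j k)))) ⟩
              2e ∙ f i                                 ≈⟨ ∙-congʳ {y = f i} (λ k → trans (2e≋ k) (∙-congʳ {y = transpose A k} y≋)) ⟩
              ((⅐ ⊛ ((ι ∘ x) ᵥ* ε)) ᵥ* A) ∙ (ε i ᵥ* A) ≈⟨ gram-∙ A A-gram (⅐ ⊛ ((ι ∘ x) ᵥ* ε)) (ε i) ⟩
              1# * ((⅐ ⊛ ((ι ∘ x) ᵥ* ε)) ∙ ε i)        ≈⟨ trans (*-identityˡ _) (∙-⊛ˡ ⅐ ((ι ∘ x) ᵥ* ε) (ε i)) ⟩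
              ⅐ * (((ι ∘ x) ᵥ* ε) ∙ ε i)               ≈⟨ *-congˡ (gram-row ε gram (ι ∘ x) i) ⟩
              ⅐ * (ι (+ 7) * ι (x i))                  ≈⟨ trans (sym (*-assoc ⅐ _ _)) (trans (*-congʳ ⅐*7) (*-identityˡ _)) ⟩
              ι (x i)                                  ∎)

-- The Paley frame, and the two directions of the theorem.

module FrameLattices where
  open import Data.Integer.Base using (+_)
  open import Data.Nat.DivMod using (_mod_)
  open import Data.Rational.Base as ℚ using (½)
  open import Data.Vec.Base using (Vec; []; _∷_; lookup)
  open import Data.Vec.Functional using (transpose)
  open import Relation.Binary.PropositionalEquality
  open import Relation.Nullary.Decidable using (_→-dec_)
  open import Relation.Unary using (_∈_)
  open QuadraticResidueCode
  open Checker
  open SkewHadamardCertificate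
  open CheckerSoundness
  open FrameMatrices
  open Equivalence
  open Lattices
  open RealRing using (ℝ-commutativeRing; ≃-pointwise; fromℤ-+; fromℤ-*; fromℤ-injective)
  import Algebra.Properties.Semiring.Sum ℤ.+-*-semiring as ℤΣ
  open Zℤ using () renaming (_∙_ to _∙ᶻ_; 𝐈 to 𝐈ᶻ)
  open MatrixAlgebra.Systematic GF7.GF7-commutativeRing A using (generator)
  open RawRing (GF 7) using () renaming (_*_ to _*₇_; 0# to 0₇)
  open LinearAlgebra (GF 7) using (⟦_⟧) renaming (_∙_ to _∙₇_)

  module ℝA = RawRing ℝ-rawRing

  realScalars : Scalars ℝ-commutativeRing
  realScalars = record
    { ι           = fromℤ
    ; ι-+         = fromℤ-+
    ; ι-*         = fromℤ-*
    ; ι-0         = ≃-pointwise {fromℤ 0ℤ} {ℝA.0#} (λ _ → refl)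
    ; ι-1         = ≃-pointwise {fromℤ 1ℤ} {ℝA.1#} (λ _ → refl)
    ; ι-injective = λ {a} {b} → fromℤ-injective {a} {b}
    ; ½           = fromℚ ½
    ; ½*2         = ≃-pointwise {fromℚ ½ ℝA.* fromℤ (+ 2)} {ℝA.1#} (λ _ → refl)
    ; ⅐           = fromℚ (1ℤ ℚ./ 7)
    ; ⅐*7         = ≃-pointwise {fromℚ (1ℤ ℚ./ 7) ℝA.* fromℤ (+ 7)} {ℝA.1#} (λ _ → refl)
    }

  open LatticeTheory realScalars

  -- The frame 3I + S, where I + S is the skew Hadamard matrix of Paley type, is
  -- 1 + 2B.  Index 0 is the point at infinity; `residues` has the entry 1 at 0,
  -- −1 at the nonzero squares modulo 19 and 0 at the nonsquares.
  residues : Vec ℤ 19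
  residues = + 1 ∷ ℤ.- 1ℤ ∷ + 0 ∷ + 0 ∷ ℤ.- 1ℤ ∷ ℤ.- 1ℤ ∷ ℤ.- 1ℤ ∷ ℤ.- 1ℤ ∷ + 0 ∷ ℤ.- 1ℤ ∷ + 0 ∷ ℤ.- 1ℤ
    ∷ + 0 ∷ + 0 ∷ + 0 ∷ + 0 ∷ ℤ.- 1ℤ ∷ ℤ.- 1ℤ ∷ + 0 ∷ []

  B : Fin 20 → Fin 20 → ℤ
  B zero    zero    = + 1
  B zero    (suc j) = ℤ.- + 1
  B (suc i) zero    = + 0
  B (suc i) (suc j) = lookup residues ((toℕ j ℕ.+ (19 ℕ.∸ toℕ i)) mod 19)

  F : Fin 20 → Fin 20 → ℤ
  F i j = + 1 ℤ.+ + 2 ℤ.* B i j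

  -- Half the row sums of B, that is of 1 - 19 and of 1 - 9. Their integrality puts every vector ½ F
  -- i = ½ 1 + B i into D⁺.
  E : Fin 20 → ℤ
  E zero    = ℤ.- + 9
  E (suc _) = ℤ.- + 4

  ΣB : ∀ i → ℤΣ.sum (B i) ≡ + 2 ℤ.* E i
  ΣB = from-yes (Fin.all? λ i → ℤΣ.sum (B i) ℤ.≟ + 2 ℤ.* E i)

  F-rows : ∀ i k → F i ∙ᶻ F k ≡ + 28 ℤ.* 𝐈ᶻ i k
  F-rows = from-yes (Fin.all? λ i → Fin.all? λ k → F i ∙ᶻ F k ℤ.≟ + 28 ℤ.* 𝐈ᶻ i k)

  F-columns : ∀ j k → transpose F j ∙ᶻ transpose F k ≡ + 28 ℤ.* 𝐈ᶻ j k
  F-columns = from-yes (Fin.all? λ j → Fin.all? λ k → transpose F j ∙ᶻ transpose F k ℤ.≟ + 28 ℤ.* 𝐈ᶻ j k)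

  F-column-orthogonal : ∀ j i → (λ k → reduce 7 (F k j)) ∙₇ generator i ≡ 0₇
  F-column-orthogonal = from-yes (Fin.all? λ j → Fin.all? λ i → (λ k → reduce 7 (F k j)) ∙₇ generator i Fin.≟ 0₇)

  F-column∈QR₂₀ : ∀ j → (λ k → reduce 7 (F k j)) ∈ QR₂₀
  F-column∈QR₂₀ j = proj₂ QR₂₀-selfDual {λ k → reduce 7 (F k j)} λ {y} y∈QR →
    QR.orthogonal-to {λ k → reduce 7 (F k j)} {y} (F-column-orthogonal j) y∈QR

  -- A coincidence would give a word of weight 2 orthogonal to all generators. Excluding it
  -- guarantees that a labelling uses no vertex twice, so a leaf does not have to check this.
  columns-distinct : ∀ c c′ s s′ → (∀ l → ⟦ s ⟧ *₇ generator l c ≡ ⟦ s′ ⟧ *₇ generator l c′) → c ≡ c′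
  columns-distinct c c′ s s′ = distinct s s′ c c′
    where
    distinct? : ∀ s s′ → Dec (∀ c c′ → (∀ l → ⟦ s ⟧ *₇ generator l c ≡ ⟦ s′ ⟧ *₇ generator l c′) → c ≡ c′)
    distinct? s s′ = Fin.all? λ c → Fin.all? λ c′ →
      (Fin.all? λ l → ⟦ s ⟧ *₇ generator l c Fin.≟ ⟦ s′ ⟧ *₇ generator l c′) →-dec c Fin.≟ c′
    distinct : ∀ s s′ c c′ → (∀ l → ⟦ s ⟧ *₇ generator l c ≡ ⟦ s′ ⟧ *₇ generator l c′) → c ≡ c′
    distinct Sign.+ Sign.+ = from-yes (distinct? Sign.+ Sign.+)
    distinct Sign.+ Sign.- = from-yes (distinct? Sign.+ Sign.-)
    distinct Sign.- Sign.+ = from-yes (distinct? Sign.- Sign.+)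
    distinct Sign.- Sign.- = from-yes (distinct? Sign.- Sign.-)

  module _ (ε : ℝMatrix 20 20) (orthogonalBasis : IsOrthogonalBasis 7 ε) where
    open IsOrthogonalBasis orthogonalBasis

    gramᵀ : ∀ j k → LinearAlgebra._∙_ ℝ-rawRing (transpose ε j) (transpose ε k) ℝA.≈ (fromℤ (+ 7) ℝA.* LinearAlgebra.𝐈 ℝ-rawRing j k)
    gramᵀ = basis-columns {20} {ε} basis gram

    QR₂₀-lattice : constructionA 7 ε QR₂₀ ≅ D⁺ 20
    QR₂₀-lattice = Paley.A , record { rows = Paley.rowsᴬ ; columns = Paley.columnsᴬ } , (λ {v} → Paley.D⁺⊆image {v}) , (λ {v} → Paley.image⊆D⁺ {v})
      where
      module Paley = Forward {20} refl ε gram gramᵀ F B E (λ _ _ → refl) ΣB F-rows F-columns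
        QR₂₀-isSubspace (λ {x} {y} x∈QR y∈QR → proj₁ QR₂₀-selfDual {x} x∈QR {y} y∈QR) F-column∈QR₂₀

    unique : (C : Codes.Code 7 20) → Codes.IsSelfDual 7 C → Codes.Is[_,_,_]Code 7 20 10 9 C →
             constructionA 7 ε C ≅ D⁺ 20 → Codes.Equivalent 7 C QR₂₀
    unique C selfDual isCode (O , O-orthogonal , D⁺⊆ , ⊆D⁺) =
      labelling⇒equivalent {10} {20} {C} {QR₂₀} subspace QR₂₀-isSubspace selfDual QR₂₀-selfDual generator QR.basis columns-distinct N.δ
        (Soundness.run-sound generator N.S′ N.diag′ N.off′ N.skew′ N.balanced′ C subspace (λ {x} → minimal {x}) N.δ N.word′∈C
          certificate N.start certificate-accepted)
      where
      open Codes.Is[_,_,_]Code isCode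
      open Codes.HasMinWeight minWeight
      module O-frame = Backward {20} refl ε gram gramᵀ subspace O (LinearAlgebra.IsOrthogonal.rows O-orthogonal)
        (LinearAlgebra.IsOrthogonal.columns O-orthogonal) (λ {v} → D⁺⊆ {v}) (λ {v} → ⊆D⁺ {v})
      module FM = FromFrame refl C subspace (λ {x} → minimal {x}) O-frame.F O-frame.F-odd O-frame.rows O-frame.columns O-frame.column∈C
      module N = Normalise FM.S FM.S-diag FM.S-off FM.S-skew FM.S-balanced C subspace FM.word∈C

open QuadraticResidueCode using (QR₂₀-selfDual)
open MinimumWeight using (QR₂₀-isCode)
open FrameLattices using (QR₂₀-lattice; unique)

theorem1 : (ε : ℝMatrix 20 20) → IsOrthogonalBasis 7 ε →
    ( Codes.IsSelfDual 7 QR₂₀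
    × Codes.Is[_,_,_]Code 7 20 10 9 QR₂₀
    × constructionA 7 ε QR₂₀ ≅ D⁺ 20 )
    × ( (C : Codes.Code 7 20) →
    Codes.IsSelfDual 7 C →
    Codes.Is[_,_,_]Code 7 20 10 9 C →
    constructionA 7 ε C ≅ D⁺ 20 →
    Codes.Equivalent 7 C QR₂₀ )
theorem1 ε basis = (QR₂₀-selfDual , QR₂₀-isCode , QR₂₀-lattice ε basis) , unique ε basis
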